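{- Let $G$ be a connected graph with cyclomatic number $k\ge 1$. Then $H(G)\ge r(G)-\frac{31}{105}(k-1)$. In particular, $H(G)>r(G)-1$ for every connected graph $G$ with cyclomatic number $k$ satisfying $1\le k\le 4$.
   Context: Graphs are finite, simple and undirected. The cyclomatic number of $G$ is $k=|E(G)|-|V(G)|+1$. For a graph $G$ with vertex degrees $d_i=\deg(v_i)$, the Harmonic index is $H(G)=\sum_{v_iv_j\in E(G)} \frac{2}{d_i+d_j}$, the sum being over all edges. The radius $r(G)=\min_{v_i\in V}\max_{v_j\in V}\rho(v_i,v_j)$, where $\rho$ is the shortest-path distance. -}

module Defs where

open import Data.Nat as ℕ using (ℕ; zero; suc)
open import Data.Integer as ℤ using (ℤ; +_)
open import Data.Rational as ℚ using (ℚ; 0ℚ)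
open import Data.Bool using (Bool; true; false; if_then_else_)
open import Data.Fin using (Fin; toℕ)
open import Data.List using (List; map; foldr; allFin)
open import Data.Product using (Σ; ∃; _×_; _,_)
open import Relation.Binary.PropositionalEquality using (_≡_)
open import Relation.Nullary using (yes; no)

record Graph (n : ℕ) : Set where
  field
    adj    : Fin n → Fin n → Bool
    sym    : ∀ i j → adj i j ≡ adj j i
    irrefl : ∀ i → adj i i ≡ false
open Graph public

sumℕ : List ℕ → ℕ
sumℕ = foldr ℕ._+_ 0

sumℚ : List ℚ → ℚ
sumℚ = foldr ℚ._+_ 0ℚ

deg : ∀ {n} → Graph n → Fin n → ℕ
deg {n} G i = sumℕ (map (λ j → if adj G i j then 1 else 0) (allFin n))

edgeCount : ∀ {n} → Graph n → ℕ
edgeCount {n} G =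
  sumℕ (map (λ i → sumℕ (map (λ j → edgeInd i j) (allFin n))) (allFin n))
  where
  edgeInd : Fin n → Fin n → ℕ
  edgeInd i j with toℕ i ℕ.<? toℕ j
  ... | yes _ = if adj G i j then 1 else 0
  ... | no  _ = 0

cyclomatic : ∀ {n} → Graph n → ℤ
cyclomatic {n} G = (+ edgeCount G) ℤ.- (+ n) ℤ.+ (+ 1)

-- 2 / (d_i + d_j); the sum d_i + d_j is ≥ 2 for every edge, so the zero case never
-- contributes for an actual edge (it is only needed to make division total).
harmonicTerm : ℕ → ℚ
harmonicTerm zero    = 0ℚ
harmonicTerm (suc m) = (+ 2) ℚ./ suc m

harmonic : ∀ {n} → Graph n → ℚ
harmonic {n} G =
  sumℚ (map (λ i → sumℚ (map (λ j → term i j) (allFin n))) (allFin n))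
  where
  term : Fin n → Fin n → ℚ
  term i j with toℕ i ℕ.<? toℕ j
  ... | yes _ = if adj G i j then harmonicTerm (deg G i ℕ.+ deg G j) else 0ℚ
  ... | no  _ = 0ℚ

data Walk {n : ℕ} (G : Graph n) : Fin n → Fin n → ℕ → Set where
  here : ∀ {u} → Walk G u u 0
  step : ∀ {u v w ℓ} → adj G u v ≡ true → Walk G v w ℓ → Walk G u w (suc ℓ)

Connected : ∀ {n} → Graph n → Set
Connected G = ∀ u v → ∃ λ ℓ → Walk G u v ℓ

IsDist : ∀ {n} → Graph n → Fin n → Fin n → ℕ → Set
IsDist G u v d = Walk G u v d × (∀ m → Walk G u v m → d ℕ.≤ m)

IsEcc : ∀ {n} → Graph n → Fin n → ℕ → Set
IsEcc {n} G u e =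
  (Σ (Fin n) λ v → IsDist G u v e) × (∀ v d → IsDist G u v d → d ℕ.≤ e)

IsRadius : ∀ {n} → Graph n → ℕ → Set
IsRadius {n} G r =
  (Σ (Fin n) λ u → IsEcc G u r) × (∀ u e → IsEcc G u e → r ℕ.≤ e)

{-# OPTIONS --safe #-}
module Submission where

-- The degree sum shows that G has an edge xy whose deletion leaves G connected. Orienting a spanning tree of G − xy
-- towards x and adding the arc x → y gives a map f without 2-cycles along edges of G under which every vertex runs
-- into x; its edges {v, f v} form a connected spanning unicyclic subgraph U. The other k − 1 edges are deleted one by
-- one. The ends u, v of such an edge keep the neighbours f u, f v of degree at least two, so with t(s) = 2/s one
-- deletion raises H by at most the maximum of φ(a) + φ(b) − t(a + b) over the end degrees, which is 31/105
-- (attained for a = b = 5). As r only grows under deletion, it remains to see that r ≤ H(U).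
--
-- H(U) is bounded below by building U up from its cycle, of length g and with H = g/2. Attaching a leaf never lowers
-- H; it raises H by at least 1/2 if it prolongs a leaf, and by at least 3/10 if it is the first vertex attached at a
-- cycle vertex. Let h₁ be the largest height of a tree hanging off the cycle, h₂ the largest height at another root,
-- and p = ⌊g/2⌋. Then H(U) ≥ g/2 + (h₁ + h₂)/2 − 2/5. If h₁ ≤ p + h₂, the root of the tallest tree has
-- eccentricity at most p + h₂, which is enough unless g is even and h₁ = h₂; then either a third tree of height two or
-- four trees supply the missing 2/5, or some cycle vertex is antipodal to no tree and has eccentricity at most
-- p + h₁ − 1. If h₁ ≥ p + h₂, the centre lies on the longest path from the tallest tree to the cycle, and that path
-- with the farthest branch off it bounds H(U).

open import Defs renaming (here to walk-here; step to walk-step; sym to adj-sym; irrefl to adj-irrefl)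
open import Algebra.Bundles using (CommutativeMonoid)
open import Data.Bool using (Bool; true; false; if_then_else_; not; _∧_; _∨_)
import Data.Bool.Properties as Bool
open import Data.Empty using (⊥; ⊥-elim)
open import Data.Fin as Fin using (Fin; zero; suc; toℕ; punchIn)
import Data.Fin.Properties as Finₚ
open import Data.Integer as ℤ using (ℤ; +_)
import Data.Integer.Properties as ℤₚ
import Data.Integer.Tactic.RingSolver as ℤ-Solver
open import Data.List using (List; []; _∷_; map; foldr; allFin; tabulate)
open import Data.List.Membership.DecPropositional using () renaming (_∈?_ to ∈?)
open import Data.List.Membership.Propositional using (_∈_; _∉_)
open import Data.List.Properties using (map-tabulate)
open import Data.List.Relation.Unary.Any using (here; there)
open import Data.Nat as ℕ using (ℕ; zero; suc; z≤n; s≤s)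
open import Data.Nat.DivMod using (_%_; _/_; m≡m%n+[m/n]*n; m%n<n)
import Data.Nat.Properties as ℕₚ
open import Data.Nat.Tactic.RingSolver using (solve-∀)
open import Data.Product using (Σ; ∃; _×_; _,_; proj₁; proj₂)
open import Data.Rational as ℚ using (ℚ; 0ℚ)
import Data.Rational.Properties as ℚₚ
open import Data.Rational.Solver using (module +-*-Solver)
import Data.Rational.Unnormalised as ℚᵘ
import Data.Rational.Unnormalised.Properties as ℚᵘₚ
open import Data.Sum using (_⊎_; inj₁; inj₂)
open import Function using (_∘_; id)
open import Relation.Binary.Definitions using (tri<; tri≈; tri>)
open import Relation.Binary.PropositionalEquality using (_≡_; _≢_; refl; sym; trans; cong; cong₂; subst; subst₂; module ≡-Reasoning)
open import Relation.Nullary using (¬_; Dec; yes; no; does)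
open import Relation.Nullary.Decidable using (True; toWitness; from-yes; dec-true; dec-false; ¬?; _×-dec_)
open import Algebra.Properties.Monoid.Mult ℚₚ.+-0-monoid using () renaming (_×_ to _⊠_)
open +-*-Solver using (solve; _:+_; _:-_; :-_; _:=_; con)

-- Fractions, and the estimate behind the constant 31/105

-- Opaque, so that unification does not normalise fractions with variable denominators.
abstract
  frac : ℕ → ℕ → ℚ
  frac m q = (+ m) ℚ./ suc q

  frac-≤ : ∀ m q m′ q′ → m ℕ.* suc q′ ℕ.≤ m′ ℕ.* suc q → frac m q ℚ.≤ frac m′ q′
  frac-≤ m q m′ q′ le = ℚₚ.toℚᵘ-cancel-≤ (begin
    ℚ.toℚᵘ (frac m q)    ≃⟨ ℚₚ.toℚᵘ-fromℚᵘ (ℚᵘ.mkℚᵘ (+ m) q) ⟩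
    ℚᵘ.mkℚᵘ (+ m) q      ≤⟨ ℚᵘ.*≤* (subst₂ ℤ._≤_ (ℤₚ.pos-* m (suc q′)) (ℤₚ.pos-* m′ (suc q)) (ℤ.+≤+ le)) ⟩
    ℚᵘ.mkℚᵘ (+ m′) q′    ≃⟨ ℚᵘₚ.≃-sym (ℚₚ.toℚᵘ-fromℚᵘ (ℚᵘ.mkℚᵘ (+ m′) q′)) ⟩
    ℚ.toℚᵘ (frac m′ q′)  ∎)
    where open ℚᵘₚ.≤-Reasoning

  frac-≡ : ∀ m q m′ q′ → m ℕ.* suc q′ ≡ m′ ℕ.* suc q → frac m q ≡ frac m′ q′
  frac-≡ m q m′ q′ eq =
    ℚₚ.≤-antisym (frac-≤ m q m′ q′ (ℕₚ.≤-reflexive eq)) (frac-≤ m′ q′ m q (ℕₚ.≤-reflexive (sym eq)))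

  -- The denominator argument is what `suc q * suc q′` reduces to, less one, so it agrees with
  -- unnormalised addition by computation.
  frac-+ : ∀ m q m′ q′ →
    frac m q ℚ.+ frac m′ q′ ≡ frac (m ℕ.* suc q′ ℕ.+ m′ ℕ.* suc q) (q′ ℕ.+ q ℕ.* suc q′)
  frac-+ m q m′ q′ = ℚₚ.toℚᵘ-injective (begin-equality
    ℚ.toℚᵘ (frac m q ℚ.+ frac m′ q′)
      ≃⟨ ℚₚ.toℚᵘ-homo-+ (frac m q) (frac m′ q′) ⟩
    ℚ.toℚᵘ (frac m q) ℚᵘ.+ ℚ.toℚᵘ (frac m′ q′)
      ≃⟨ ℚᵘₚ.+-cong (ℚₚ.toℚᵘ-fromℚᵘ (ℚᵘ.mkℚᵘ (+ m) q)) (ℚₚ.toℚᵘ-fromℚᵘ (ℚᵘ.mkℚᵘ (+ m′) q′)) ⟩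
    ℚᵘ.mkℚᵘ (+ m) q ℚᵘ.+ ℚᵘ.mkℚᵘ (+ m′) q′
      ≡⟨ cong (λ z → ℚᵘ.mkℚᵘ z (q′ ℕ.+ q ℕ.* suc q′))
           (trans (cong₂ ℤ._+_ (sym (ℤₚ.pos-* m (suc q′))) (sym (ℤₚ.pos-* m′ (suc q)))) refl) ⟩
    ℚᵘ.mkℚᵘ (+ (m ℕ.* suc q′ ℕ.+ m′ ℕ.* suc q)) (q′ ℕ.+ q ℕ.* suc q′)
      ≃⟨ ℚᵘₚ.≃-sym (ℚₚ.toℚᵘ-fromℚᵘ _) ⟩
    ℚ.toℚᵘ (frac (m ℕ.* suc q′ ℕ.+ m′ ℕ.* suc q) (q′ ℕ.+ q ℕ.* suc q′)) ∎)
    where open ℚᵘₚ.≤-Reasoning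

  frac-* : ∀ m q m′ q′ → frac m q ℚ.* frac m′ q′ ≡ frac (m ℕ.* m′) (q′ ℕ.+ q ℕ.* suc q′)
  frac-* m q m′ q′ = ℚₚ.toℚᵘ-injective (begin-equality
    ℚ.toℚᵘ (frac m q ℚ.* frac m′ q′)
      ≃⟨ ℚₚ.toℚᵘ-homo-* (frac m q) (frac m′ q′) ⟩
    ℚ.toℚᵘ (frac m q) ℚᵘ.* ℚ.toℚᵘ (frac m′ q′)
      ≃⟨ ℚᵘₚ.*-cong (ℚₚ.toℚᵘ-fromℚᵘ (ℚᵘ.mkℚᵘ (+ m) q)) (ℚₚ.toℚᵘ-fromℚᵘ (ℚᵘ.mkℚᵘ (+ m′) q′)) ⟩
    ℚᵘ.mkℚᵘ (+ m) q ℚᵘ.* ℚᵘ.mkℚᵘ (+ m′) q′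
      ≡⟨ cong (λ z → ℚᵘ.mkℚᵘ z (q′ ℕ.+ q ℕ.* suc q′)) (sym (ℤₚ.pos-* m m′)) ⟩
    ℚᵘ.mkℚᵘ (+ (m ℕ.* m′)) (q′ ℕ.+ q ℕ.* suc q′)
      ≃⟨ ℚᵘₚ.≃-sym (ℚₚ.toℚᵘ-fromℚᵘ _) ⟩
    ℚ.toℚᵘ (frac (m ℕ.* m′) (q′ ℕ.+ q ℕ.* suc q′)) ∎)
    where open ℚᵘₚ.≤-Reasoning

  harmonicTerm-frac : ∀ m → harmonicTerm (suc m) ≡ frac 2 m
  harmonicTerm-frac m = refl

  frac-/ : ∀ m q → (+ m) ℚ./ suc q ≡ frac m q
  frac-/ m q = refl

frac-+-same : ∀ m m′ q → frac m q ℚ.+ frac m′ q ≡ frac (m ℕ.+ m′) q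
frac-+-same m m′ q = trans (frac-+ m q m′ q)
  (frac-≡ (m ℕ.* suc q ℕ.+ m′ ℕ.* suc q) (q ℕ.+ q ℕ.* suc q) (m ℕ.+ m′) q (lemma m m′ q))
  where
  lemma : ∀ m m′ q → (m ℕ.* suc q ℕ.+ m′ ℕ.* suc q) ℕ.* suc q ≡ (m ℕ.+ m′) ℕ.* suc (q ℕ.+ q ℕ.* suc q)
  lemma = solve-∀

frac-0 : frac 0 0 ≡ 0ℚ
frac-0 = sym (frac-/ 0 0)

frac-⊠ : ∀ k m q → k ⊠ frac m q ≡ frac (k ℕ.* m) q
frac-⊠ zero    m q = trans (sym frac-0) (frac-≡ 0 0 0 q refl)
frac-⊠ (suc k) m q = trans (cong (frac m q ℚ.+_) (frac-⊠ k m q)) (frac-+-same m (k ℕ.* m) q)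

frac-mono : ∀ {m m′} q → m ℕ.≤ m′ → frac m q ℚ.≤ frac m′ q
frac-mono {m} {m′} q le = frac-≤ m q m′ q (ℕₚ.*-monoˡ-≤ (suc q) le)

0≤frac : ∀ m q → 0ℚ ℚ.≤ frac m q
0≤frac m q = subst (ℚ._≤ frac m q) frac-0 (frac-≤ 0 0 m q z≤n)

+-cancelʳ-≤ : ∀ r {p q} → p ℚ.+ r ℚ.≤ q ℚ.+ r → p ℚ.≤ q
+-cancelʳ-≤ r {p} {q} le = subst₂ ℚ._≤_ (lemma p r) (lemma q r) (ℚₚ.+-monoˡ-≤ (ℚ.- r) le)
  where

  lemma : ∀ p r → p ℚ.+ r ℚ.+ ℚ.- r ≡ p
  lemma = solve 2 (λ p r → p :+ r :+ :- r := p) refl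

-- H is computed through sums over ordered pairs, which count every edge twice; this removes the
-- factor.
double-cancel-≤ : ∀ {p q} → p ℚ.+ p ℚ.≤ q ℚ.+ q → p ℚ.≤ q
double-cancel-≤ {p} {q} le with p ℚ.≤? q
... | yes p≤q = p≤q
... | no  p≰q = ⊥-elim (ℚₚ.<-irrefl refl (ℚₚ.<-≤-trans (ℚₚ.+-mono-< (ℚₚ.≰⇒> p≰q) (ℚₚ.≰⇒> p≰q)) le))

t : ℕ → ℚ
t zero    = 0ℚ
t (suc m) = frac 2 m

harmonicTerm≡t : ∀ s → harmonicTerm s ≡ t s
harmonicTerm≡t zero    = refl
harmonicTerm≡t (suc m) = harmonicTerm-frac m

-- The drop of the term of an edge with degree sum s when one of its ends gains a neighbour.
δ : ℕ → ℚ
δ s = t s ℚ.- t (suc s)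

t-δ : ∀ s → t s ≡ t (suc s) ℚ.+ δ s
t-δ s = lemma (t s) (t (suc s))
  where

  lemma : ∀ a b → a ≡ b ℚ.+ (a ℚ.- b)
  lemma = solve 2 (λ a b → a := b :+ (a :- b)) refl

-- With s = m + 1 the value is 2/(s(s + 1)); `frac` takes the denominator less one.
δ-frac : ∀ m → δ (suc m) ≡ frac 2 (suc m ℕ.+ m ℕ.* suc (suc m))
δ-frac m = trans (cong (ℚ._- t (suc (suc m))) eq) (lemma (frac 2 _) (t (suc (suc m))))
  where

  lemma : ∀ a b → (a ℚ.+ b) ℚ.- b ≡ a
  lemma = solve 2 (λ a b → (a :+ b) :- b := a) refl
  poly : ∀ m → 2 ℕ.* suc (suc m ℕ.+ (suc m ℕ.+ m ℕ.* suc (suc m)) ℕ.* suc (suc m))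
             ≡ (2 ℕ.* suc (suc m) ℕ.+ 2 ℕ.* suc (suc m ℕ.+ m ℕ.* suc (suc m))) ℕ.* suc m
  poly = solve-∀
  eq : t (suc m) ≡ frac 2 (suc m ℕ.+ m ℕ.* suc (suc m)) ℚ.+ t (suc (suc m))
  eq = trans (frac-≡ 2 m _ _ (poly m)) (sym (frac-+ 2 _ 2 (suc m)))

δ-anti : ∀ {m k} → m ℕ.≤ k → δ (suc k) ℚ.≤ δ (suc m)
δ-anti {m} {k} m≤k = subst₂ ℚ._≤_ (sym (δ-frac k)) (sym (δ-frac m))
  (frac-≤ 2 _ 2 _ (ℕₚ.*-monoʳ-≤ 2 (s≤s (ℕₚ.+-mono-≤ (s≤s m≤k) (ℕₚ.*-mono-≤ m≤k (s≤s (s≤s m≤k)))))))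

t-anti : ∀ {m k} → m ℕ.≤ k → t (suc k) ℚ.≤ t (suc m)
t-anti {m} {k} m≤k = frac-≤ 2 k 2 m (ℕₚ.*-monoʳ-≤ 2 (s≤s m≤k))

-- If a leaf is attached to a vertex of degree d, the old terms there lose at most d δ(d + 1), the
-- case in which all neighbours are leaves, and the new edge contributes t(d + 2). Hence attaching a
-- leaf never lowers H.
⊠-δ≤t : ∀ d → d ⊠ δ (suc d) ℚ.≤ t (suc (suc d))
⊠-δ≤t d = subst (ℚ._≤ t (suc (suc d))) (sym (trans (cong (d ⊠_) (δ-frac d)) (frac-⊠ d 2 _)))
  (frac-≤ (d ℕ.* 2) _ 2 (suc d) (subst (d ℕ.* 2 ℕ.* suc (suc d) ℕ.≤_) (poly d) (ℕₚ.m≤m+n _ _)))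
  where
  poly : ∀ d → d ℕ.* 2 ℕ.* suc (suc d) ℕ.+ (2 ℕ.* d ℕ.+ 4) ≡ 2 ℕ.* suc (suc d ℕ.+ d ℕ.* suc (suc d))
  poly = solve-∀

-- φ (a − 2) = (a − 2) δ(a) + δ(a + 1) bounds the change of the terms at an end of degree a of a deleted edge, if one
-- further neighbour has degree at least two; the others may be leaves.
φ : ℕ → ℚ
φ a = frac (2 ℕ.* a ℕ.* a ℕ.+ 10 ℕ.* a ℕ.+ 4) (23 ℕ.+ 26 ℕ.* a ℕ.+ 9 ℕ.* a ℕ.* a ℕ.+ a ℕ.* a ℕ.* a)

φ-def : ∀ a → a ⊠ δ (2 ℕ.+ a) ℚ.+ δ (3 ℕ.+ a) ≡ φ a
φ-def a = begin
  a ⊠ δ (2 ℕ.+ a) ℚ.+ δ (3 ℕ.+ a)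
    ≡⟨ cong₂ ℚ._+_ (trans (cong (a ⊠_) (δ-frac (suc a))) (frac-⊠ a 2 _)) (δ-frac (2 ℕ.+ a)) ⟩
  frac (a ℕ.* 2) _ ℚ.+ frac 2 _
    ≡⟨ frac-+ (a ℕ.* 2) _ 2 _ ⟩
  frac _ _
    ≡⟨ frac-≡ _ _ _ _ (poly a) ⟩
  φ a ∎
  where
  open ≡-Reasoning
  poly : ∀ a →
    (a ℕ.* 2 ℕ.* suc (3 ℕ.+ a ℕ.+ (2 ℕ.+ a) ℕ.* (4 ℕ.+ a)) ℕ.+ 2 ℕ.* suc (2 ℕ.+ a ℕ.+ (1 ℕ.+ a) ℕ.* (3 ℕ.+ a)))
      ℕ.* suc (23 ℕ.+ 26 ℕ.* a ℕ.+ 9 ℕ.* a ℕ.* a ℕ.+ a ℕ.* a ℕ.* a)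
    ≡ (2 ℕ.* a ℕ.* a ℕ.+ 10 ℕ.* a ℕ.+ 4) ℕ.*
      suc ((3 ℕ.+ a ℕ.+ (2 ℕ.+ a) ℕ.* (4 ℕ.+ a)) ℕ.+ (2 ℕ.+ a ℕ.+ (1 ℕ.+ a) ℕ.* (3 ℕ.+ a)) ℕ.* suc (3 ℕ.+ a ℕ.+ (2 ℕ.+ a) ℕ.* (4 ℕ.+ a)))
  poly = solve-∀

frac-≤-dec : ∀ m q m′ q′ → {True (m ℕ.* suc q′ ℕ.≤? m′ ℕ.* suc q)} → frac m q ℚ.≤ frac m′ q′
frac-≤-dec m q m′ q′ {w} = frac-≤ m q m′ q′ (toWitness w)

m+n≡o⇒m≤o : ∀ m n {o} → m ℕ.+ n ≡ o → m ℕ.≤ o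
m+n≡o⇒m≤o m n refl = ℕₚ.m≤m+n m n

-- The split 31/105 = 4/15 + 1/35 settles the case in which one end has degree at most four. This is
-- the first part, attained at 1 and 2.
φ-≤-4/15 : ∀ a → a ℕ.≤ 2 → φ a ℚ.≤ frac 4 14
φ-≤-4/15 0 _ = frac-≤-dec _ _ 4 14
φ-≤-4/15 1 _ = frac-≤-dec _ _ 4 14
φ-≤-4/15 2 _ = frac-≤-dec _ _ 4 14
φ-≤-4/15 (suc (suc (suc _))) (s≤s (s≤s ()))

-- The other part of the split; the argument is 6 + b because 4 + (a + b) ≤ 6 + b for a ≤ 2.
φ-≤-t : ∀ b → φ b ℚ.≤ t (6 ℕ.+ b) ℚ.+ frac 1 34
φ-≤-t b = subst (φ b ℚ.≤_) (sym (frac-+ 2 (5 ℕ.+ b) 1 34)) (go b)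
  where
  poly : ∀ y → (2 ℕ.* (7 ℕ.+ y) ℕ.* (7 ℕ.+ y) ℕ.+ 10 ℕ.* (7 ℕ.+ y) ℕ.+ 4) ℕ.* suc (34 ℕ.+ (5 ℕ.+ (7 ℕ.+ y)) ℕ.* 35)
    ℕ.+ (y ℕ.* (y ℕ.* (y ℕ.* (y ℕ.+ 43) ℕ.+ 549) ℕ.+ 2497) ℕ.+ 3910)
    ≡ (2 ℕ.* 35 ℕ.+ 1 ℕ.* suc (5 ℕ.+ (7 ℕ.+ y))) ℕ.* suc (23 ℕ.+ 26 ℕ.* (7 ℕ.+ y) ℕ.+ 9 ℕ.* (7 ℕ.+ y) ℕ.* (7 ℕ.+ y) ℕ.+ (7 ℕ.+ y) ℕ.* (7 ℕ.+ y) ℕ.* (7 ℕ.+ y))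
  poly = solve-∀
  go : ∀ b → φ b ℚ.≤ frac (2 ℕ.* 35 ℕ.+ 1 ℕ.* suc (5 ℕ.+ b)) (34 ℕ.+ (5 ℕ.+ b) ℕ.* 35)
  go 0 = frac-≤-dec _ _ _ _
  go 1 = frac-≤-dec _ _ _ _
  go 2 = frac-≤-dec _ _ _ _
  go 3 = frac-≤-dec _ _ _ _
  go 4 = frac-≤-dec _ _ _ _
  go 5 = frac-≤-dec _ _ _ _
  go 6 = frac-≤-dec _ _ _ _
  -- With b = 7 + y the difference of the cross products is a polynomial in y with coefficients in
  -- ℕ; the smaller b are computed.
  go (suc (suc (suc (suc (suc (suc (suc y))))))) =
    frac-≤ _ _ _ _ (m+n≡o⇒m≤o _ _ (poly y))

-- One more unit of degree lowers φ by at least the drop of t at 10 + y, hence by at least its drop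
-- at any larger sum. This drives the induction starting from the extremal pair.
φ-step : ∀ y → φ (4 ℕ.+ y) ℚ.+ δ (10 ℕ.+ y) ℚ.≤ φ (3 ℕ.+ y)
φ-step y = subst (ℚ._≤ φ (3 ℕ.+ y))
  (sym (trans (cong (φ (4 ℕ.+ y) ℚ.+_) (δ-frac (9 ℕ.+ y))) (frac-+ _ _ _ _)))
  (frac-≤ _ _ _ _ (m+n≡o⇒m≤o _ _ (poly y)))
  where
  poly : ∀ y →
      ((2 ℕ.* (4 ℕ.+ y) ℕ.* (4 ℕ.+ y) ℕ.+ 10 ℕ.* (4 ℕ.+ y) ℕ.+ 4)
         ℕ.* suc (suc (9 ℕ.+ y) ℕ.+ (9 ℕ.+ y) ℕ.* suc (suc (9 ℕ.+ y)))
       ℕ.+ 2 ℕ.* suc (23 ℕ.+ 26 ℕ.* (4 ℕ.+ y) ℕ.+ 9 ℕ.* (4 ℕ.+ y) ℕ.* (4 ℕ.+ y) ℕ.+ (4 ℕ.+ y) ℕ.* (4 ℕ.+ y) ℕ.* (4 ℕ.+ y)))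
         ℕ.* suc (23 ℕ.+ 26 ℕ.* (3 ℕ.+ y) ℕ.+ 9 ℕ.* (3 ℕ.+ y) ℕ.* (3 ℕ.+ y) ℕ.+ (3 ℕ.+ y) ℕ.* (3 ℕ.+ y) ℕ.* (3 ℕ.+ y))
      ℕ.+ (y ℕ.* (y ℕ.* (y ℕ.* (y ℕ.* (y ℕ.* 12 ℕ.+ 372) ℕ.+ 4356) ℕ.+ 23244) ℕ.+ 51648) ℕ.+ 25200)
      ≡ (2 ℕ.* (3 ℕ.+ y) ℕ.* (3 ℕ.+ y) ℕ.+ 10 ℕ.* (3 ℕ.+ y) ℕ.+ 4)
         ℕ.* suc ((suc (9 ℕ.+ y) ℕ.+ (9 ℕ.+ y) ℕ.* suc (suc (9 ℕ.+ y)))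
                  ℕ.+ (23 ℕ.+ 26 ℕ.* (4 ℕ.+ y) ℕ.+ 9 ℕ.* (4 ℕ.+ y) ℕ.* (4 ℕ.+ y) ℕ.+ (4 ℕ.+ y) ℕ.* (4 ℕ.+ y) ℕ.* (4 ℕ.+ y))
                      ℕ.* suc (suc (9 ℕ.+ y) ℕ.+ (9 ℕ.+ y) ℕ.* suc (suc (9 ℕ.+ y))))
  poly = solve-∀

φφ-≤-suc : ∀ x y → φ (3 ℕ.+ x) ℚ.+ φ (3 ℕ.+ y) ℚ.≤ t (10 ℕ.+ (x ℕ.+ y)) ℚ.+ frac 31 104 →
  φ (3 ℕ.+ x) ℚ.+ φ (4 ℕ.+ y) ℚ.≤ t (11 ℕ.+ (x ℕ.+ y)) ℚ.+ frac 31 104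
φφ-≤-suc x y ih = +-cancelʳ-≤ d (begin
  φ (3 ℕ.+ x) ℚ.+ φ (4 ℕ.+ y) ℚ.+ d
    ≤⟨ ℚₚ.+-monoʳ-≤ (φ (3 ℕ.+ x) ℚ.+ φ (4 ℕ.+ y)) (δ-anti (ℕₚ.+-monoʳ-≤ 9 (ℕₚ.m≤n+m y x))) ⟩
  φ (3 ℕ.+ x) ℚ.+ φ (4 ℕ.+ y) ℚ.+ δ (10 ℕ.+ y)
    ≡⟨ ℚₚ.+-assoc (φ (3 ℕ.+ x)) (φ (4 ℕ.+ y)) (δ (10 ℕ.+ y)) ⟩
  φ (3 ℕ.+ x) ℚ.+ (φ (4 ℕ.+ y) ℚ.+ δ (10 ℕ.+ y))
    ≤⟨ ℚₚ.+-monoʳ-≤ (φ (3 ℕ.+ x)) (φ-step y) ⟩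
  φ (3 ℕ.+ x) ℚ.+ φ (3 ℕ.+ y)
    ≤⟨ ih ⟩
  t (10 ℕ.+ (x ℕ.+ y)) ℚ.+ frac 31 104
    ≡⟨ cong (ℚ._+ frac 31 104) (t-δ (10 ℕ.+ (x ℕ.+ y))) ⟩
  t (11 ℕ.+ (x ℕ.+ y)) ℚ.+ d ℚ.+ frac 31 104
    ≡⟨ solve 3 (λ a b c → a :+ b :+ c := a :+ c :+ b) refl (t (11 ℕ.+ (x ℕ.+ y))) d (frac 31 104) ⟩
  t (11 ℕ.+ (x ℕ.+ y)) ℚ.+ frac 31 104 ℚ.+ d ∎)
  where
  open ℚₚ.≤-Reasoning
  d = δ (10 ℕ.+ (x ℕ.+ y))

-- The bound is attained at 3, 3, that is, for two ends of degree 5.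
φφ-≤-large : ∀ x y → φ (3 ℕ.+ x) ℚ.+ φ (3 ℕ.+ y) ℚ.≤ t (10 ℕ.+ (x ℕ.+ y)) ℚ.+ frac 31 104
φφ-≤-large zero zero = subst₂ ℚ._≤_ (sym (frac-+ _ _ _ _)) (sym (frac-+ 2 9 31 104)) (frac-≤-dec _ _ _ _)
φφ-≤-large x (suc y) = subst (λ s → φ (3 ℕ.+ x) ℚ.+ φ (4 ℕ.+ y) ℚ.≤ t (10 ℕ.+ s) ℚ.+ frac 31 104)
  (sym (ℕₚ.+-suc x y)) (φφ-≤-suc x y (φφ-≤-large x y))
φφ-≤-large (suc x) zero = subst₂ (λ p s → p ℚ.≤ t (11 ℕ.+ s) ℚ.+ frac 31 104)
  (ℚₚ.+-comm (φ 3) (φ (4 ℕ.+ x))) (ℕₚ.+-comm 0 x)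
  (φφ-≤-suc 0 x (subst₂ (λ p s → p ℚ.≤ t (10 ℕ.+ s) ℚ.+ frac 31 104)
    (ℚₚ.+-comm (φ (3 ℕ.+ x)) (φ 3)) (ℕₚ.+-comm x 0) (φφ-≤-large x 0)))

φφ-≤-small : ∀ a b → a ℕ.≤ 2 → φ a ℚ.+ φ b ℚ.≤ t (4 ℕ.+ (a ℕ.+ b)) ℚ.+ frac 31 104
φφ-≤-small a b a≤2 = begin
  φ a ℚ.+ φ b
    ≤⟨ ℚₚ.+-mono-≤ (φ-≤-4/15 a a≤2) (φ-≤-t b) ⟩
  frac 4 14 ℚ.+ (t (6 ℕ.+ b) ℚ.+ frac 1 34)
    ≡⟨ solve 3 (λ x y z → x :+ (y :+ z) := y :+ (x :+ z)) refl (frac 4 14) (t (6 ℕ.+ b)) (frac 1 34) ⟩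
  t (6 ℕ.+ b) ℚ.+ (frac 4 14 ℚ.+ frac 1 34)
    ≤⟨ ℚₚ.+-mono-≤ (t-anti (ℕₚ.+-monoʳ-≤ 3 (ℕₚ.+-monoˡ-≤ b a≤2)))
         (ℚₚ.≤-reflexive (trans (frac-+ 4 14 1 34) (frac-≡ _ _ 31 104 refl))) ⟩
  t (4 ℕ.+ (a ℕ.+ b)) ℚ.+ frac 31 104 ∎
  where open ℚₚ.≤-Reasoning

φφ-≤ : ∀ a b → φ a ℚ.+ φ b ℚ.≤ t (4 ℕ.+ (a ℕ.+ b)) ℚ.+ frac 31 104
φφ-≤ 0 b = φφ-≤-small 0 b z≤n
φφ-≤ 1 b = φφ-≤-small 1 b (s≤s z≤n)
φφ-≤ 2 b = φφ-≤-small 2 b (s≤s (s≤s z≤n))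
φφ-≤ a@(suc (suc (suc x))) b with b ℕ.≤? 2
... | yes b≤2 = subst₂ (λ p s → p ℚ.≤ t (4 ℕ.+ s) ℚ.+ frac 31 104) (ℚₚ.+-comm (φ b) (φ a)) (ℕₚ.+-comm b a)
                  (φφ-≤-small b a b≤2)
φφ-≤ (suc (suc (suc x))) (suc (suc (suc y))) | no _ =
  subst (λ s → φ (3 ℕ.+ x) ℚ.+ φ (3 ℕ.+ y) ℚ.≤ t s ℚ.+ frac 31 104) (shift x y) (φφ-≤-large x y)
  where
  shift : ∀ x y → 10 ℕ.+ (x ℕ.+ y) ≡ 4 ℕ.+ ((3 ℕ.+ x) ℕ.+ (3 ℕ.+ y))
  shift = solve-∀
φφ-≤ (suc (suc (suc x))) 0 | no b≰2 = ⊥-elim (b≰2 z≤n)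
φφ-≤ (suc (suc (suc x))) 1 | no b≰2 = ⊥-elim (b≰2 (s≤s z≤n))
φφ-≤ (suc (suc (suc x))) 2 | no b≰2 = ⊥-elim (b≰2 (s≤s (s≤s z≤n)))

-- Sums over vertices

module SumLemmas {c ℓ} (M : CommutativeMonoid c ℓ) where
  open CommutativeMonoid M hiding (refl; sym; trans)
  open CommutativeMonoid M using () renaming (refl to ≈-refl; sym to ≈-sym; trans to ≈-trans; reflexive to ≈-reflexive)
  open import Algebra.Properties.CommutativeMonoid.Sum M public
  open import Relation.Binary.Reasoning.Setoid setoid
  open import Algebra.Properties.CommutativeSemigroup commutativeSemigroup using (xy∙z≈xz∙y)

  when : Bool → Carrier → Carrier
  when b x = if b then x else ε

  foldr-allFin : ∀ {n} (f : Fin n → Carrier) → foldr _∙_ ε (map f (allFin n)) ≡ sum f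
  foldr-allFin f = trans (cong (foldr _∙_ ε) (map-tabulate id f)) (foldr-tabulate f)
    where
    foldr-tabulate : ∀ {n} (f : Fin n → Carrier) → foldr _∙_ ε (tabulate f) ≡ sum f
    foldr-tabulate {zero}  f = refl
    foldr-tabulate {suc n} f = cong (f zero ∙_) (foldr-tabulate (f ∘ suc))

  sum-zero : ∀ {n} {f : Fin n → Carrier} → (∀ j → f j ≈ ε) → sum f ≈ ε
  sum-zero {n} f≈ε = ≈-trans (sum-cong-≋ f≈ε) (sum-replicate-zero n)

  -- Stated crosswise, since a commutative monoid has no subtraction.
  sum-change : ∀ {n} {f g : Fin n → Carrier} (u : Fin n) → (∀ j → j ≢ u → f j ≈ g j) →
    sum f ∙ g u ≈ sum g ∙ f u
  sum-change {suc n} {f} {g} u f≈g = begin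
    sum f ∙ g u
      ≈⟨ ∙-congʳ (sum-remove {i = u} f) ⟩
    f u ∙ sum (f ∘ punchIn u) ∙ g u
      ≈⟨ ∙-congʳ (∙-congˡ (sum-cong-≋ λ k → f≈g (punchIn u k) (Finₚ.punchInᵢ≢i u k))) ⟩
    f u ∙ sum (g ∘ punchIn u) ∙ g u
      ≈⟨ ∙-congʳ (comm _ _) ⟩
    sum (g ∘ punchIn u) ∙ f u ∙ g u
      ≈⟨ xy∙z≈xz∙y _ _ _ ⟩
    sum (g ∘ punchIn u) ∙ g u ∙ f u
      ≈⟨ ∙-congʳ (comm _ _) ⟩
    g u ∙ sum (g ∘ punchIn u) ∙ f u
      ≈⟨ ∙-congʳ (sum-remove {i = u} g) ⟨
    sum g ∙ f u ∎

  sum-single : ∀ {n} {f : Fin n → Carrier} (u : Fin n) → (∀ j → j ≢ u → f j ≈ ε) → sum f ≈ f u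
  sum-single {n} {f} u f≈ε = begin
    sum f              ≈⟨ identityʳ _ ⟨
    sum f ∙ ε          ≈⟨ sum-change {g = λ _ → ε} u f≈ε ⟩
    sum {n} (λ _ → ε) ∙ f u ≈⟨ ∙-congʳ (sum-replicate-zero n) ⟩
    ε ∙ f u            ≈⟨ identityˡ _ ⟩
    f u                ∎

  sum-pick : ∀ {n} (u : Fin n) (f : Fin n → Carrier) → sum (λ j → when (does (j Fin.≟ u)) (f j)) ≈ f u
  sum-pick u f = ≈-trans (sum-single u off) at
    where
    off : ∀ j → j ≢ u → when (does (j Fin.≟ u)) (f j) ≈ ε
    off j j≢u with j Fin.≟ u
    ... | yes j≡u = ⊥-elim (j≢u j≡u)
    ... | no  _   = ≈-refl
    at : when (does (u Fin.≟ u)) (f u) ≈ f u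
    at with u Fin.≟ u
    ... | yes _ = ≈-refl
    ... | no u≢u = ⊥-elim (u≢u refl)

  -- Exchanging the indices turns the second copy into the sum over i > j; the diagonal contributes
  -- nothing.
  sum-triangle : ∀ {n} (w : Fin n → Fin n → Carrier) → (∀ i j → w i j ≈ w j i) → (∀ i → w i i ≈ ε) →
    sum (λ i → sum (λ j → when (does (toℕ i ℕ.<? toℕ j)) (w i j)))
      ∙ sum (λ i → sum (λ j → when (does (toℕ i ℕ.<? toℕ j)) (w i j)))
    ≈ sum (λ i → sum (λ j → w i j))
  sum-triangle {n} w w-sym w-diag = begin
    sum (λ i → sum (λ j → lt i j)) ∙ sum (λ i → sum (λ j → lt i j))
      ≈⟨ ∙-congˡ (∑-comm lt) ⟩
    sum (λ i → sum (λ j → lt i j)) ∙ sum (λ i → sum (λ j → lt j i))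
      ≈⟨ ∑-distrib-+ (λ i → sum (lt i)) (λ i → sum (λ j → lt j i)) ⟨
    sum (λ i → sum (λ j → lt i j) ∙ sum (λ j → lt j i))
      ≈⟨ sum-cong-≋ (λ i → ≈-trans (≈-sym (∑-distrib-+ (lt i) (λ j → lt j i))) (sum-cong-≋ (both i))) ⟩
    sum (λ i → sum (λ j → w i j)) ∎
    where
    lt : Fin n → Fin n → Carrier
    lt i j = when (does (toℕ i ℕ.<? toℕ j)) (w i j)
    both : ∀ i j → lt i j ∙ lt j i ≈ w i j
    both i j = cases (toℕ i ℕ.<? toℕ j) (toℕ j ℕ.<? toℕ i)
      where
      cases : (p : Dec (toℕ i ℕ.< toℕ j)) (q : Dec (toℕ j ℕ.< toℕ i)) →
        when (does p) (w i j) ∙ when (does q) (w j i) ≈ w i j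
      cases (yes i<j) (yes j<i) = ⊥-elim (ℕₚ.<-asym i<j j<i)
      cases (yes _)   (no _)    = identityʳ _
      cases (no _)    (yes _)   = ≈-trans (identityˡ _) (w-sym j i)
      cases (no i≮j)  (no j≮i)  with Finₚ.toℕ-injective (ℕₚ.≤-antisym (ℕₚ.≮⇒≥ j≮i) (ℕₚ.≮⇒≥ i≮j))
      ... | refl = ≈-trans (identityˡ ε) (≈-sym (w-diag i))

module Sℕ = SumLemmas ℕₚ.+-0-commutativeMonoid
module Sℚ = SumLemmas ℚₚ.+-0-commutativeMonoid

sumℕ-mono : ∀ {n} {f g : Fin n → ℕ} → (∀ i → f i ℕ.≤ g i) → Sℕ.sum f ℕ.≤ Sℕ.sum g
sumℕ-mono {zero}  le = z≤n
sumℕ-mono {suc n} le = ℕₚ.+-mono-≤ (le zero) (sumℕ-mono (le ∘ suc))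

sumℚ-mono : ∀ {n} {f g : Fin n → ℚ} → (∀ i → f i ℚ.≤ g i) → Sℚ.sum f ℚ.≤ Sℚ.sum g
sumℚ-mono {zero}  le = ℚₚ.≤-refl
sumℚ-mono {suc n} le = ℚₚ.+-mono-≤ (le zero) (sumℚ-mono (le ∘ suc))

sum-when-⊠ : ∀ {n} (b : Fin n → Bool) q → Sℚ.sum (λ j → Sℚ.when (b j) q) ≡ Sℕ.sum (λ j → Sℕ.when (b j) 1) ⊠ q
sum-when-⊠ {zero}  b q = refl
sum-when-⊠ {suc n} b q with b zero
... | true  = cong (q ℚ.+_) (sum-when-⊠ (b ∘ suc) q)
... | false = trans (ℚₚ.+-identityˡ _) (sum-when-⊠ (b ∘ suc) q)

deg-sum : ∀ {n} (G : Graph n) i → deg G i ≡ Sℕ.sum (λ j → Sℕ.when (adj G i j) 1)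
deg-sum G i = Sℕ.foldr-allFin (λ j → Sℕ.when (adj G i j) 1)

-- The summand is local to `edgeCount` and has no name outside. Unification recovers it here, so
-- that it can be compared with another summand; likewise for `harmonic`.
edgeCount-terms : ∀ {n} (G : Graph n) → Σ (Fin n → Fin n → ℕ) λ w →
  edgeCount G ≡ sumℕ (map (λ i → sumℕ (map (λ j → w i j) (allFin n))) (allFin n))
edgeCount-terms G = _ , refl

harmonic-terms : ∀ {n} (G : Graph n) → Σ (Fin n → Fin n → ℚ) λ w →
  harmonic G ≡ sumℚ (map (λ i → sumℚ (map (λ j → w i j) (allFin n))) (allFin n))
harmonic-terms G = _ , refl

edge-double : ∀ {n} (G : Graph n) → edgeCount G ℕ.+ edgeCount G ≡ Sℕ.sum (deg G)
edge-double {n} G = begin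
  edgeCount G ℕ.+ edgeCount G
    ≡⟨ cong₂ ℕ._+_ to-sum to-sum ⟩
  Sℕ.sum (λ i → Sℕ.sum (λ j → lt i j)) ℕ.+ Sℕ.sum (λ i → Sℕ.sum (λ j → lt i j))
    ≡⟨ Sℕ.sum-triangle _ (λ i j → cong (λ b → Sℕ.when b 1) (adj-sym G i j)) (λ i → cong (λ b → Sℕ.when b 1) (adj-irrefl G i)) ⟩
  Sℕ.sum (λ i → Sℕ.sum (λ j → Sℕ.when (adj G i j) 1))
    ≡⟨ Sℕ.sum-cong-≗ (λ i → sym (deg-sum G i)) ⟩
  Sℕ.sum (deg G) ∎
  where
  open ≡-Reasoning
  w lt : Fin n → Fin n → ℕ
  w = proj₁ (edgeCount-terms G)
  lt i j = Sℕ.when (does (toℕ i ℕ.<? toℕ j)) (Sℕ.when (adj G i j) 1)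
  term : ∀ i j → w i j ≡ lt i j
  term i j with toℕ i ℕ.<? toℕ j
  ... | yes p = sym (cong (λ b → Sℕ.when b (Sℕ.when (adj G i j) 1)) (dec-true (toℕ i ℕ.<? toℕ j) p))
  ... | no ¬p = sym (cong (λ b → Sℕ.when b (Sℕ.when (adj G i j) 1)) (dec-false (toℕ i ℕ.<? toℕ j) ¬p))
  to-sum : edgeCount G ≡ Sℕ.sum (λ i → Sℕ.sum (λ j → lt i j))
  to-sum = trans (Sℕ.foldr-allFin (λ i → sumℕ (map (w i) (allFin n))))
    (Sℕ.sum-cong-≗ λ i → trans (Sℕ.foldr-allFin (w i)) (Sℕ.sum-cong-≗ (term i)))

weight : ∀ {n} → Graph n → Fin n → Fin n → ℚ
weight G i j = Sℚ.when (adj G i j) (t (deg G i ℕ.+ deg G j))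

harmonic-double : ∀ {n} (G : Graph n) →
  harmonic G ℚ.+ harmonic G ≡ Sℚ.sum (λ i → Sℚ.sum (weight G i))
harmonic-double {n} G = trans (cong₂ ℚ._+_ to-sum to-sum) (Sℚ.sum-triangle (weight G)
  (λ i j → cong₂ (λ b s → Sℚ.when b (t s)) (adj-sym G i j) (ℕₚ.+-comm (deg G i) (deg G j)))
  (λ i → cong (λ b → Sℚ.when b (t (deg G i ℕ.+ deg G i))) (adj-irrefl G i)))
  where
  w lt : Fin n → Fin n → ℚ
  w = proj₁ (harmonic-terms G)
  lt i j = Sℚ.when (does (toℕ i ℕ.<? toℕ j)) (weight G i j)
  term : ∀ i j → w i j ≡ lt i j
  term i j with toℕ i ℕ.<? toℕ j
  ... | yes p = trans (cong (Sℚ.when (adj G i j)) (harmonicTerm≡t (deg G i ℕ.+ deg G j)))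
                  (sym (cong (λ b → Sℚ.when b (weight G i j)) (dec-true (toℕ i ℕ.<? toℕ j) p)))
  ... | no ¬p = sym (cong (λ b → Sℚ.when b (weight G i j)) (dec-false (toℕ i ℕ.<? toℕ j) ¬p))
  to-sum : harmonic G ≡ Sℚ.sum (λ i → Sℚ.sum (λ j → lt i j))
  to-sum = trans (Sℚ.foldr-allFin (λ i → sumℚ (map (w i) (allFin n))))
    (Sℚ.sum-cong-≗ λ i → trans (Sℚ.foldr-allFin (w i)) (Sℚ.sum-cong-≗ (term i)))

-- Adding an edge

-- A relation between two given graphs rather than an operation, so that it serves both for deleting
-- an edge and for attaching a leaf.
record AddEdge {n} (G G⁺ : Graph n) (u v : Fin n) : Set where
  field
    old  : adj G u v ≡ false
    new  : adj G⁺ u v ≡ true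
    same : ∀ i j → ¬ (i ≡ u × j ≡ v) → ¬ (i ≡ v × j ≡ u) → adj G⁺ i j ≡ adj G i j

  distinct : u ≢ v
  distinct refl with trans (sym new) (adj-irrefl G⁺ u)
  ... | ()

  deg-end : deg G⁺ u ≡ suc (deg G u)
  deg-end = begin
    deg G⁺ u
      ≡⟨ deg-sum G⁺ u ⟩
    Sℕ.sum (λ j → Sℕ.when (adj G⁺ u j) 1)
      ≡⟨ ℕₚ.+-identityʳ _ ⟨
    Sℕ.sum (λ j → Sℕ.when (adj G⁺ u j) 1) ℕ.+ 0
      ≡⟨ cong (λ b → Sℕ.sum (λ j → Sℕ.when (adj G⁺ u j) 1) ℕ.+ Sℕ.when b 1) old ⟨
    Sℕ.sum (λ j → Sℕ.when (adj G⁺ u j) 1) ℕ.+ Sℕ.when (adj G u v) 1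
      ≡⟨ Sℕ.sum-change {g = λ j → Sℕ.when (adj G u j) 1} v
           (λ j j≢v → cong (λ b → Sℕ.when b 1) (same u j (λ e → j≢v (proj₂ e)) (λ e → distinct (proj₁ e)))) ⟩
    Sℕ.sum (λ j → Sℕ.when (adj G u j) 1) ℕ.+ Sℕ.when (adj G⁺ u v) 1
      ≡⟨ cong₂ (λ s b → s ℕ.+ Sℕ.when b 1) (sym (deg-sum G u)) new ⟩
    deg G u ℕ.+ 1
      ≡⟨ ℕₚ.+-comm (deg G u) 1 ⟩
    suc (deg G u) ∎
    where open ≡-Reasoning

  deg-other : ∀ {i} → i ≢ u → i ≢ v → deg G⁺ i ≡ deg G i
  deg-other {i} i≢u i≢v = trans (deg-sum G⁺ i) (trans
    (Sℕ.sum-cong-≗ λ j → cong (λ b → Sℕ.when b 1) (same i j (λ e → i≢u (proj₁ e)) (λ e → i≢v (proj₁ e))))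
    (sym (deg-sum G i)))

AddEdge-sym : ∀ {n} {G G⁺ : Graph n} {u v} → AddEdge G G⁺ u v → AddEdge G G⁺ v u
AddEdge-sym {G = G} {G⁺} {u} {v} e = record
  { old  = trans (adj-sym G v u) old
  ; new  = trans (adj-sym G⁺ v u) new
  ; same = λ i j p q → same i j q p
  }
  where open AddEdge e

δ-term : ∀ {n} → Graph n → Fin n → Fin n → ℚ
δ-term G i j = Sℚ.when (adj G i j) (δ (deg G i ℕ.+ deg G j))

-- The total decrease of the terms at u when u gains a neighbour and the degrees of its present
-- neighbours stay the same.
loss : ∀ {n} → Graph n → Fin n → ℚ
loss G u = Sℚ.sum (δ-term G u)

module _ {n} {G G⁺ : Graph n} {u v : Fin n} (e : AddEdge G G⁺ u v) where
  open AddEdge e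

  private
    τ : ℚ
    τ = t (deg G⁺ u ℕ.+ deg G⁺ v)

    at : Fin n → Fin n → ℚ → ℚ
    at i k q = Sℚ.when (does (i Fin.≟ k)) q

    gain-at lost-at : Fin n → Fin n → ℚ
    gain-at i j = at i u (at j v τ) ℚ.+ at i v (at j u τ)
    lost-at i j = (at i u (δ-term G i j) ℚ.+ at i v (δ-term G i j))
                ℚ.+ (at j u (δ-term G i j) ℚ.+ at j v (δ-term G i j))

    -- An exact balance for each ordered pair: `gain-at` has the new edge in both orders, and an
    -- edge at u or v loses its δ once in a row and once in a column.
    pointwise : ∀ i j → weight G i j ℚ.+ gain-at i j ≡ weight G⁺ i j ℚ.+ lost-at i j
    pointwise i j with i Fin.≟ u | i Fin.≟ v | j Fin.≟ u | j Fin.≟ v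
    ... | yes refl | yes u≡v  | _        | _        = ⊥-elim (distinct u≡v)
    ... | _        | _        | yes refl | yes u≡v  = ⊥-elim (distinct u≡v)
    ... | yes refl | no _     | yes refl | no _     rewrite adj-irrefl G u | adj-irrefl G⁺ u = refl
    ... | no _     | yes refl | no _     | yes refl rewrite adj-irrefl G v | adj-irrefl G⁺ v = refl
    ... | yes refl | no _     | no _     | yes refl rewrite old | new =
      solve 1 (λ x → con 0ℚ :+ (x :+ con 0ℚ) := x :+ ((con 0ℚ :+ con 0ℚ) :+ (con 0ℚ :+ con 0ℚ))) refl τ
    ... | no _     | yes refl | yes refl | no _     rewrite AddEdge.old (AddEdge-sym e) | AddEdge.new (AddEdge-sym e) =
      trans (solve 1 (λ x → con 0ℚ :+ (con 0ℚ :+ x) := x :+ ((con 0ℚ :+ con 0ℚ) :+ (con 0ℚ :+ con 0ℚ))) refl τ)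
        (cong (λ s → t s ℚ.+ ((0ℚ ℚ.+ 0ℚ) ℚ.+ (0ℚ ℚ.+ 0ℚ))) (ℕₚ.+-comm (deg G⁺ u) (deg G⁺ v)))
    ... | yes refl | no _     | no j≢u   | no j≢v
      rewrite same u j (λ e → j≢v (proj₂ e)) (λ e → distinct (proj₁ e)) | deg-end | deg-other j≢u j≢v with adj G u j
    ...   | false = refl
    ...   | true  = trans (cong (ℚ._+ (0ℚ ℚ.+ 0ℚ)) (t-δ (deg G u ℕ.+ deg G j)))
              (solve 2 (λ x y → x :+ y :+ (con 0ℚ :+ con 0ℚ) := x :+ ((y :+ con 0ℚ) :+ (con 0ℚ :+ con 0ℚ))) refl (t (suc (deg G u ℕ.+ deg G j))) (δ (deg G u ℕ.+ deg G j)))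
    pointwise i j | no _ | yes refl | no j≢u | no j≢v
      rewrite same v j (λ e → distinct (sym (proj₁ e))) (λ e → j≢u (proj₂ e)) | AddEdge.deg-end (AddEdge-sym e) | deg-other j≢u j≢v with adj G v j
    ...   | false = refl
    ...   | true  = trans (cong (ℚ._+ (0ℚ ℚ.+ 0ℚ)) (t-δ (deg G v ℕ.+ deg G j)))
              (solve 2 (λ x y → x :+ y :+ (con 0ℚ :+ con 0ℚ) := x :+ ((con 0ℚ :+ y) :+ (con 0ℚ :+ con 0ℚ))) refl (t (suc (deg G v ℕ.+ deg G j))) (δ (deg G v ℕ.+ deg G j)))
    pointwise i j | no i≢u | no i≢v | yes refl | no _
      rewrite same i u (λ e → i≢u (proj₁ e)) (λ e → i≢v (proj₁ e)) | deg-end | deg-other i≢u i≢v | ℕₚ.+-suc (deg G i) (deg G u) with adj G i u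
    ...   | false = refl
    ...   | true  = trans (cong (ℚ._+ (0ℚ ℚ.+ 0ℚ)) (t-δ (deg G i ℕ.+ deg G u)))
              (solve 2 (λ x y → x :+ y :+ (con 0ℚ :+ con 0ℚ) := x :+ ((con 0ℚ :+ con 0ℚ) :+ (y :+ con 0ℚ))) refl (t (suc (deg G i ℕ.+ deg G u))) (δ (deg G i ℕ.+ deg G u)))
    pointwise i j | no i≢u | no i≢v | no _ | yes refl
      rewrite same i v (λ e → i≢u (proj₁ e)) (λ e → i≢v (proj₁ e)) | AddEdge.deg-end (AddEdge-sym e) | deg-other i≢u i≢v | ℕₚ.+-suc (deg G i) (deg G v) with adj G i v
    ...   | false = refl
    ...   | true  = trans (cong (ℚ._+ (0ℚ ℚ.+ 0ℚ)) (t-δ (deg G i ℕ.+ deg G v)))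
              (solve 2 (λ x y → x :+ y :+ (con 0ℚ :+ con 0ℚ) := x :+ ((con 0ℚ :+ con 0ℚ) :+ (con 0ℚ :+ y))) refl (t (suc (deg G i ℕ.+ deg G v))) (δ (deg G i ℕ.+ deg G v)))
    pointwise i j | no i≢u | no i≢v | no j≢u | no j≢v
      rewrite same i j (λ e → i≢u (proj₁ e)) (λ e → i≢v (proj₁ e)) | deg-other i≢u i≢v | deg-other j≢u j≢v with adj G i j
    ...   | false = refl
    ...   | true  = refl

    δ-sym : ∀ i j → δ-term G i j ≡ δ-term G j i
    δ-sym i j = cong₂ (λ b s → Sℚ.when b (δ s)) (adj-sym G i j) (ℕₚ.+-comm (deg G i) (deg G j))

    ΣΣ : (Fin n → Fin n → ℚ) → ℚ
    ΣΣ w = Sℚ.sum (λ i → Sℚ.sum (w i))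

    ΣΣ-+ : ∀ (w w′ : Fin n → Fin n → ℚ) → ΣΣ (λ i j → w i j ℚ.+ w′ i j) ≡ ΣΣ w ℚ.+ ΣΣ w′
    ΣΣ-+ w w′ = trans (Sℚ.sum-cong-≗ λ i → Sℚ.∑-distrib-+ (w i) (w′ i))
      (Sℚ.∑-distrib-+ (λ i → Sℚ.sum (w i)) (λ i → Sℚ.sum (w′ i)))

    ΣΣ-row : ∀ (w : Fin n → Fin n → ℚ) k → ΣΣ (λ i j → at i k (w i j)) ≡ Sℚ.sum (w k)
    ΣΣ-row w k = trans (Sℚ.∑-comm (λ i j → at i k (w i j))) (Sℚ.sum-cong-≗ λ j → Sℚ.sum-pick k (λ i → w i j))

    ΣΣ-column : ∀ (w : Fin n → Fin n → ℚ) k → ΣΣ (λ i j → at j k (w i j)) ≡ Sℚ.sum (λ i → w i k)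
    ΣΣ-column w k = Sℚ.sum-cong-≗ λ i → Sℚ.sum-pick k (w i)

    ΣΣ-gain : ΣΣ gain-at ≡ τ ℚ.+ τ
    ΣΣ-gain = trans (ΣΣ-+ (λ i j → at i u (at j v τ)) (λ i j → at i v (at j u τ)))
      (cong₂ ℚ._+_ (trans (ΣΣ-row (λ _ j → at j v τ) u) (Sℚ.sum-pick v (λ _ → τ)))
                   (trans (ΣΣ-row (λ _ j → at j u τ) v) (Sℚ.sum-pick u (λ _ → τ))))

    ΣΣ-lost : ΣΣ lost-at ≡ (loss G u ℚ.+ loss G v) ℚ.+ (loss G u ℚ.+ loss G v)
    ΣΣ-lost = trans (ΣΣ-+ (λ i j → at i u (δ-term G i j) ℚ.+ at i v (δ-term G i j)) _)
      (cong₂ ℚ._+_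
        (trans (ΣΣ-+ (λ i j → at i u (δ-term G i j)) _)
          (cong₂ ℚ._+_ (ΣΣ-row (δ-term G) u) (ΣΣ-row (δ-term G) v)))
        (trans (ΣΣ-+ (λ i j → at j u (δ-term G i j)) _)
          (cong₂ ℚ._+_ (trans (ΣΣ-column (δ-term G) u) (Sℚ.sum-cong-≗ λ i → δ-sym i u))
                       (trans (ΣΣ-column (δ-term G) v) (Sℚ.sum-cong-≗ λ i → δ-sym i v)))))

  -- As u and v are not adjacent in G, no edge changes its degree at both ends, so each edge at u or
  -- v loses exactly its δ.
  harmonic-addEdge : harmonic G ℚ.+ t (deg G⁺ u ℕ.+ deg G⁺ v) ≡ harmonic G⁺ ℚ.+ (loss G u ℚ.+ loss G v)
  harmonic-addEdge = ℚₚ.≤-antisym (double-cancel-≤ (ℚₚ.≤-reflexive doubled)) (double-cancel-≤ (ℚₚ.≤-reflexive (sym doubled)))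
    where
    open ≡-Reasoning
    interchange : ∀ a b → a ℚ.+ b ℚ.+ (a ℚ.+ b) ≡ a ℚ.+ a ℚ.+ (b ℚ.+ b)
    interchange = solve 2 (λ a b → a :+ b :+ (a :+ b) := a :+ a :+ (b :+ b)) refl
    doubled : harmonic G ℚ.+ τ ℚ.+ (harmonic G ℚ.+ τ)
            ≡ harmonic G⁺ ℚ.+ (loss G u ℚ.+ loss G v) ℚ.+ (harmonic G⁺ ℚ.+ (loss G u ℚ.+ loss G v))
    doubled = begin
      harmonic G ℚ.+ τ ℚ.+ (harmonic G ℚ.+ τ)
        ≡⟨ interchange (harmonic G) τ ⟩
      harmonic G ℚ.+ harmonic G ℚ.+ (τ ℚ.+ τ)
        ≡⟨ cong₂ ℚ._+_ (harmonic-double G) (sym ΣΣ-gain) ⟩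
      ΣΣ (weight G) ℚ.+ ΣΣ gain-at
        ≡⟨ ΣΣ-+ (weight G) gain-at ⟨
      ΣΣ (λ i j → weight G i j ℚ.+ gain-at i j)
        ≡⟨ Sℚ.sum-cong-≗ (λ i → Sℚ.sum-cong-≗ (pointwise i)) ⟩
      ΣΣ (λ i j → weight G⁺ i j ℚ.+ lost-at i j)
        ≡⟨ ΣΣ-+ (weight G⁺) lost-at ⟩
      ΣΣ (weight G⁺) ℚ.+ ΣΣ lost-at
        ≡⟨ cong₂ ℚ._+_ (sym (harmonic-double G⁺)) ΣΣ-lost ⟩
      harmonic G⁺ ℚ.+ harmonic G⁺ ℚ.+ ((loss G u ℚ.+ loss G v) ℚ.+ (loss G u ℚ.+ loss G v))
        ≡⟨ interchange (harmonic G⁺) (loss G u ℚ.+ loss G v) ⟨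
      harmonic G⁺ ℚ.+ (loss G u ℚ.+ loss G v) ℚ.+ (harmonic G⁺ ℚ.+ (loss G u ℚ.+ loss G v)) ∎

-- The change of H under deleting an edge and attaching a leaf

⊠-δ-+-≤ : ∀ d m q → let r = suc (suc d) ℕ.+ suc d ℕ.* suc (suc (suc d)) in
  {True ((d ℕ.* 2 ℕ.* suc q ℕ.+ m ℕ.* suc r) ℕ.* suc (suc d) ℕ.≤? 2 ℕ.* suc (q ℕ.+ r ℕ.* suc q))} →
  d ⊠ δ (2 ℕ.+ d) ℚ.+ frac m q ℚ.≤ t (2 ℕ.+ d)
⊠-δ-+-≤ d m q {w} = subst (ℚ._≤ t (2 ℕ.+ d))
  (sym (trans (cong (ℚ._+ frac m q) (trans (cong (d ⊠_) (δ-frac (suc d))) (frac-⊠ d 2 _))) (frac-+ (d ℕ.* 2) _ m q)))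
  (frac-≤ _ _ 2 (suc d) (toWitness w))

module _ {n} (G : Graph n) (u : Fin n) where

  private
    at : Fin n → Fin n → ℕ
    at j a = Sℕ.when (does (j Fin.≟ a)) 1

    Σ-at : ∀ a → Sℕ.sum (λ j → at j a) ≡ 1
    Σ-at a = Sℕ.sum-pick a (λ _ → 1)

    Σ-at₂ : ∀ a b → Sℕ.sum (λ j → at j a ℕ.+ at j b) ≡ 2
    Σ-at₂ a b = trans (Sℕ.∑-distrib-+ (λ j → at j a) (λ j → at j b)) (cong₂ ℕ._+_ (Σ-at a) (Σ-at b))

  deg-≥1 : ∀ {a} → adj G u a ≡ true → 1 ℕ.≤ deg G u
  deg-≥1 {a} ua = subst₂ ℕ._≤_ (Σ-at a) (sym (deg-sum G u)) (sumℕ-mono le)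
    where
    le : ∀ j → at j a ℕ.≤ Sℕ.when (adj G u j) 1
    le j with j Fin.≟ a
    ... | no _ = z≤n
    ... | yes refl rewrite ua = ℕₚ.≤-refl

  deg-≥2 : ∀ {a b} → adj G u a ≡ true → adj G u b ≡ true → a ≢ b → 2 ℕ.≤ deg G u
  deg-≥2 {a} {b} ua ub a≢b = subst₂ ℕ._≤_ (Σ-at₂ a b) (sym (deg-sum G u)) (sumℕ-mono le)
    where
    le : ∀ j → at j a ℕ.+ at j b ℕ.≤ Sℕ.when (adj G u j) 1
    le j with j Fin.≟ a | j Fin.≟ b
    ... | yes refl | yes a≡b = ⊥-elim (a≢b a≡b)
    ... | yes refl | no _ rewrite ua = ℕₚ.≤-refl
    ... | no _ | yes refl rewrite ub = ℕₚ.≤-refl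
    ... | no _ | no _ = z≤n

  deg-≤1 : ∀ a → (∀ j → adj G u j ≡ true → j ≡ a) → deg G u ℕ.≤ 1
  deg-≤1 a only = subst₂ ℕ._≤_ (sym (deg-sum G u)) (Σ-at a) (sumℕ-mono le)
    where
    le : ∀ j → Sℕ.when (adj G u j) 1 ℕ.≤ at j a
    le j with adj G u j in uj
    ... | false = z≤n
    ... | true with j Fin.≟ a
    ...   | yes _  = ℕₚ.≤-refl
    ...   | no j≢a = ⊥-elim (j≢a (only j uj))

  deg-≤2 : ∀ a b → (∀ j → adj G u j ≡ true → j ≡ a ⊎ j ≡ b) → deg G u ℕ.≤ 2
  deg-≤2 a b only = subst₂ ℕ._≤_ (sym (deg-sum G u)) (Σ-at₂ a b) (sumℕ-mono le)
    where
    le : ∀ j → Sℕ.when (adj G u j) 1 ℕ.≤ at j a ℕ.+ at j b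
    le j with adj G u j in uj
    ... | false = z≤n
    ... | true with j Fin.≟ a | j Fin.≟ b | only j uj
    ...   | yes _  | _      | _      = s≤s z≤n
    ...   | no _   | yes _  | _      = ℕₚ.≤-refl
    ...   | no j≢a | no _   | inj₁ p = ⊥-elim (j≢a p)
    ...   | no _   | no j≢b | inj₂ p = ⊥-elim (j≢b p)

  deg-≡0 : (∀ j → adj G u j ≡ false) → deg G u ≡ 0
  deg-≡0 none = trans (deg-sum G u) (Sℕ.sum-zero λ j → cong (λ b → Sℕ.when b 1) (none j))

δ-anti′ : ∀ {k s} → suc k ℕ.≤ s → δ s ℚ.≤ δ (suc k)
δ-anti′ (s≤s k≤m) = δ-anti k≤m

module _ {n} (G : Graph n) (u : Fin n) where

  loss-≤ : ∀ k → (∀ x → adj G u x ≡ true → suc k ℕ.≤ deg G u ℕ.+ deg G x) → loss G u ℚ.≤ deg G u ⊠ δ (suc k)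
  loss-≤ k bound = subst (loss G u ℚ.≤_)
    (trans (sum-when-⊠ (adj G u) (δ (suc k))) (cong (_⊠ δ (suc k)) (sym (deg-sum G u)))) (sumℚ-mono le)
    where
    le : ∀ x → δ-term G u x ℚ.≤ Sℚ.when (adj G u x) (δ (suc k))
    le x with adj G u x in ux
    ... | false = ℚₚ.≤-refl
    ... | true  = δ-anti′ (bound x ux)

  neighbour-bound : ∀ x → adj G u x ≡ true → suc (deg G u) ℕ.≤ deg G u ℕ.+ deg G x
  neighbour-bound x ux = subst (ℕ._≤ deg G u ℕ.+ deg G x) (ℕₚ.+-comm (deg G u) 1)
    (ℕₚ.+-monoʳ-≤ (deg G u) (deg-≥1 G x (trans (adj-sym G x u) ux)))

  neighbour-bound₂ : ∀ x → 2 ℕ.≤ deg G x → suc (suc (deg G u)) ℕ.≤ deg G u ℕ.+ deg G x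
  neighbour-bound₂ x 2≤x = subst (ℕ._≤ deg G u ℕ.+ deg G x) (ℕₚ.+-comm (deg G u) 2) (ℕₚ.+-monoʳ-≤ (deg G u) 2≤x)

  -- Each of the deg u terms is at most δ(deg u + 1), and the one at x even at most δ(deg u + 2);
  -- the replaced term is added on the left to avoid subtraction.
  loss-≤-branch : ∀ x → adj G u x ≡ true → 2 ℕ.≤ deg G x →
    loss G u ℚ.+ δ (suc (deg G u)) ℚ.≤ deg G u ⊠ δ (suc (deg G u)) ℚ.+ δ (suc (suc (deg G u)))
  loss-≤-branch x₀ ux₀ 2≤x₀ = subst₂ ℚ._≤_
    (trans (Sℚ.∑-distrib-+ (δ-term G u) (λ x → atℚ x δ₁)) (cong (loss G u ℚ.+_) (Sℚ.sum-pick x₀ (λ _ → δ₁))))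
    (trans (Sℚ.∑-distrib-+ (λ x → Sℚ.when (adj G u x) δ₁) (λ x → atℚ x δ₂))
      (cong₂ ℚ._+_ (trans (sum-when-⊠ (adj G u) δ₁) (cong (_⊠ δ₁) (sym (deg-sum G u)))) (Sℚ.sum-pick x₀ (λ _ → δ₂))))
    (sumℚ-mono le)
    where
    δ₁ = δ (suc (deg G u))
    δ₂ = δ (suc (suc (deg G u)))
    atℚ : Fin n → ℚ → ℚ
    atℚ x q = Sℚ.when (does (x Fin.≟ x₀)) q
    le : ∀ x → δ-term G u x ℚ.+ atℚ x δ₁ ℚ.≤ Sℚ.when (adj G u x) δ₁ ℚ.+ atℚ x δ₂
    le x with x Fin.≟ x₀
    ... | yes refl rewrite ux₀ = subst (ℚ._≤ δ₁ ℚ.+ δ₂) (ℚₚ.+-comm δ₁ (δ (deg G u ℕ.+ deg G x)))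
      (ℚₚ.+-monoʳ-≤ δ₁ (δ-anti′ (neighbour-bound₂ x 2≤x₀)))
    ... | no _ with adj G u x in ux
    ...   | false = ℚₚ.≤-refl
    ...   | true  = ℚₚ.+-monoˡ-≤ 0ℚ (δ-anti′ (neighbour-bound x ux))

  -- Here a + 1 is the degree before the edge is added, so a is the new degree less two, as in φ.
  loss-≤-φ : ∀ x → adj G u x ≡ true → 2 ℕ.≤ deg G x → ∀ a → deg G u ≡ suc a → loss G u ℚ.≤ φ a
  loss-≤-φ x ux 2≤x a eq = +-cancelʳ-≤ (δ (2 ℕ.+ a)) (begin
    loss G u ℚ.+ δ (2 ℕ.+ a)
      ≤⟨ subst (λ d → loss G u ℚ.+ δ (suc d) ℚ.≤ d ⊠ δ (suc d) ℚ.+ δ (suc (suc d))) eq (loss-≤-branch x ux 2≤x) ⟩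
    δ (2 ℕ.+ a) ℚ.+ a ⊠ δ (2 ℕ.+ a) ℚ.+ δ (3 ℕ.+ a)
      ≡⟨ solve 3 (λ x y z → x :+ y :+ z := y :+ z :+ x) refl (δ (2 ℕ.+ a)) (a ⊠ δ (2 ℕ.+ a)) (δ (3 ℕ.+ a)) ⟩
    a ⊠ δ (2 ℕ.+ a) ℚ.+ δ (3 ℕ.+ a) ℚ.+ δ (2 ℕ.+ a)
      ≡⟨ cong (ℚ._+ δ (2 ℕ.+ a)) (φ-def a) ⟩
    φ a ℚ.+ δ (2 ℕ.+ a) ∎)
    where open ℚₚ.≤-Reasoning

∃-pred : ∀ {d} → 1 ℕ.≤ d → ∃ λ a → d ≡ suc a
∃-pred (s≤s {n = a} _) = a , refl

-- Deleting uv removes its term and gives back the losses at both ends; `φφ-≤` compares the two.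
harmonic-delete : ∀ {n} {G G⁺ : Graph n} {u v} → AddEdge G G⁺ u v →
  ∀ a → adj G u a ≡ true → 2 ℕ.≤ deg G a →
  ∀ b → adj G v b ≡ true → 2 ℕ.≤ deg G b →
  harmonic G ℚ.≤ harmonic G⁺ ℚ.+ frac 31 104
harmonic-delete {G = G} {G⁺} {u} {v} e a ua 2≤a b vb 2≤b
  with ∃-pred (deg-≥1 G u ua) | ∃-pred (deg-≥1 G v vb)
... | x , du | y , dv = +-cancelʳ-≤ τ (begin
  harmonic G ℚ.+ τ
    ≡⟨ harmonic-addEdge e ⟩
  harmonic G⁺ ℚ.+ (loss G u ℚ.+ loss G v)
    ≤⟨ ℚₚ.+-monoʳ-≤ (harmonic G⁺) (ℚₚ.+-mono-≤ (loss-≤-φ G u a ua 2≤a x du) (loss-≤-φ G v b vb 2≤b y dv)) ⟩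
  harmonic G⁺ ℚ.+ (φ x ℚ.+ φ y)
    ≤⟨ ℚₚ.+-monoʳ-≤ (harmonic G⁺) (φφ-≤ x y) ⟩
  harmonic G⁺ ℚ.+ (t (4 ℕ.+ (x ℕ.+ y)) ℚ.+ frac 31 104)
    ≡⟨ cong (λ s → harmonic G⁺ ℚ.+ (t s ℚ.+ frac 31 104)) degrees ⟩
  harmonic G⁺ ℚ.+ (τ ℚ.+ frac 31 104)
    ≡⟨ solve 3 (λ h x y → h :+ (x :+ y) := h :+ y :+ x) refl (harmonic G⁺) τ (frac 31 104) ⟩
  harmonic G⁺ ℚ.+ frac 31 104 ℚ.+ τ ∎)
  where
  open ℚₚ.≤-Reasoning
  τ = t (deg G⁺ u ℕ.+ deg G⁺ v)
  shift : ∀ x y → 4 ℕ.+ (x ℕ.+ y) ≡ suc (suc x) ℕ.+ suc (suc y)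
  shift = solve-∀
  degrees : 4 ℕ.+ (x ℕ.+ y) ≡ deg G⁺ u ℕ.+ deg G⁺ v
  degrees = trans (shift x y) (sym (cong₂ ℕ._+_ (trans (AddEdge.deg-end e) (cong suc du))
    (trans (AddEdge.deg-end (AddEdge-sym e)) (cong suc dv))))

module _ {n} {G G⁺ : Graph n} {u v : Fin n} (e : AddEdge G G⁺ u v) (isolated : deg G v ≡ 0) where

  -- An isolated v has no loss, and the new edge has degree sum 2 + deg u, so H grows by t(2 + deg
  -- u) less the loss at u.
  harmonic-leaf : ∀ c → loss G u ℚ.+ c ℚ.≤ t (2 ℕ.+ deg G u) → harmonic G ℚ.+ c ℚ.≤ harmonic G⁺
  harmonic-leaf c bound = +-cancelʳ-≤ (loss G u) (begin
    harmonic G ℚ.+ c ℚ.+ loss G u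
      ≡⟨ solve 3 (λ x y z → x :+ y :+ z := x :+ (z :+ y)) refl (harmonic G) c (loss G u) ⟩
    harmonic G ℚ.+ (loss G u ℚ.+ c)
      ≤⟨ ℚₚ.+-monoʳ-≤ (harmonic G) bound ⟩
    harmonic G ℚ.+ t (2 ℕ.+ deg G u)
      ≡⟨ cong (λ s → harmonic G ℚ.+ t s) degrees ⟩
    harmonic G ℚ.+ t (deg G⁺ u ℕ.+ deg G⁺ v)
      ≡⟨ harmonic-addEdge e ⟩
    harmonic G⁺ ℚ.+ (loss G u ℚ.+ loss G v)
      ≤⟨ ℚₚ.+-monoʳ-≤ (harmonic G⁺) (ℚₚ.+-monoʳ-≤ (loss G u) no-loss) ⟩
    harmonic G⁺ ℚ.+ (loss G u ℚ.+ 0ℚ)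
      ≡⟨ cong (harmonic G⁺ ℚ.+_) (ℚₚ.+-identityʳ (loss G u)) ⟩
    harmonic G⁺ ℚ.+ loss G u ∎)
    where
    open ℚₚ.≤-Reasoning
    degrees : 2 ℕ.+ deg G u ≡ deg G⁺ u ℕ.+ deg G⁺ v
    degrees = trans (ℕₚ.+-comm 1 (suc (deg G u)))
      (sym (cong₂ ℕ._+_ (AddEdge.deg-end e) (trans (AddEdge.deg-end (AddEdge-sym e)) (cong suc isolated))))
    no-loss : loss G v ℚ.≤ 0ℚ
    no-loss = subst (λ d → loss G v ℚ.≤ d ⊠ δ (suc (deg G v))) isolated (loss-≤ G v _ (neighbour-bound G v))

  harmonic-leaf-mono : harmonic G ℚ.≤ harmonic G⁺
  harmonic-leaf-mono = subst (ℚ._≤ harmonic G⁺) (ℚₚ.+-identityʳ (harmonic G)) (harmonic-leaf 0ℚ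
    (subst (ℚ._≤ t (2 ℕ.+ deg G u)) (sym (ℚₚ.+-identityʳ (loss G u)))
      (ℚₚ.≤-trans (loss-≤ G u _ (neighbour-bound G u)) (⊠-δ≤t (deg G u)))))

  module _ (big : ∀ x → adj G u x ≡ true → 2 ℕ.≤ deg G x) where

    harmonic-leaf-gain : ∀ m q → deg G u ⊠ δ (2 ℕ.+ deg G u) ℚ.+ frac m q ℚ.≤ t (2 ℕ.+ deg G u) →
      harmonic G ℚ.+ frac m q ℚ.≤ harmonic G⁺
    harmonic-leaf-gain m q bound = harmonic-leaf (frac m q) (ℚₚ.≤-trans
      (ℚₚ.+-monoˡ-≤ (frac m q) (loss-≤ G u _ (λ x ux → neighbour-bound₂ G u x (big x ux)))) bound)

    -- The constant is t(3) - δ(3) = t(4) = 1/2, the value for degree one.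
    harmonic-leaf-gain₁ : deg G u ℕ.≤ 1 → harmonic G ℚ.+ frac 5 9 ℚ.≤ harmonic G⁺
    harmonic-leaf-gain₁ le = harmonic-leaf-gain 5 9 (go (deg G u) le)
      where
      go : ∀ d → d ℕ.≤ 1 → d ⊠ δ (2 ℕ.+ d) ℚ.+ frac 5 9 ℚ.≤ t (2 ℕ.+ d)
      go 0 _ = ⊠-δ-+-≤ 0 5 9
      go 1 _ = ⊠-δ-+-≤ 1 5 9
      go (suc (suc _)) (s≤s ())

    -- The constant is t(4) - 2 δ(4) = 1/2 - 1/5 = 3/10, the value for degree two.
    harmonic-leaf-gain₂ : deg G u ℕ.≤ 2 → harmonic G ℚ.+ frac 3 9 ℚ.≤ harmonic G⁺
    harmonic-leaf-gain₂ le = harmonic-leaf-gain 3 9 (go (deg G u) le)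
      where
      go : ∀ d → d ℕ.≤ 2 → d ⊠ δ (2 ℕ.+ d) ℚ.+ frac 3 9 ℚ.≤ t (2 ℕ.+ d)
      go 0 _ = ⊠-δ-+-≤ 0 3 9
      go 1 _ = ⊠-δ-+-≤ 1 3 9
      go 2 _ = ⊠-δ-+-≤ 2 3 9
      go (suc (suc (suc _))) (s≤s (s≤s ()))

-- Booleans, graphs with equal adjacency, least numbers

Bool-ext : ∀ {b c} → (b ≡ true → c ≡ true) → (c ≡ true → b ≡ true) → b ≡ c
Bool-ext {false} {false} _ _ = refl
Bool-ext {false} {true}  _ g = g refl
Bool-ext {true}  {false} f _ = sym (f refl)
Bool-ext {true}  {true}  _ _ = refl

true≢false : ∀ {b} → b ≡ true → b ≡ false → ⊥
true≢false refl ()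

≢true⇒false : ∀ {b} → ¬ (b ≡ true) → b ≡ false
≢true⇒false {false} _ = refl
≢true⇒false {true}  p = ⊥-elim (p refl)

does⇒ : ∀ {ℓ} {P : Set ℓ} (d : Dec P) → does d ≡ true → P
does⇒ (yes p) _ = p

∨-elim : ∀ {b c} → b ∨ c ≡ true → b ≡ true ⊎ c ≡ true
∨-elim {true}  _ = inj₁ refl
∨-elim {false} p = inj₂ p

∨-introˡ : ∀ {b} c → b ≡ true → b ∨ c ≡ true
∨-introˡ c refl = refl

∨-introʳ : ∀ b {c} → c ≡ true → b ∨ c ≡ true
∨-introʳ true  _ = refl
∨-introʳ false p = p

deg-cong : ∀ {n} {G G′ : Graph n} → (∀ i j → adj G i j ≡ adj G′ i j) → ∀ i → deg G i ≡ deg G′ i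
deg-cong {G = G} {G′} eq i = trans (deg-sum G i)
  (trans (Sℕ.sum-cong-≗ λ j → cong (λ b → Sℕ.when b 1) (eq i j)) (sym (deg-sum G′ i)))

edgeCount-cong : ∀ {n} {G G′ : Graph n} → (∀ i j → adj G i j ≡ adj G′ i j) → edgeCount G ≡ edgeCount G′
edgeCount-cong {G = G} {G′} eq = ℕₚ.*-cancelˡ-≡ (edgeCount G) (edgeCount G′) 2 (trans (twice (edgeCount G)) (trans
  (trans (edge-double G) (trans (Sℕ.sum-cong-≗ (deg-cong {G = G} {G′} eq)) (sym (edge-double G′))))
  (sym (twice (edgeCount G′)))))
  where
  twice : ∀ m → 2 ℕ.* m ≡ m ℕ.+ m
  twice = solve-∀

harmonic-cong : ∀ {n} {G G′ : Graph n} → (∀ i j → adj G i j ≡ adj G′ i j) → harmonic G ≡ harmonic G′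
harmonic-cong {G = G} {G′} eq =
  ℚₚ.≤-antisym (double-cancel-≤ (ℚₚ.≤-reflexive doubled)) (double-cancel-≤ (ℚₚ.≤-reflexive (sym doubled)))
  where
  d = deg-cong {G = G} {G′} eq
  doubled : harmonic G ℚ.+ harmonic G ≡ harmonic G′ ℚ.+ harmonic G′
  doubled = trans (harmonic-double G) (trans
    (Sℚ.sum-cong-≗ λ i → Sℚ.sum-cong-≗ λ j → cong₂ (λ b s → Sℚ.when b (t s)) (eq i j) (cong₂ ℕ._+_ (d i) (d j)))
    (sym (harmonic-double G′)))

least : ∀ {ℓ} {P : ℕ → Set ℓ} → (∀ k → Dec (P k)) → ∀ k → P k →
  ∃ λ m → P m × m ℕ.≤ k × (∀ i → i ℕ.< m → ¬ P i)
least P? zero    p = 0 , p , z≤n , λ _ ()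
least {P = P} P? (suc k) p with P? 0
... | yes p₀ = 0 , p₀ , z≤n , λ _ ()
... | no ¬p₀ with least {P = λ i → P (suc i)} (λ i → P? (suc i)) k p
...   | m , pm , m≤k , min = suc m , pm , s≤s m≤k , below
  where
  below : ∀ i → i ℕ.< suc m → ¬ P i
  below zero    _         = ¬p₀
  below (suc i) (s≤s i<m) = min i i<m

-- Graphs of functions without 2-cycles

module Functional {n : ℕ} (f : Fin n → Fin n) (ff : ∀ v → f (f v) ≢ v) where

  f≢ : ∀ v → f v ≢ v
  f≢ v eq = ff v (trans (cong f eq) eq)

  iter : ℕ → Fin n → Fin n
  iter zero    v = v
  iter (suc i) v = f (iter i v)

  iter-f : ∀ i v → iter i (f v) ≡ f (iter i v)
  iter-f zero    v = refl
  iter-f (suc i) v = cong f (iter-f i v)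

  iter-+ : ∀ i j v → iter (i ℕ.+ j) v ≡ iter i (iter j v)
  iter-+ zero    j v = refl
  iter-+ (suc i) j v = cong f (iter-+ i j v)

  Sub : Set
  Sub = Fin n → Bool

  -- All vertices are kept; those outside S ∪ f(S) are isolated and do not contribute to H.
  U : Sub → Graph n
  U S = record
    { adj    = λ i j → arc i j ∨ arc j i
    ; sym    = λ i j → Bool.∨-comm (arc i j) (arc j i)
    ; irrefl = λ i → ≢true⇒false λ p → loop i (∨-elim p)
    }
    where
    arc : Fin n → Fin n → Bool
    arc i j = S i ∧ does (f i Fin.≟ j)
    loop : ∀ i → arc i i ≡ true ⊎ arc i i ≡ true → ⊥
    loop i (inj₁ p) = f≢ i (does⇒ (f i Fin.≟ i) (Bool.∧-conicalʳ (S i) _ p))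
    loop i (inj₂ p) = f≢ i (does⇒ (f i Fin.≟ i) (Bool.∧-conicalʳ (S i) _ p))

  U-elim : ∀ S {i j} → adj (U S) i j ≡ true → (S i ≡ true × f i ≡ j) ⊎ (S j ≡ true × f j ≡ i)
  U-elim S {i} {j} p with ∨-elim {S i ∧ does (f i Fin.≟ j)} p
  ... | inj₁ q = inj₁ (Bool.∧-conicalˡ _ _ q , does⇒ (f i Fin.≟ j) (Bool.∧-conicalʳ (S i) _ q))
  ... | inj₂ q = inj₂ (Bool.∧-conicalˡ _ _ q , does⇒ (f j Fin.≟ i) (Bool.∧-conicalʳ (S j) _ q))

  U-intro : ∀ S {i} → S i ≡ true → adj (U S) i (f i) ≡ true
  U-intro S {i} Si = ∨-introˡ _ (cong₂ _∧_ Si (dec-true (f i Fin.≟ f i) refl))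

  U-introʳ : ∀ S {i} → S i ≡ true → adj (U S) (f i) i ≡ true
  U-introʳ S {i} Si = trans (adj-sym (U S) (f i) i) (U-intro S Si)

  Closed : Sub → Set
  Closed S = ∀ v → S v ≡ true → S (f v) ≡ true

  insert : Sub → Fin n → Sub
  insert S x z = S z ∨ does (z Fin.≟ x)

  insert-elim : ∀ S x {z} → insert S x z ≡ true → S z ≡ true ⊎ z ≡ x
  insert-elim S x {z} p with ∨-elim {S z} p
  ... | inj₁ q = inj₁ q
  ... | inj₂ q = inj₂ (does⇒ (z Fin.≟ x) q)

  insert-old : ∀ S x {z} → S z ≡ true → insert S x z ≡ true
  insert-old S x p = ∨-introˡ _ p

  insert-new : ∀ S x → insert S x x ≡ true
  insert-new S x = ∨-introʳ (S x) (dec-true (x Fin.≟ x) refl)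

  insert-closed : ∀ {S x} → Closed S → S (f x) ≡ true → Closed (insert S x)
  insert-closed {S} {x} cl Sfx v p with insert-elim S x p
  ... | inj₁ Sv   = insert-old S x (cl v Sv)
  ... | inj₂ refl = insert-old S x Sfx

  module _ {S : Sub} (cl : Closed S) {x : Fin n} (x∉S : S x ≡ false) where

    insert-edge : AddEdge (U S) (U (insert S x)) (f x) x
    insert-edge = record { old = ≢true⇒false (λ p → old (U-elim S p)) ; new = U-introʳ (insert S x) (insert-new S x) ; same = same }
      where
      old : (S (f x) ≡ true × f (f x) ≡ x) ⊎ (S x ≡ true × f x ≡ f x) → ⊥
      old (inj₁ (_ , p)) = ff x p
      old (inj₂ (p , _)) = true≢false p x∉S
      same : ∀ i j → ¬ (i ≡ f x × j ≡ x) → ¬ (i ≡ x × j ≡ f x) → adj (U (insert S x)) i j ≡ adj (U S) i j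
      same i j ¬p ¬q = Bool-ext (λ p → to (U-elim (insert S x) p)) (λ p → from (U-elim S p))
        where
        to : (insert S x i ≡ true × f i ≡ j) ⊎ (insert S x j ≡ true × f j ≡ i) → adj (U S) i j ≡ true
        to (inj₁ (p , refl)) with insert-elim S x p
        ... | inj₁ Si   = U-intro S Si
        ... | inj₂ refl = ⊥-elim (¬q (refl , refl))
        to (inj₂ (p , refl)) with insert-elim S x p
        ... | inj₁ Sj   = U-introʳ S Sj
        ... | inj₂ refl = ⊥-elim (¬p (refl , refl))
        from : (S i ≡ true × f i ≡ j) ⊎ (S j ≡ true × f j ≡ i) → adj (U (insert S x)) i j ≡ true
        from (inj₁ (p , refl)) = U-intro (insert S x) (insert-old S x p)
        from (inj₂ (p , refl)) = U-introʳ (insert S x) (insert-old S x p)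

    -- Everything that f maps to a vertex outside a closed set lies outside that set as well.
    insert-isolated : deg (U S) x ≡ 0
    insert-isolated = deg-≡0 (U S) x λ j → ≢true⇒false λ p → none (U-elim S p)
      where
      none : ∀ {j} → (S x ≡ true × f x ≡ j) ⊎ (S j ≡ true × f j ≡ x) → ⊥
      none (inj₁ (p , _))    = true≢false p x∉S
      none (inj₂ (p , refl)) = true≢false (cl _ p) x∉S

  -- The neighbours z and f (f z) of f z differ because there are no 2-cycles.
  deg-image : ∀ {S} → Closed S → ∀ {z} → S z ≡ true → 2 ℕ.≤ deg (U S) (f z)
  deg-image {S} cl {z} Sz = deg-≥2 (U S) (f z) (U-introʳ S Sz) (U-intro S (cl z Sz)) (λ eq → ff z (sym eq))

  -- Lower bounds on H are counted in tenths.
  Low : Sub → ℕ → Set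
  Low S N = frac N 9 ℚ.≤ harmonic (U S)

  Low-gain : ∀ {S S′} N k → harmonic (U S) ℚ.+ frac k 9 ℚ.≤ harmonic (U S′) → Low S N → Low S′ (N ℕ.+ k)
  Low-gain {S} {S′} N k gain low = subst (ℚ._≤ harmonic (U S′)) (frac-+-same N k 9)
    (ℚₚ.≤-trans (ℚₚ.+-monoˡ-≤ (frac k 9) low) gain)

  Low-≤ : ∀ {S M N} → M ℕ.≤ N → Low S N → Low S M
  Low-≤ M≤N low = ℚₚ.≤-trans (frac-mono 9 M≤N) low

  Leaf : Sub → Fin n → Set
  Leaf S v = ∀ z → S z ≡ true → f z ≢ v

  module _ {S : Sub} (cl : Closed S) {x : Fin n} (x∉S : S x ≡ false) where

    Low-insert : ∀ {N} → Low S N → Low (insert S x) N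
    Low-insert low = ℚₚ.≤-trans low (harmonic-leaf-mono (insert-edge cl x∉S) (insert-isolated cl x∉S))

    -- The only neighbour of the leaf f x is f (f x), which has degree at least two as the image of
    -- a vertex of S, so `harmonic-leaf-gain₁` applies.
    Low-insert-leaf : ∀ {N} → S (f x) ≡ true → Leaf S (f x) → Low S N → Low (insert S x) (N ℕ.+ 5)
    Low-insert-leaf {N} Sfx leaf = Low-gain N 5 (harmonic-leaf-gain₁ (insert-edge cl x∉S) (insert-isolated cl x∉S)
      (λ y p → big y (only y p)) (deg-≤1 (U S) (f x) (f (f x)) only))
      where
      only : ∀ j → adj (U S) (f x) j ≡ true → j ≡ f (f x)
      only j p with U-elim S p
      ... | inj₁ (_ , eq)  = sym eq
      ... | inj₂ (Sj , eq) = ⊥-elim (leaf j Sj eq)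
      big : ∀ y → y ≡ f (f x) → 2 ℕ.≤ deg (U S) y
      big _ refl = deg-image cl Sfx

    -- By the hypotheses f x has degree two in U S, and its neighbours f (f x) and p are not leaves.
    Low-insert-path : ∀ {N} p q → S (f x) ≡ true → S q ≡ true → f q ≡ p → f p ≡ f x →
      (∀ z → S z ≡ true → f z ≡ f x → z ≡ p) → Low S N → Low (insert S x) (N ℕ.+ 3)
    Low-insert-path {N} p q Sfx Sq fq fp unique = Low-gain N 3 (harmonic-leaf-gain₂ (insert-edge cl x∉S) (insert-isolated cl x∉S)
      (λ y p → big y (only y p)) (deg-≤2 (U S) (f x) (f (f x)) p only))
      where
      only : ∀ j → adj (U S) (f x) j ≡ true → j ≡ f (f x) ⊎ j ≡ p
      only j p with U-elim S p
      ... | inj₁ (_ , eq)  = inj₁ (sym eq)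
      ... | inj₂ (Sj , eq) = inj₂ (unique j Sj eq)
      big : ∀ y → y ≡ f (f x) ⊎ y ≡ p → 2 ℕ.≤ deg (U S) y
      big _ (inj₁ refl) = deg-image cl Sfx
      big _ (inj₂ refl) = subst (λ z → 2 ℕ.≤ deg (U S) z) fq (deg-image cl Sq)

  -- S enlarged by the first ℓ vertices of the orbit of v; `elim` records that nothing else is
  -- added.
  record Chain (S : Sub) (v : Fin n) (ℓ : ℕ) (N : ℕ) : Set where
    field
      S′     : Sub
      closed : Closed S′
      old    : ∀ z → S z ≡ true → S′ z ≡ true
      new    : S′ v ≡ true
      elim   : ∀ z → S′ z ≡ true → S z ≡ true ⊎ ∃ λ i → i ℕ.< ℓ × z ≡ iter i v
      low    : Low S′ N

  module _ {S : Sub} (cl : Closed S) where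

    -- The path is inserted from its end next to S back to v. The bound `M` after the first vertex
    -- is supplied from outside; every later vertex prolongs a leaf and gains 5 tenths.
    chain : ∀ ℓ v → S (iter (suc ℓ) v) ≡ true → (∀ i → i ℕ.< suc ℓ → S (iter i v) ≡ false) →
      ∀ M → (∀ y → S y ≡ false → f y ≡ iter (suc ℓ) v → Low (insert S y) M) →
      Σ (Chain S v (suc ℓ) (M ℕ.+ ℓ ℕ.* 5)) λ C → Leaf (Chain.S′ C) v
    chain zero v Sfv out M start = record
      { S′ = insert S v
      ; closed = insert-closed cl Sfv
      ; old = λ z → insert-old S v
      ; new = insert-new S v
      ; elim = elim
      ; low = subst (Low (insert S v)) (sym (ℕₚ.+-identityʳ M)) (start v v∉S refl)
      } , leaf
      where
      v∉S = out 0 (s≤s z≤n)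
      elim : ∀ z → insert S v z ≡ true → S z ≡ true ⊎ ∃ λ i → i ℕ.< 1 × z ≡ iter i v
      elim z p with insert-elim S v p
      ... | inj₁ q = inj₁ q
      ... | inj₂ q = inj₂ (0 , s≤s z≤n , q)
      leaf : Leaf (insert S v) v
      leaf z p fz≡v with insert-elim S v p
      ... | inj₁ Sz   = true≢false (subst (λ w → S w ≡ true) fz≡v (cl z Sz)) v∉S
      ... | inj₂ refl = f≢ z fz≡v
    chain (suc ℓ) v S-end out M start
      with chain ℓ (f v) (subst (λ z → S z ≡ true) (sym (iter-f (suc ℓ) v)) S-end)
             (λ i i<ℓ → subst (λ z → S z ≡ false) (sym (iter-f i v)) (out (suc i) (s≤s i<ℓ)))
             M (λ y y∉S eq → start y y∉S (trans eq (iter-f (suc ℓ) v)))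
    ... | C , leaf = record
      { S′ = insert S₁ v
      ; closed = insert-closed closed new
      ; old = λ z p → insert-old S₁ v (old z p)
      ; new = insert-new S₁ v
      ; elim = elim′
      ; low = subst (Low (insert S₁ v)) (arith M (ℓ ℕ.* 5)) (Low-insert-leaf closed v∉S₁ new leaf low)
      } , leaf′
      where
      open Chain C renaming (S′ to S₁)
      arith : ∀ M k → M ℕ.+ k ℕ.+ 5 ≡ M ℕ.+ (5 ℕ.+ k)
      arith = solve-∀
      v∉S₁ : S₁ v ≡ false
      v∉S₁ = ≢true⇒false λ p → leaf v p refl
      elim′ : ∀ z → insert S₁ v z ≡ true → S z ≡ true ⊎ ∃ λ i → i ℕ.< suc (suc ℓ) × z ≡ iter i v
      elim′ z p with insert-elim S₁ v p
      ... | inj₂ q = inj₂ (0 , s≤s z≤n , q)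
      ... | inj₁ q with elim z q
      ...   | inj₁ r = inj₁ r
      ...   | inj₂ (i , i<ℓ , eq) = inj₂ (suc i , s≤s i<ℓ , trans eq (iter-f i v))
      leaf′ : Leaf (insert S₁ v) v
      leaf′ z p fz≡v with insert-elim S₁ v p
      ... | inj₁ Sz   = true≢false (subst (λ w → S₁ w ≡ true) fz≡v (closed z Sz)) v∉S₁
      ... | inj₂ refl = f≢ z fz≡v

    -- The gain of the first vertex is estimated by zero; the truncated difference also covers the
    -- empty path.
    chain-any : ∀ ℓ v → S (iter ℓ v) ≡ true → (∀ i → i ℕ.< ℓ → S (iter i v) ≡ false) →
      ∀ N → Low S N → Chain S v ℓ (N ℕ.+ (ℓ ℕ.* 5 ℕ.∸ 5))
    chain-any zero v Sv _ N low = record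
      { S′ = S ; closed = cl ; old = λ _ p → p ; new = Sv ; elim = λ _ p → inj₁ p
      ; low = subst (Low S) (sym (ℕₚ.+-identityʳ N)) low }
    chain-any (suc ℓ) v S-end out N low =
      proj₁ (chain ℓ v S-end out N (λ y y∉S _ → Low-insert cl y∉S low))

  abstract
    entry : ∀ (S : Sub) v → (∃ λ k → S (iter k v) ≡ true) →
      ∃ λ m → S (iter m v) ≡ true × (∀ i → i ℕ.< m → S (iter i v) ≡ false)
    entry S v (k , p) with least (λ k → S (iter k v) Bool.≟ true) k p
    ... | m , pm , _ , min = m , pm , λ i i<m → ≢true⇒false (min i i<m)

  full : Sub
  full _ = true

  -- The vertices are added in the order of their numbers, each together with its path into the
  -- current set, and no such step lowers H.
  Low-full : ∀ {S} → Closed S → (∀ v → ∃ λ k → S (iter k v) ≡ true) → ∀ {N} → Low S N → Low full N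
  Low-full {S} cl reach {N} low with fill n ℕₚ.≤-refl
    where
    fill : ∀ m → m ℕ.≤ n → Σ Sub λ S′ → Closed S′ × (∀ z → S z ≡ true → S′ z ≡ true)
      × (∀ v → toℕ v ℕ.< m → S′ v ≡ true) × Low S′ N
    fill zero _ = S , cl , (λ _ p → p) , (λ _ ()) , low
    fill (suc m) m<n with fill m (ℕₚ.<⇒≤ m<n)
    ... | S₁ , cl₁ , old₁ , in₁ , low₁
      with entry S₁ (Fin.fromℕ< m<n) (proj₁ (reach _) , old₁ _ (proj₂ (reach _)))
    ...   | ℓ , end , out = S′ , closed , (λ z p → old z (old₁ z p)) , inside , Low-≤ (ℕₚ.m≤m+n N _) low′
      where
      open Chain (chain-any cl₁ ℓ (Fin.fromℕ< m<n) end out N low₁) renaming (low to low′)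
      inside : ∀ v → toℕ v ℕ.< suc m → S′ v ≡ true
      inside v v<1+m with ℕₚ.m≤n⇒m<n∨m≡n (ℕₚ.≤-pred v<1+m)
      ... | inj₁ v<m = old v (in₁ v v<m)
      ... | inj₂ v≡m = subst (λ z → S′ z ≡ true)
        (Finₚ.toℕ-injective (trans (Finₚ.toℕ-fromℕ< m<n) (sym v≡m))) new
  ... | S′ , _ , _ , all , low′ = subst (frac N 9 ℚ.≤_)
    (harmonic-cong {G = U S′} {U full} λ i j → cong₂ (λ a b → (a ∧ does (f i Fin.≟ j)) ∨ (b ∧ does (f j Fin.≟ i)))
      (all i (Finₚ.toℕ<n i)) (all j (Finₚ.toℕ<n j))) low′

-- The cycle, heights and roots, and growing trees on the cycle

module Unicyclic {n : ℕ} (f : Fin n → Fin n) (ff : ∀ v → f (f v) ≢ v) (x : Fin n)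
  (reach : ∀ v → ∃ λ k → Functional.iter f ff k v ≡ x) where
  open Functional f ff

  abstract
    -- x is periodic because f x runs into x; m + 1 is its least period.
    return : ∃ λ m → iter (suc m) x ≡ x × (∀ i → i ℕ.< m → iter (suc i) x ≢ x)
    return with reach (f x)
    ... | k , p with least (λ k → iter (suc k) x Fin.≟ x) k (trans (sym (iter-f k x)) p)
    ...   | m , pm , _ , min = m , pm , min

  m g : ℕ
  m = proj₁ return
  g = suc m

  3≤g : 3 ℕ.≤ g
  3≤g = bound m (proj₁ (proj₂ return))
    where
    bound : ∀ k → iter (suc k) x ≡ x → 3 ℕ.≤ suc k
    bound zero          p = ⊥-elim (f≢ x p)
    bound (suc zero)    p = ⊥-elim (ff x p)
    bound (suc (suc _)) _ = s≤s (s≤s (s≤s z≤n))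

  -- Every vertex runs into x, whose least period is g, so the g-periodic points are the vertices of the cycle.
  OnC : Fin n → Set
  OnC u = iter g u ≡ u

  onC? : ∀ u → Dec (OnC u)
  onC? u = iter g u Fin.≟ u

  onC-f : ∀ {u} → OnC u → OnC (f u)
  onC-f {u} c = trans (iter-f g u) (cong f c)

  onC-iter : ∀ i {u} → OnC u → OnC (iter i u)
  onC-iter zero    c = c
  onC-iter (suc i) c = onC-f (onC-iter i c)

  onC-x : OnC x
  onC-x = proj₁ (proj₂ return)

  iter-multiple : ∀ k {u} → OnC u → iter (k ℕ.* g) u ≡ u
  iter-multiple zero    c = refl
  iter-multiple (suc k) {u} c = trans (iter-+ g (k ℕ.* g) u) (trans (cong (iter g) (iter-multiple k c)) c)

  -- On the cycle `iter m` inverts f, as m = g - 1.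
  pred-f : ∀ {z} → OnC z → iter m (f z) ≡ z
  pred-f {z} c = trans (iter-f m z) c

  -- If u reaches x in k steps, then k m further steps complete k g steps and return to u. So u is
  -- an iterate of x, and the exponent is reduced modulo g.
  index : ∀ {u} → OnC u → ∃ λ i → i ℕ.< g × iter i x ≡ u
  index {u} c with reach u
  ... | k , p = j % g , m%n<n j g , (begin
      iter (j % g) x                      ≡⟨ cong (iter (j % g)) (iter-multiple (j / g) onC-x) ⟨
      iter (j % g) (iter (j / g ℕ.* g) x) ≡⟨ iter-+ (j % g) (j / g ℕ.* g) x ⟨
      iter (j % g ℕ.+ j / g ℕ.* g) x      ≡⟨ cong (λ i → iter i x) (m≡m%n+[m/n]*n j g) ⟨
      iter j x                            ≡⟨ cong (iter j) p ⟨
      iter j (iter k u)                   ≡⟨ iter-+ j k u ⟨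
      iter (j ℕ.+ k) u                    ≡⟨ cong (λ i → iter i u) (arith k m) ⟩
      iter (k ℕ.* g) u                    ≡⟨ iter-multiple k c ⟩
      u ∎)
    where
    open ≡-Reasoning
    j = k ℕ.* m
    arith : ∀ k m → k ℕ.* m ℕ.+ k ≡ k ℕ.* suc m
    arith = solve-∀

  no-return : ∀ i → 0 ℕ.< i → i ℕ.< g → iter i x ≢ x
  no-return (suc i) _ (s≤s i<m) = proj₂ (proj₂ return) i i<m

  -- From `iter j x` another g - j steps lead back to x, so a collision would bring x back to itself
  -- after g - j + i < g steps.
  index-< : ∀ {i j} → i ℕ.< j → j ℕ.< g → iter i x ≢ iter j x
  index-< {i} {j} i<j j<g eq = no-return (g ℕ.∸ j ℕ.+ i)
    (ℕₚ.<-≤-trans (ℕₚ.m<n⇒0<n∸m j<g) (ℕₚ.m≤m+n _ i))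
    (subst (g ℕ.∸ j ℕ.+ i ℕ.<_) (ℕₚ.m∸n+n≡m (ℕₚ.<⇒≤ j<g)) (ℕₚ.+-monoʳ-< (g ℕ.∸ j) i<j))
    (begin
      iter (g ℕ.∸ j ℕ.+ i) x      ≡⟨ iter-+ (g ℕ.∸ j) i x ⟩
      iter (g ℕ.∸ j) (iter i x)   ≡⟨ cong (iter (g ℕ.∸ j)) eq ⟩
      iter (g ℕ.∸ j) (iter j x)   ≡⟨ iter-+ (g ℕ.∸ j) j x ⟨
      iter (g ℕ.∸ j ℕ.+ j) x      ≡⟨ cong (λ k → iter k x) (ℕₚ.m∸n+n≡m (ℕₚ.<⇒≤ j<g)) ⟩
      iter g x                    ≡⟨ onC-x ⟩
      x ∎)
    where open ≡-Reasoning

  index-injective : ∀ {i j} → i ℕ.< g → j ℕ.< g → iter i x ≡ iter j x → i ≡ j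
  index-injective {i} {j} i<g j<g eq with ℕₚ.<-cmp i j
  ... | tri< i<j _ _ = ⊥-elim (index-< i<j j<g eq)
  ... | tri≈ _ i≡j _ = i≡j
  ... | tri> _ _ j<i = ⊥-elim (index-< j<i i<g (sym eq))

  SC : Sub
  SC z = does (onC? z)

  SC-intro : ∀ {z} → OnC z → SC z ≡ true
  SC-intro {z} c = dec-true (onC? z) c

  SC-elim : ∀ {z} → SC z ≡ true → OnC z
  SC-elim {z} = does⇒ (onC? z)

  SC-closed : Closed SC
  SC-closed v p = SC-intro (onC-f (SC-elim p))

  SC-reach : ∀ v → ∃ λ k → SC (iter k v) ≡ true
  SC-reach v = proj₁ (reach v) , SC-intro (subst OnC (sym (proj₂ (reach v))) onC-x)

  -- Double counting of the pairs (v, k) with k < g and v = `iter k x`: each k occurs once and, by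
  -- injectivity, each v at most once.
  SC-count : g ℕ.≤ Sℕ.sum (λ v → Sℕ.when (SC v) 1)
  SC-count = subst (ℕ._≤ Sℕ.sum (λ v → Sℕ.when (SC v) 1)) total (sumℕ-mono le)
    where
    c : Fin g → Fin n
    c k = iter (toℕ k) x
    hit : Fin n → Fin g → ℕ
    hit v k = Sℕ.when (does (v Fin.≟ c k)) 1
    total : Sℕ.sum (λ v → Sℕ.sum (hit v)) ≡ g
    total = trans (Sℕ.∑-comm hit) (trans (Sℕ.sum-cong-≗ λ k → Sℕ.sum-pick (c k) (λ _ → 1)) (ones g))
      where
      ones : ∀ k → Sℕ.sum {k} (λ _ → 1) ≡ k
      ones zero    = refl
      ones (suc k) = cong suc (ones k)
    le : ∀ v → Sℕ.sum (hit v) ℕ.≤ Sℕ.when (SC v) 1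
    le v with Finₚ.any? (λ k → v Fin.≟ c k)
    ... | no none = subst (ℕ._≤ Sℕ.when (SC v) 1) (sym (Sℕ.sum-zero zeros)) z≤n
      where
      zeros : ∀ k → hit v k ≡ 0
      zeros k with v Fin.≟ c k
      ... | yes p = ⊥-elim (none (k , p))
      ... | no _  = refl
    ... | yes (k , refl) rewrite SC-intro (onC-iter (toℕ k) onC-x) =
      subst (ℕ._≤ 1) (sym (Sℕ.sum-single k zeros)) (one (does (c k Fin.≟ c k)))
      where
      one : ∀ b → Sℕ.when b 1 ℕ.≤ 1
      one true  = ℕₚ.≤-refl
      one false = z≤n
      zeros : ∀ j → j ≢ k → hit (c k) j ≡ 0
      zeros j j≢k with c k Fin.≟ c j
      ... | yes p = ⊥-elim (j≢k (Finₚ.toℕ-injective (index-injective (Finₚ.toℕ<n j) (Finₚ.toℕ<n k) (sym p))))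
      ... | no _  = refl

  deg-SC : ∀ i → deg (U SC) i ℕ.≤ 2
  deg-SC i = deg-≤2 (U SC) i (f i) (iter m i) only
    where
    only : ∀ j → adj (U SC) i j ≡ true → j ≡ f i ⊎ j ≡ iter m i
    only j p with U-elim SC p
    ... | inj₁ (_ , eq)    = inj₁ (sym eq)
    ... | inj₂ (q , refl)  = inj₂ (sym (pred-f (SC-elim q)))

  -- In the sum over ordered pairs every cycle vertex has at least two neighbours, and every term is
  -- at least t(4) = 1/2 because no degree exceeds two. So each cycle vertex contributes at least 1
  -- to 2H.
  Low-SC : Low SC (g ℕ.* 5)
  Low-SC = double-cancel-≤ (begin
    frac (g ℕ.* 5) 9 ℚ.+ frac (g ℕ.* 5) 9
      ≡⟨ frac-+-same (g ℕ.* 5) (g ℕ.* 5) 9 ⟩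
    frac (g ℕ.* 5 ℕ.+ g ℕ.* 5) 9
      ≤⟨ frac-mono 9 (subst (ℕ._≤ Sℕ.sum count ℕ.* 10) (arith g) (ℕₚ.*-monoˡ-≤ 10 SC-count)) ⟩
    frac (Sℕ.sum count ℕ.* 10) 9
      ≡⟨ frac-⊠ (Sℕ.sum count) 10 9 ⟨
    Sℕ.sum count ⊠ frac 10 9
      ≡⟨ sum-when-⊠ SC (frac 10 9) ⟨
    Sℚ.sum (λ i → Sℚ.when (SC i) (frac 10 9))
      ≤⟨ sumℚ-mono by-degree ⟩
    Sℚ.sum (λ i → deg H i ⊠ frac 5 9)
      ≡⟨ Sℚ.sum-cong-≗ (λ i → trans (cong (_⊠ frac 5 9) (deg-sum H i)) (sym (sum-when-⊠ (adj H i) (frac 5 9)))) ⟩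
    Sℚ.sum (λ i → Sℚ.sum (λ j → Sℚ.when (adj H i j) (frac 5 9)))
      ≤⟨ sumℚ-mono (λ i → sumℚ-mono (by-weight i)) ⟩
    Sℚ.sum (λ i → Sℚ.sum (weight H i))
      ≡⟨ harmonic-double H ⟨
    harmonic H ℚ.+ harmonic H ∎)
    where
    open ℚₚ.≤-Reasoning
    H = U SC
    count : Fin n → ℕ
    count i = Sℕ.when (SC i) 1
    arith : ∀ g → g ℕ.* 10 ≡ g ℕ.* 5 ℕ.+ g ℕ.* 5
    arith = solve-∀
    by-degree : ∀ i → Sℚ.when (SC i) (frac 10 9) ℚ.≤ deg H i ⊠ frac 5 9
    by-degree i = subst (Sℚ.when (SC i) (frac 10 9) ℚ.≤_) (sym (frac-⊠ (deg H i) 5 9)) (cases (onC? i))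
      where
      cases : (d : Dec (OnC i)) → Sℚ.when (does d) (frac 10 9) ℚ.≤ frac (deg H i ℕ.* 5) 9
      cases (no _)  = 0≤frac _ 9
      cases (yes c) = frac-mono 9 (ℕₚ.*-monoˡ-≤ 5 (subst (λ z → 2 ℕ.≤ deg H z) c
                    (deg-image SC-closed (SC-intro (onC-iter m c)))))
    by-weight : ∀ i j → Sℚ.when (adj H i j) (frac 5 9) ℚ.≤ weight H i j
    by-weight i j with adj H i j in ij
    ... | false = ℚₚ.≤-refl
    ... | true  = ≤-t (ℕₚ.≤-trans (deg-≥1 H i ij) (ℕₚ.m≤m+n _ _)) (ℕₚ.+-mono-≤ (deg-SC i) (deg-SC j))
      where
      ≤-t : ∀ {s} → 1 ℕ.≤ s → s ℕ.≤ 4 → frac 5 9 ℚ.≤ t s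
      ≤-t (s≤s _) (s≤s s≤3) = ℚₚ.≤-trans (frac-≤-dec 5 9 2 3) (t-anti s≤3)

  height : Fin n → ℕ
  height v = proj₁ (entry SC v (SC-reach v))

  root : Fin n → Fin n
  root v = iter (height v) v

  root-onC : ∀ v → OnC (root v)
  root-onC v = SC-elim (proj₁ (proj₂ (entry SC v (SC-reach v))))

  below-height : ∀ v i → i ℕ.< height v → ¬ OnC (iter i v)
  below-height v i i<h c = true≢false (SC-intro c) (proj₂ (proj₂ (entry SC v (SC-reach v))) i i<h)

  height-unique : ∀ v k → OnC (iter k v) → (∀ i → i ℕ.< k → ¬ OnC (iter i v)) → height v ≡ k
  height-unique v k c out with ℕₚ.<-cmp (height v) k
  ... | tri< h<k _ _ = ⊥-elim (out (height v) h<k (root-onC v))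
  ... | tri≈ _ h≡k _ = h≡k
  ... | tri> _ _ k<h = ⊥-elim (below-height v k k<h c)

  height-onC : ∀ {v} → OnC v → height v ≡ 0
  height-onC {v} c = height-unique v 0 c λ _ ()

  root-onC-id : ∀ {v} → OnC v → root v ≡ v
  root-onC-id {v} c = cong (λ k → iter k v) (height-onC c)

  module _ (v : Fin n) {i : ℕ} (i≤h : i ℕ.≤ height v) where

    private
      end : iter (height v ℕ.∸ i) (iter i v) ≡ root v
      end = trans (sym (iter-+ (height v ℕ.∸ i) i v)) (cong (λ k → iter k v) (ℕₚ.m∸n+n≡m i≤h))

    height-iter : height (iter i v) ≡ height v ℕ.∸ i
    height-iter = height-unique (iter i v) (height v ℕ.∸ i) (subst OnC (sym end) (root-onC v))
      λ j j<h c → below-height v (j ℕ.+ i)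
        (subst (j ℕ.+ i ℕ.<_) (ℕₚ.m∸n+n≡m i≤h) (ℕₚ.+-monoˡ-< i j<h))
        (subst OnC (sym (iter-+ j i v)) c)

    root-iter : root (iter i v) ≡ root v
    root-iter = trans (cong (λ k → iter k (iter i v)) height-iter) end

  1≤height : ∀ {v} → ¬ OnC v → 1 ℕ.≤ height v
  1≤height {v} ¬c with height v in eq
  ... | zero  = ⊥-elim (¬c (subst OnC (cong (λ k → iter k v) eq) (root-onC v)))
  ... | suc _ = s≤s z≤n

  -- `rs` lists the cycle vertices at which trees have been attached so far; at any other cycle
  -- vertex S has no tree.
  record Grown (rs : List (Fin n)) (N : ℕ) : Set where
    field
      S      : Sub
      closed : Closed S
      cycle  : ∀ {z} → OnC z → S z ≡ true
      roots  : ∀ z → S z ≡ true → OnC z ⊎ root z ∈ rs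
      low    : Low S N

  Grown-full : ∀ {rs N} → Grown rs N → Low full N
  Grown-full G = Low-full closed (λ v → proj₁ (SC-reach v) , cycle (SC-elim (proj₂ (SC-reach v)))) low
    where open Grown G

  grown₀ : Grown [] (g ℕ.* 5)
  grown₀ = record { S = SC ; closed = SC-closed ; cycle = SC-intro ; roots = λ z p → inj₁ (SC-elim p) ; low = Low-SC }

  module _ {rs N} (G : Grown rs N) (v : Fin n) (new : root v ∉ rs) where
    open Grown G

    grow-out : ∀ i → i ℕ.< height v → S (iter i v) ≡ false
    grow-out i i<h = ≢true⇒false λ p → impossible (roots _ p)
      where
      impossible : OnC (iter i v) ⊎ root (iter i v) ∈ rs → ⊥
      impossible (inj₁ c) = below-height v i i<h c
      impossible (inj₂ q) = new (subst (_∈ rs) (root-iter v (ℕₚ.<⇒≤ i<h)) q)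

    -- No tree hangs at the root of v yet, so its neighbours in `U S` are its two neighbours on the
    -- cycle, neither of them a leaf.
    grow-start : ∀ y → S y ≡ false → f y ≡ root v → Low (insert S y) (N ℕ.+ 3)
    grow-start y y∉S fy≡r = Low-insert-path closed y∉S p (iter m p) (cycle fy-onC) (cycle (onC-iter m p-onC))
      p-onC fy-onC unique low
      where
      fy-onC : OnC (f y)
      fy-onC = subst OnC (sym fy≡r) (root-onC v)
      p : Fin n
      p = iter m (f y)
      p-onC : OnC p
      p-onC = onC-iter m fy-onC
      unique : ∀ z → S z ≡ true → f z ≡ f y → z ≡ p
      unique z q fz≡fy with onC? z | roots z q
      ... | yes c | _      = trans (sym (pred-f c)) (cong (iter m) fz≡fy)
      ... | no ¬c | inj₁ c = ⊥-elim (¬c c)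
      ... | no ¬c | inj₂ z∈rs = ⊥-elim (new (subst (_∈ rs) (begin
              root z        ≡⟨ root-iter z (1≤height ¬c) ⟨
              root (f z)    ≡⟨ cong root (trans fz≡fy fy≡r) ⟩
              root (root v) ≡⟨ root-onC-id (root-onC v) ⟩
              root v        ∎) z∈rs))
        where open ≡-Reasoning

    -- A path of h > 0 vertices gains 3 + 5 (h - 1) = 5 h - 2 tenths, an empty one nothing. The
    -- height is a variable so that it can be matched on.
    grow-chain : ∀ h → height v ≡ h → Chain S v h (N ℕ.+ (h ℕ.* 5 ℕ.∸ 2))
    grow-chain zero    eq = record
      { S′ = S ; closed = closed ; old = λ _ p → p ; new = cycle (subst OnC (cong (λ k → iter k v) eq) (root-onC v))
      ; elim = λ _ p → inj₁ p ; low = subst (Low S) (sym (ℕₚ.+-identityʳ N)) low }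
    grow-chain (suc ℓ) eq = subst (Chain S v (suc ℓ)) (ℕₚ.+-assoc N 3 (ℓ ℕ.* 5)) (proj₁ (chain closed ℓ v
      (cycle (subst (λ h → OnC (iter h v)) eq (root-onC v)))
      (λ i i<h → grow-out i (subst (i ℕ.<_) (sym eq) i<h)) (N ℕ.+ 3)
      (λ y y∉S fy → grow-start y y∉S (trans fy (cong (λ h → iter h v) (sym eq))))))

    grow : Σ (Grown (root v ∷ rs) (N ℕ.+ (height v ℕ.* 5 ℕ.∸ 2))) λ G′ →
      ∀ z → Grown.S G′ z ≡ true → S z ≡ true ⊎ ∃ λ i → i ℕ.< height v × z ≡ iter i v
    grow = record { S = Chain.S′ C ; closed = Chain.closed C ; cycle = λ c → Chain.old C _ (cycle c) ; roots = roots′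
                  ; low = Chain.low C } , Chain.elim C
      where
      C : Chain S v (height v) (N ℕ.+ (height v ℕ.* 5 ℕ.∸ 2))
      C = grow-chain (height v) refl
      roots′ : ∀ z → Chain.S′ C z ≡ true → OnC z ⊎ root z ∈ root v ∷ rs
      roots′ z p with Chain.elim C z p
      ... | inj₂ (i , i<h , refl) = inj₂ (here (root-iter v (ℕₚ.<⇒≤ i<h)))
      ... | inj₁ q with roots z q
      ...   | inj₁ c = inj₁ c
      ...   | inj₂ s = inj₂ (there s)

-- Arithmetic and choices from finite sets

-- Linear arithmetic: Y − X is the sum of B − A and the slack s.
linear : ∀ {A B} → A ℕ.≤ B → ∀ X Y s → X ℕ.+ B ℕ.+ s ≡ Y ℕ.+ A → X ℕ.≤ Y
linear {A} {B} A≤B X Y s eq = ℕₚ.+-cancelʳ-≤ B X Y (begin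
  X ℕ.+ B         ≤⟨ ℕₚ.m≤m+n (X ℕ.+ B) s ⟩
  X ℕ.+ B ℕ.+ s   ≡⟨ eq ⟩
  Y ℕ.+ A         ≤⟨ ℕₚ.+-monoʳ-≤ Y A≤B ⟩
  Y ℕ.+ B         ∎)
  where open ℕₚ.≤-Reasoning

infixr 6 _⊹_
_⊹_ : ∀ {a b c d} → a ℕ.≤ b → c ℕ.≤ d → a ℕ.+ c ℕ.≤ b ℕ.+ d
_⊹_ = ℕₚ.+-mono-≤

parity : ∀ k → ∃ λ p → k ≡ p ℕ.+ p ⊎ k ≡ suc (p ℕ.+ p)
parity zero = 0 , inj₁ refl
parity (suc k) with parity k
... | p , inj₁ eq = p , inj₂ (cong suc eq)
... | p , inj₂ eq = suc p , inj₁ (trans (cong suc eq) (cong suc (sym (ℕₚ.+-suc p p))))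

-- s is k/2 rounded up, the radius of a path of length k.
half : ∀ k → ∃ λ s → k ℕ.≤ s ℕ.+ s × s ℕ.+ s ℕ.≤ suc k
half k with parity (suc k)
... | zero  , inj₂ refl = 0 , z≤n , z≤n
... | suc p , inj₂ refl = suc p , ℕₚ.≤-refl , ℕₚ.n≤1+n _
... | p     , inj₁ eq   = p , ℕₚ.≤-trans (ℕₚ.n≤1+n k) (ℕₚ.≤-reflexive eq) , ℕₚ.≤-reflexive (sym eq)

argmax : ∀ {n ℓ} {P : Fin n → Set ℓ} (h : Fin n → ℕ) → (∀ v → Dec (P v)) → ∃ P →
  ∃ λ a → P a × (∀ v → P v → h v ℕ.≤ h a)
argmax {zero} h P? (() , _)
argmax {suc n} {P = P} h P? (v , Pv) with P? zero | Finₚ.any? (λ i → P? (suc i))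
... | no ¬p₀ | no none = ⊥-elim (nothing v Pv)
  where
  nothing : ∀ v → ¬ P v
  nothing zero    = ¬p₀
  nothing (suc i) = λ p → none (i , p)
... | yes p₀ | no none = zero , p₀ , max
  where
  max : ∀ v → P v → h v ℕ.≤ h zero
  max zero    _ = ℕₚ.≤-refl
  max (suc i) p = ⊥-elim (none (i , p))
... | p₀ | yes some with argmax {P = λ i → P (suc i)} (h ∘ suc) (λ i → P? (suc i)) some
...   | a , Pa , max = extend p₀
  where
  extend : Dec (P zero) → ∃ λ a → P a × (∀ v → P v → h v ℕ.≤ h a)
  extend (no ¬p₀) = suc a , Pa , λ { zero p → ⊥-elim (¬p₀ p) ; (suc i) → max i }
  extend (yes p₀) with ℕₚ.≤-total (h zero) (h (suc a))
  ... | inj₁ le = suc a , Pa , λ { zero _ → le ; (suc i) → max i }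
  ... | inj₂ ge = zero , p₀ , λ { zero _ → ℕₚ.≤-refl ; (suc i) p → ℕₚ.≤-trans (max i p) ge }

abstract
  -- By the pigeonhole principle. It serves to choose, among four cycle vertices, one that is
  -- opposite to none of three roots.
  avoid₃ : ∀ x y z → ∃ λ k → k ℕ.< 4 × k ≢ x × k ≢ y × k ≢ z
  avoid₃ x y z with Finₚ.any? {n = 4} (λ k → ¬? (toℕ k ℕ.≟ x) ×-dec ¬? (toℕ k ℕ.≟ y) ×-dec ¬? (toℕ k ℕ.≟ z))
  ... | yes (k , p , q , r) = toℕ k , Finₚ.toℕ<n k , p , q , r
  ... | no none = ⊥-elim (collision (Finₚ.pigeonhole (s≤s (s≤s (s≤s (s≤s z≤n)))) (λ k → proj₁ (which k))))
    where
    target : Fin 3 → ℕ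
    target zero = x
    target (suc zero) = y
    target (suc (suc zero)) = z
    which : ∀ (k : Fin 4) → ∃ λ c → toℕ k ≡ target c
    which k with toℕ k ℕ.≟ x | toℕ k ℕ.≟ y | toℕ k ℕ.≟ z
    ... | yes p | _     | _     = zero , p
    ... | no _  | yes p | _     = suc zero , p
    ... | no _  | no _  | yes p = suc (suc zero) , p
    ... | no p  | no q  | no r  = ⊥-elim (none (k , p , q , r))
    collision : (∃ λ i → ∃ λ j → i Fin.< j × proj₁ (which i) ≡ proj₁ (which j)) → ⊥
    collision (i , j , i<j , eq) = ℕₚ.<-irrefl
      (trans (proj₂ (which i)) (trans (cong target eq) (sym (proj₂ (which j))))) i<j

abstract
  -- k is the index opposite to i on a cycle of length 2p; the two cases replace reduction modulo
  -- 2p.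
  antipode : ∀ p i → Σ ℕ λ k → ∀ {k′} → k′ ℕ.< p ℕ.+ p → k′ ≢ k → k′ ℕ.+ p ≢ i × i ℕ.+ p ≢ k′
  antipode p i with i ℕ.<? p
  ... | yes i<p = i ℕ.+ p , λ _ k′≢ →
    (λ eq → ℕₚ.<⇒≱ i<p (subst (p ℕ.≤_) eq (ℕₚ.m≤n+m p _))) , (λ eq → k′≢ (sym eq))
  ... | no i≮p = i ℕ.∸ p , λ {k′} k′< k′≢ →
    (λ eq → k′≢ (trans (sym (ℕₚ.m+n∸n≡m k′ p)) (cong (ℕ._∸ p) eq))) ,
    (λ eq → ℕₚ.<⇒≱ k′< (subst (p ℕ.+ p ℕ.≤_) eq (ℕₚ.+-monoˡ-≤ p (ℕₚ.≮⇒≥ i≮p))))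

-- Walks of bounded length

module _ {n} (G : Graph n) where

  walk-snoc : ∀ {u v w ℓ} → Walk G u v ℓ → adj G v w ≡ true → Walk G u w (suc ℓ)
  walk-snoc walk-here       vw = walk-step vw walk-here
  walk-snoc (walk-step e p) vw = walk-step e (walk-snoc p vw)

  walk-reverse : ∀ {u v ℓ} → Walk G u v ℓ → Walk G v u ℓ
  walk-reverse walk-here = walk-here
  walk-reverse (walk-step {u} {v} e p) = walk-snoc (walk-reverse p) (trans (adj-sym G v u) e)

  walk-++ : ∀ {u v w k ℓ} → Walk G u v k → Walk G v w ℓ → Walk G u w (k ℕ.+ ℓ)
  walk-++ walk-here       q = q
  walk-++ (walk-step e p) q = walk-step e (walk-++ p q)

  Within : ℕ → Fin n → Fin n → Set
  Within R u v = ∃ λ ℓ → ℓ ℕ.≤ R × Walk G u v ℓ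

  within-sym : ∀ {R u v} → Within R u v → Within R v u
  within-sym (ℓ , ℓ≤R , w) = ℓ , ℓ≤R , walk-reverse w

  within-trans : ∀ {R R′ u v w} → Within R u v → Within R′ v w → Within (R ℕ.+ R′) u w
  within-trans (k , k≤R , p) (ℓ , ℓ≤R′ , q) = k ℕ.+ ℓ , ℕₚ.+-mono-≤ k≤R ℓ≤R′ , walk-++ p q

  within-mono : ∀ {R R′ u v} → R ℕ.≤ R′ → Within R u v → Within R′ u v
  within-mono R≤R′ (ℓ , ℓ≤R , w) = ℓ , ℕₚ.≤-trans ℓ≤R R≤R′ , w

-- Centres of unicyclic graphs

-- Walks follow the edges from v to f v, which G contains, so eccentricities are bounded in G
-- directly, whereas H is bounded in `U full`.
module Radius {n : ℕ} (f : Fin n → Fin n) (ff : ∀ v → f (f v) ≢ v) (x : Fin n)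
  (reach : ∀ v → ∃ λ k → Functional.iter f ff k v ≡ x)
  (G : Graph n) (edge : ∀ v → adj G v (f v) ≡ true) where
  open Functional f ff
  open Unicyclic f ff x reach

  W : ℕ → Fin n → Fin n → Set
  W = Within G

  walk-iter : ∀ i v → Walk G v (iter i v) i
  walk-iter zero    v = walk-here
  walk-iter (suc i) v = walk-snoc G (walk-iter i v) (edge (iter i v))

  within-iter : ∀ i v → W i v (iter i v)
  within-iter i v = i , ℕₚ.≤-refl , walk-iter i v

  within-root : ∀ v → W (height v) (root v) v
  within-root v = within-sym G (within-iter (height v) v)

  within-forward : ∀ i j v → i ℕ.≤ j → W (j ℕ.∸ i) (iter i v) (iter j v)
  within-forward i j v i≤j = subst (W (j ℕ.∸ i) (iter i v))
    (trans (sym (iter-+ (j ℕ.∸ i) i v)) (cong (λ k → iter k v) (ℕₚ.m∸n+n≡m i≤j))) (within-iter (j ℕ.∸ i) (iter i v))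

  -- The two arcs between the vertices have lengths j - i and i + g - j; the disjunction says which
  -- of them has length at most R.
  within-arc : ∀ R {i j} → i ℕ.≤ j → j ℕ.< g → j ℕ.≤ i ℕ.+ R ⊎ i ℕ.+ g ℕ.≤ j ℕ.+ R → W R (iter i x) (iter j x)
  within-arc R {i} {j} i≤j _ (inj₁ le) = within-mono G (ℕₚ.m≤n+o⇒m∸n≤o j i le) (within-forward i j x i≤j)
  within-arc R {i} {j} i≤j j<g (inj₂ le) = within-sym G (within-mono G (ℕₚ.m≤n+o⇒m∸n≤o (i ℕ.+ g) j le)
    (subst (W (i ℕ.+ g ℕ.∸ j) (iter j x)) (trans (iter-+ i g x) (cong (iter i) onC-x))
      (within-forward j (i ℕ.+ g) x (ℕₚ.≤-trans (ℕₚ.<⇒≤ j<g) (ℕₚ.m≤n+m g i)))))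

  within-indices : ∀ R {i j} → i ℕ.< g → j ℕ.< g →
    j ℕ.≤ i ℕ.+ R ⊎ i ℕ.+ g ℕ.≤ j ℕ.+ R → i ℕ.≤ j ℕ.+ R ⊎ j ℕ.+ g ℕ.≤ i ℕ.+ R → W R (iter i x) (iter j x)
  within-indices R {i} {j} i<g j<g ij ji with ℕₚ.≤-total i j
  ... | inj₁ i≤j = within-arc R i≤j j<g ij
  ... | inj₂ j≤i = within-sym G (within-arc R j≤i i<g ji)

  -- If both arcs were longer than p, then g would be at least 2p + 2.
  within-cycle : ∀ {p} → g ℕ.≤ suc (p ℕ.+ p) → ∀ {u w} → OnC u → OnC w → W p u w
  within-cycle {p} g≤ cu cw with index cu | index cw
  ... | i , i<g , refl | j , j<g , refl = within-indices p i<g j<g (near i j) (near j i)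
    where
    arith : ∀ i j p g → i ℕ.+ g ℕ.+ (j ℕ.+ suc (p ℕ.+ p)) ℕ.+ 0 ≡ j ℕ.+ p ℕ.+ (suc (i ℕ.+ p) ℕ.+ g)
    arith = solve-∀
    near : ∀ i j → j ℕ.≤ i ℕ.+ p ⊎ i ℕ.+ g ℕ.≤ j ℕ.+ p
    near i j with j ℕ.≤? i ℕ.+ p
    ... | yes le = inj₁ le
    ... | no ¬le = inj₂ (linear (ℕₚ.≰⇒> ¬le ⊹ g≤) (i ℕ.+ g) (j ℕ.+ p) 0 (arith i j p g))

  -- If both arcs were longer than q, both would have length q + 1 and the vertices would be
  -- opposite.
  within-cycle′ : ∀ {q} → g ≡ suc q ℕ.+ suc q → ∀ {k i} → k ℕ.< g → i ℕ.< g → k ≢ proj₁ (antipode (suc q) i) →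
    W q (iter k x) (iter i x)
  within-cycle′ {q} g≡ {k} {i} k<g i<g k≢
    with proj₂ (antipode (suc q) i) (subst (k ℕ.<_) g≡ k<g) k≢
  ... | k+p≢i , i+p≢k = within-indices q k<g i<g (near k i k+p≢i) (near i k i+p≢k)
    where
    arith : ∀ i j q → i ℕ.+ (suc q ℕ.+ suc q) ℕ.+ j ℕ.+ 0 ≡ j ℕ.+ q ℕ.+ suc (i ℕ.+ suc q)
    arith = solve-∀
    near : ∀ i j → i ℕ.+ suc q ≢ j → j ℕ.≤ i ℕ.+ q ⊎ i ℕ.+ g ℕ.≤ j ℕ.+ q
    near i j i+p≢j with j ℕ.≤? i ℕ.+ q
    ... | yes le = inj₁ le
    ... | no ¬le = inj₂ (subst (λ k → i ℕ.+ k ℕ.≤ j ℕ.+ q) (sym g≡)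
      (linear (ℕₚ.≤∧≢⇒< (subst (ℕ._≤ j) (sym (ℕₚ.+-suc i q)) (ℕₚ.≰⇒> ¬le)) i+p≢j)
        (i ℕ.+ (suc q ℕ.+ suc q)) (j ℕ.+ q) 0 (arith i j q)))

  -- R bounds the eccentricity of c in G, hence the radius, and H of `U full` is at least R, counted
  -- in tenths.
  Bounded : Set
  Bounded = ∃ λ R → Σ (Fin n) λ c → (∀ v → W R c v) × Low full (R ℕ.* 10)

  abstract
    tallest : ∃ λ a → ∀ v → height v ℕ.≤ height a
    tallest with argmax {P = λ v → v ≡ v} height (λ v → v Fin.≟ v) (x , refl)
    ... | a , _ , max = a , λ v → max v refl

  a : Fin n
  a = proj₁ tallest

  height≤a : ∀ v → height v ℕ.≤ height a
  height≤a = proj₂ tallest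

  abstract
    -- A candidate exists: f (root a) is a cycle vertex other than root a and is its own root. So h₂
    -- may be zero.
    second : ∃ λ b → root b ≢ root a × (∀ v → root v ≢ root a → height v ℕ.≤ height b)
    second = argmax height (λ v → ¬? (root v Fin.≟ root a))
      (f (root a) , λ eq → f≢ (root a) (trans (sym (root-onC-id (onC-f (root-onC a)))) eq))

  b : Fin n
  b = proj₁ second

  b≢a : root b ≢ root a
  b≢a = proj₁ (proj₂ second)

  height≤b : ∀ v → root v ≢ root a → height v ℕ.≤ height b
  height≤b = proj₂ (proj₂ second)

  h₁ h₂ k₁ k₂ : ℕ
  h₁ = height a
  h₂ = height b
  k₁ = h₁ ℕ.* 5 ℕ.∸ 2
  k₂ = h₂ ℕ.* 5 ℕ.∸ 2

  -- The gain of a tree falls short of half its height by at most 2/10, so two trees have a deficit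
  -- of at most 4/10.
  gain-≥ : ∀ h → h ℕ.* 5 ℕ.≤ 2 ℕ.+ (h ℕ.* 5 ℕ.∸ 2)
  gain-≥ h = ℕₚ.m≤n+m∸n (h ℕ.* 5) 2

  grown₁ : Grown (root a ∷ []) (g ℕ.* 5 ℕ.+ k₁)
  grown₁ = proj₁ (grow grown₀ a λ ())

  grown₂ : Grown (root b ∷ root a ∷ []) (g ℕ.* 5 ℕ.+ k₁ ℕ.+ k₂)
  grown₂ = proj₁ (grow grown₁ b λ { (here eq) → b≢a eq })

  -- The centre on the cycle: h₁ ≤ p + h₂

  module _ {p : ℕ} (g≤ : g ℕ.≤ suc (p ℕ.+ p)) where

    within-a : h₁ ℕ.≤ p ℕ.+ h₂ → ∀ v → W (p ℕ.+ h₂) (root a) v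
    within-a h₁≤ v with root v Fin.≟ root a
    ... | yes eq = within-mono G (ℕₚ.≤-trans (height≤a v) h₁≤) (subst (λ r → W (height v) r v) eq (within-root v))
    ... | no neq = within-mono G (ℕₚ.+-monoʳ-≤ p (height≤b v neq))
      (within-trans G (within-cycle g≤ (root-onC a) (root-onC v)) (within-root v))

  -- Here g/2 = p + 1/2, and the extra half exceeds the deficit of 4/10.
  balanced-odd : ∀ {p} → g ≡ suc (p ℕ.+ p) → h₁ ℕ.≤ p ℕ.+ h₂ → Bounded
  balanced-odd {p} g≡ h₁≤ = p ℕ.+ h₂ , root a , within-a (ℕₚ.≤-reflexive g≡) h₁≤ ,
    Low-≤ (subst (λ g → (p ℕ.+ h₂) ℕ.* 10 ℕ.≤ g ℕ.* 5 ℕ.+ k₁ ℕ.+ k₂) (sym g≡)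
      (linear (ℕₚ.*-monoˡ-≤ 5 (height≤a b) ⊹ gain-≥ h₁ ⊹ gain-≥ h₂) _ _ 1 (arith p h₁ h₂ k₁ k₂)))
      (Grown-full grown₂)
    where
    arith : ∀ p h₁ h₂ k₁ k₂ → (p ℕ.+ h₂) ℕ.* 10 ℕ.+ (h₁ ℕ.* 5 ℕ.+ ((2 ℕ.+ k₁) ℕ.+ (2 ℕ.+ k₂))) ℕ.+ 1
      ≡ suc (p ℕ.+ p) ℕ.* 5 ℕ.+ k₁ ℕ.+ k₂ ℕ.+ (h₂ ℕ.* 5 ℕ.+ (h₁ ℕ.* 5 ℕ.+ h₂ ℕ.* 5))
    arith = solve-∀

  module _ {p : ℕ} (g≡ : g ≡ p ℕ.+ p) (h₁≤ : h₁ ℕ.≤ p ℕ.+ h₂) where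

    private
      centred : Low full ((p ℕ.+ h₂) ℕ.* 10) → Bounded
      centred low = p ℕ.+ h₂ , root a , within-a (ℕₚ.≤-trans (ℕₚ.≤-reflexive g≡) (ℕₚ.n≤1+n _)) h₁≤ , low

    -- The difference h₁ - h₂ ≥ 1 is worth at least 5/10, more than the deficit of 4/10.
    even-unequal : h₂ ℕ.< h₁ → Bounded
    even-unequal h₂<h₁ = centred (Low-≤ (subst (λ g → (p ℕ.+ h₂) ℕ.* 10 ℕ.≤ g ℕ.* 5 ℕ.+ k₁ ℕ.+ k₂) (sym g≡)
      (linear (ℕₚ.*-monoˡ-≤ 5 h₂<h₁ ⊹ gain-≥ h₁ ⊹ gain-≥ h₂) _ _ 1 (arith p h₁ h₂ k₁ k₂)))
      (Grown-full grown₂))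
      where
      arith : ∀ p h₁ h₂ k₁ k₂ → (p ℕ.+ h₂) ℕ.* 10 ℕ.+ (h₁ ℕ.* 5 ℕ.+ ((2 ℕ.+ k₁) ℕ.+ (2 ℕ.+ k₂))) ℕ.+ 1
        ≡ (p ℕ.+ p) ℕ.* 5 ℕ.+ k₁ ℕ.+ k₂ ℕ.+ (suc h₂ ℕ.* 5 ℕ.+ (h₁ ℕ.* 5 ℕ.+ h₂ ℕ.* 5))
      arith = solve-∀

    -- A third tree of height at least two gains at least 8/10.
    even-third : ∀ c → root c ∉ root b ∷ root a ∷ [] → 2 ℕ.≤ height c → Bounded
    even-third c c∉ 2≤c = centred (Low-≤
      (subst (λ g → (p ℕ.+ h₂) ℕ.* 10 ℕ.≤ g ℕ.* 5 ℕ.+ k₁ ℕ.+ k₂ ℕ.+ (h₃ ℕ.* 5 ℕ.∸ 2)) (sym g≡)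
      (linear (ℕₚ.*-monoˡ-≤ 5 (height≤a b) ⊹ gain-≥ h₁ ⊹ gain-≥ h₂ ⊹ gain-≥ h₃ ⊹ ℕₚ.*-monoˡ-≤ 5 2≤c) _ _ 4
        (arith p h₁ h₂ h₃ k₁ k₂ (h₃ ℕ.* 5 ℕ.∸ 2))))
      (Grown-full (proj₁ (grow grown₂ c c∉))))
      where
      h₃ = height c
      arith : ∀ p h₁ h₂ h₃ k₁ k₂ k₃ → (p ℕ.+ h₂) ℕ.* 10
          ℕ.+ (h₁ ℕ.* 5 ℕ.+ ((2 ℕ.+ k₁) ℕ.+ ((2 ℕ.+ k₂) ℕ.+ ((2 ℕ.+ k₃) ℕ.+ h₃ ℕ.* 5)))) ℕ.+ 4
        ≡ (p ℕ.+ p) ℕ.* 5 ℕ.+ k₁ ℕ.+ k₂ ℕ.+ k₃ ℕ.+ (h₂ ℕ.* 5 ℕ.+ (h₁ ℕ.* 5 ℕ.+ (h₂ ℕ.* 5 ℕ.+ (h₃ ℕ.* 5 ℕ.+ 10))))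
      arith = solve-∀

    -- Two further trees gain at least 3/10 each, together more than the deficit of 4/10.
    even-fourth : ∀ c → root c ∉ root b ∷ root a ∷ [] → 1 ℕ.≤ height c →
      ∀ d → root d ∉ root c ∷ root b ∷ root a ∷ [] → 1 ℕ.≤ height d → Bounded
    even-fourth c c∉ 1≤c d d∉ 1≤d = centred (Low-≤
      (subst (λ g → (p ℕ.+ h₂) ℕ.* 10 ℕ.≤ g ℕ.* 5 ℕ.+ k₁ ℕ.+ k₂ ℕ.+ k₃ ℕ.+ k₄) (sym g≡)
      (linear (ℕₚ.*-monoˡ-≤ 5 (height≤a b) ⊹ gain-≥ h₁ ⊹ gain-≥ h₂ ⊹ gain-≥ h₃ ⊹ ℕₚ.*-monoˡ-≤ 5 1≤c
               ⊹ gain-≥ h₄ ⊹ ℕₚ.*-monoˡ-≤ 5 1≤d) _ _ 2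
        (arith p h₁ h₂ h₃ h₄ k₁ k₂ k₃ k₄)))
      (Grown-full (proj₁ (grow (proj₁ (grow grown₂ c c∉)) d d∉))))
      where
      h₃ = height c
      h₄ = height d
      k₃ = h₃ ℕ.* 5 ℕ.∸ 2
      k₄ = h₄ ℕ.* 5 ℕ.∸ 2
      arith : ∀ p h₁ h₂ h₃ h₄ k₁ k₂ k₃ k₄ → (p ℕ.+ h₂) ℕ.* 10
          ℕ.+ (h₁ ℕ.* 5 ℕ.+ ((2 ℕ.+ k₁) ℕ.+ ((2 ℕ.+ k₂) ℕ.+ ((2 ℕ.+ k₃) ℕ.+ (h₃ ℕ.* 5 ℕ.+ ((2 ℕ.+ k₄) ℕ.+ h₄ ℕ.* 5)))))) ℕ.+ 2
        ≡ (p ℕ.+ p) ℕ.* 5 ℕ.+ k₁ ℕ.+ k₂ ℕ.+ k₃ ℕ.+ k₄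
          ℕ.+ (h₂ ℕ.* 5 ℕ.+ (h₁ ℕ.* 5 ℕ.+ (h₂ ℕ.* 5 ℕ.+ (h₃ ℕ.* 5 ℕ.+ (5 ℕ.+ (h₄ ℕ.* 5 ℕ.+ 5))))))
      arith = solve-∀

    even-flat : h₂ ≡ 0 → Bounded
    even-flat h₂≡0 = centred (subst (Low full) (trans (cong (ℕ._* 5) g≡)
      (trans (arith p) (cong (λ h → (p ℕ.+ h) ℕ.* 10) (sym h₂≡0)))) (Grown-full grown₀))
      where
      arith : ∀ p → (p ℕ.+ p) ℕ.* 5 ≡ (p ℕ.+ 0) ℕ.* 10
      arith = solve-∀

  -- The centre is a cycle vertex that is antipodal to none of the three roots.
  even-few : ∀ {q h} → g ≡ suc (suc q) ℕ.+ suc (suc q) → h₁ ≡ suc h → h₂ ≡ suc h →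
    ∀ c → (∀ v → height v ≢ 0 → root v ≡ root a ⊎ root v ≡ root b ⊎ root v ≡ root c) → Bounded
  even-few {q} {h} g≡ h₁≡ h₂≡ c few = suc (suc q) ℕ.+ h , centre , close , Low-≤ low-bound (Grown-full grown₂)
    where
    arith : ∀ q h k₁ k₂ → (suc (suc q) ℕ.+ h) ℕ.* 10 ℕ.+ ((2 ℕ.+ k₁) ℕ.+ (2 ℕ.+ k₂)) ℕ.+ 6
      ≡ (suc (suc q) ℕ.+ suc (suc q)) ℕ.* 5 ℕ.+ k₁ ℕ.+ k₂ ℕ.+ (suc h ℕ.* 5 ℕ.+ suc h ℕ.* 5)
    arith = solve-∀
    -- The radius aimed at is p + h₁ - 1 with p = q + 2, and the two trees give H at least p + h₁ -
    -- 4/10.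
    low-bound : (suc (suc q) ℕ.+ h) ℕ.* 10 ℕ.≤ g ℕ.* 5 ℕ.+ k₁ ℕ.+ k₂
    low-bound = subst (λ g → (suc (suc q) ℕ.+ h) ℕ.* 10 ℕ.≤ g ℕ.* 5 ℕ.+ k₁ ℕ.+ k₂) (sym g≡)
      (linear (subst (λ z → z ℕ.* 5 ℕ.≤ 2 ℕ.+ k₁) h₁≡ (gain-≥ h₁) ⊹ subst (λ z → z ℕ.* 5 ℕ.≤ 2 ℕ.+ k₂) h₂≡ (gain-≥ h₂))
        _ _ 6 (arith q h k₁ k₂))
    position : Fin n → ℕ
    position v = proj₁ (index (root-onC v))
    avoided : Fin n → ℕ
    avoided v = proj₁ (antipode (suc (suc q)) (position v))
    -- As g ≥ 4, the indices 0 to 3 belong to four different cycle vertices, and three antipodes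
    -- cannot exclude them all.
    choice : ∃ λ k → k ℕ.< 4 × k ≢ avoided a × k ≢ avoided b × k ≢ avoided c
    choice = avoid₃ (avoided a) (avoided b) (avoided c)
    k : ℕ
    k = proj₁ choice
    4≤g : 4 ℕ.≤ g
    4≤g = subst (4 ℕ.≤_) (sym g≡) (s≤s (s≤s (subst (2 ℕ.≤_) (sym (trans (ℕₚ.+-suc q (suc q)) (cong suc (ℕₚ.+-suc q q)))) (s≤s (s≤s z≤n)))))
    k<g : k ℕ.< g
    k<g = ℕₚ.<-≤-trans (proj₁ (proj₂ choice)) 4≤g
    centre : Fin n
    centre = iter k x
    to : ∀ v w → root v ≡ root w → k ≢ avoided w → W (suc q) centre (root v)
    to v w eq k≢ = subst (W (suc q) centre) (trans (proj₂ (proj₂ (index (root-onC w)))) (sym eq))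
      (within-cycle′ {q = suc q} g≡ k<g (proj₁ (proj₂ (index (root-onC w)))) k≢)
    to-root : ∀ v → height v ≢ 0 → W (suc q) centre (root v)
    to-root v tall with few v tall
    ... | inj₁ eq        = to v a eq (proj₁ (proj₂ (proj₂ choice)))
    ... | inj₂ (inj₁ eq) = to v b eq (proj₁ (proj₂ (proj₂ (proj₂ choice))))
    ... | inj₂ (inj₂ eq) = to v c eq (proj₂ (proj₂ (proj₂ (proj₂ choice))))
    close : ∀ v → W (suc (suc q) ℕ.+ h) centre v
    close v with height v ℕ.≟ 0
    -- A cycle vertex may be opposite to the centre, but p ≤ p + h is enough for it.
    ... | yes flat = within-mono G (subst (λ z → suc (suc q) ℕ.+ z ℕ.≤ suc (suc q) ℕ.+ h) (sym flat) (ℕₚ.+-monoʳ-≤ (suc (suc q)) z≤n))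
      (within-trans G {R = suc (suc q)} {R′ = height v}
        (within-cycle {p = suc (suc q)} (ℕₚ.≤-trans (ℕₚ.≤-reflexive g≡) (ℕₚ.n≤1+n _)) (onC-iter k onC-x) (root-onC v)) (within-root v))
    ... | no tall = within-mono G
      (subst (suc q ℕ.+ height v ℕ.≤_) (ℕₚ.+-suc (suc q) h) (ℕₚ.+-monoʳ-≤ (suc q) (subst (height v ℕ.≤_) h₁≡ (height≤a v))))
      (within-trans G {R = suc q} {R′ = height v} (to-root v tall) (within-root v))

  balanced-even : ∀ {p} → g ≡ p ℕ.+ p → h₁ ℕ.≤ p ℕ.+ h₂ → Bounded
  balanced-even {zero} g≡ _ = ⊥-elim (ℕₚ.<⇒≱ (s≤s z≤n) (ℕₚ.≤-trans 3≤g (ℕₚ.≤-reflexive g≡)))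
  balanced-even {suc zero} g≡ _ = ⊥-elim (ℕₚ.<⇒≱ {2} {3} ℕₚ.≤-refl (ℕₚ.≤-trans 3≤g (ℕₚ.≤-reflexive g≡)))
  balanced-even {suc (suc q)} g≡ h₁≤ with h₂ ℕ.<? h₁
  ... | yes h₂<h₁ = even-unequal g≡ h₁≤ h₂<h₁
  ... | no h₂≮h₁ = equal h₂ refl (ℕₚ.≤-antisym (ℕₚ.≮⇒≥ h₂≮h₁) (height≤a b))
    where
    fresh? : ∀ rs v → Dec (root v ∉ rs)
    fresh? rs v = ¬? (∈? Fin._≟_ (root v) rs)
    member₂ : ∀ {v} → ¬ (root v ∉ root b ∷ root a ∷ []) → root v ≡ root a ⊎ root v ≡ root b ⊎ root v ≡ root b
    member₂ {v} ¬fresh with ∈? Fin._≟_ (root v) (root b ∷ root a ∷ [])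
    ... | no fresh = ⊥-elim (¬fresh fresh)
    ... | yes (here eq) = inj₂ (inj₁ eq)
    ... | yes (there (here eq)) = inj₁ eq
    member₃ : ∀ c {v} → ¬ (root v ∉ root c ∷ root b ∷ root a ∷ []) → root v ≡ root a ⊎ root v ≡ root b ⊎ root v ≡ root c
    member₃ c {v} ¬fresh with ∈? Fin._≟_ (root v) (root c ∷ root b ∷ root a ∷ [])
    ... | no fresh = ⊥-elim (¬fresh fresh)
    ... | yes (here eq) = inj₂ (inj₂ eq)
    ... | yes (there (here eq)) = inj₂ (inj₁ eq)
    ... | yes (there (there (here eq))) = inj₁ eq
    equal : ∀ h → h₂ ≡ h → h₁ ≡ h₂ → Bounded
    equal zero    h₂≡ _ = even-flat g≡ h₁≤ h₂≡
    equal (suc h) h₂≡ h₁≡h₂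
      with Finₚ.any? (λ v → fresh? (root b ∷ root a ∷ []) v ×-dec 2 ℕ.≤? height v)
    ... | yes (c , c∉ , 2≤c) = even-third g≡ h₁≤ c c∉ 2≤c
    ... | no _ with Finₚ.any? (λ v → fresh? (root b ∷ root a ∷ []) v ×-dec 1 ℕ.≤? height v)
    -- Without a third tree, b is passed once more in place of the third root.
    ...   | no none = even-few g≡ (trans h₁≡h₂ h₂≡) h₂≡ b λ v tall → member₂ λ fresh → none (v , fresh , ℕₚ.n≢0⇒n>0 tall)
    ...   | yes (c , c∉ , 1≤c) with Finₚ.any? (λ v → fresh? (root c ∷ root b ∷ root a ∷ []) v ×-dec 1 ℕ.≤? height v)
    ...     | yes (d , d∉ , 1≤d) = even-fourth g≡ h₁≤ c c∉ 1≤c d d∉ 1≤d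
    ...     | no none = even-few g≡ (trans h₁≡h₂ h₂≡) h₂≡ c λ v tall → member₃ c λ fresh → none (v , fresh , ℕₚ.n≢0⇒n>0 tall)

  -- The centre in the tallest tree: p + h₂ ≤ h₁

  -- The cycle together with the path from a to it.
  S₁ : Sub
  S₁ = Grown.S grown₁

  S₁-entry : ∀ v → ∃ λ k → S₁ (iter k v) ≡ true × (∀ i → i ℕ.< k → S₁ (iter i v) ≡ false)
  S₁-entry v = entry S₁ v (height v , Grown.cycle grown₁ (root-onC v))

  -- For v in the tree of a, the length of its branch off the path from a to the cycle.
  branch : Fin n → ℕ
  branch v = proj₁ (S₁-entry v)

  branch≤height : ∀ v → branch v ℕ.≤ height v
  branch≤height v = ℕₚ.≮⇒≥ λ h<b → true≢false (Grown.cycle grown₁ (root-onC v)) (proj₂ (proj₂ (S₁-entry v)) (height v) h<b)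

  -- From the meeting point h₁ - i steps remain to the cycle, so branch v ≤ i because v is no higher
  -- than a. If the meeting point lies on the cycle, then i = h₁.
  branch-point : ∀ v → root v ≡ root a → ∃ λ i → iter (branch v) v ≡ iter i a × branch v ℕ.≤ i × i ℕ.≤ h₁
  branch-point v r≡ with proj₂ (grow grown₀ a λ ()) (iter (branch v) v) (proj₁ (proj₂ (S₁-entry v)))
  ... | inj₁ c = h₁ , trans (cong (λ k → iter k v) b≡h) r≡ , subst (ℕ._≤ h₁) (sym b≡h) (height≤a v) , ℕₚ.≤-refl
    where
    b≡h : branch v ≡ height v
    b≡h with ℕₚ.m≤n⇒m<n∨m≡n (branch≤height v)
    ... | inj₁ b<h = ⊥-elim (below-height v (branch v) b<h (SC-elim c))
    ... | inj₂ eq  = eq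
  ... | inj₂ (i , i<h₁ , eq) = i , eq , b≤i , ℕₚ.<⇒≤ i<h₁
    where
    same-height : height v ℕ.∸ branch v ≡ h₁ ℕ.∸ i
    same-height = trans (sym (height-iter v (branch≤height v))) (trans (cong height eq) (height-iter a (ℕₚ.<⇒≤ i<h₁)))
    b≤i : branch v ℕ.≤ i
    b≤i = begin
      branch v                              ≡⟨ ℕₚ.m∸[m∸n]≡n (branch≤height v) ⟨
      height v ℕ.∸ (height v ℕ.∸ branch v)  ≡⟨ cong (height v ℕ.∸_) same-height ⟩
      height v ℕ.∸ (h₁ ℕ.∸ i)               ≤⟨ ℕₚ.∸-monoˡ-≤ (h₁ ℕ.∸ i) (height≤a v) ⟩
      h₁ ℕ.∸ (h₁ ℕ.∸ i)                     ≡⟨ ℕₚ.m∸[m∸n]≡n (ℕₚ.<⇒≤ i<h₁) ⟩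
      i                                     ∎
      where open ℕₚ.≤-Reasoning

  abstract
    longest : ∃ λ c → root c ≡ root a × (∀ v → root v ≡ root a → branch v ℕ.≤ branch c)
    longest = argmax branch (λ v → root v Fin.≟ root a) (a , refl)

  module _ {p : ℕ} (g≤ : g ℕ.≤ suc (p ℕ.+ p)) where

    -- The centre is s steps from a towards the cycle. Vertices outside the tree of a are at most h₁
    -- - s + p + h₂ away. A branch leaving the path i ≤ s steps from a has length at most i and so
    -- stays within s; one leaving later is reached within h₁ - s + branch v.
    tall-within : ∀ {s} → s ℕ.≤ h₁ → h₁ ℕ.+ (p ℕ.+ h₂) ℕ.≤ s ℕ.+ s →
      (∀ v → root v ≡ root a → h₁ ℕ.+ branch v ℕ.≤ s ℕ.+ s) → ∀ v → W s (iter s a) v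
    tall-within {s} s≤h₁ outside inside v with root v Fin.≟ root a
    ... | no neq = within-mono G bound
          (within-trans G (within-forward s h₁ a s≤h₁) (within-trans G (within-cycle g≤ (root-onC a) (root-onC v)) (within-root v)))
      where
      bound : h₁ ℕ.∸ s ℕ.+ (p ℕ.+ height v) ℕ.≤ s
      bound = ℕₚ.≤-trans (ℕₚ.+-monoʳ-≤ (h₁ ℕ.∸ s) (ℕₚ.+-monoʳ-≤ p (height≤b v neq)))
        (subst (ℕ._≤ s) (ℕₚ.+-∸-comm (p ℕ.+ h₂) s≤h₁) (ℕₚ.m≤n+o⇒m∸n≤o _ s outside))
    ... | yes eq with branch-point v eq
    ...   | i , meet , b≤i , i≤h₁ = close (ℕₚ.≤-total i s)
      where
      climb : W (branch v) (iter i a) v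
      climb = within-sym G (subst (W (branch v) v) meet (within-iter (branch v) v))
      close : i ℕ.≤ s ⊎ s ℕ.≤ i → W s (iter s a) v
      close (inj₁ i≤s) = within-mono G
        (ℕₚ.≤-trans (ℕₚ.+-monoʳ-≤ (s ℕ.∸ i) b≤i) (ℕₚ.≤-reflexive (ℕₚ.m∸n+n≡m i≤s)))
        (within-trans G (within-sym G (within-forward i s a i≤s)) climb)
      close (inj₂ s≤i) = within-mono G
        (ℕₚ.≤-trans (ℕₚ.+-monoˡ-≤ (branch v) (ℕₚ.∸-monoˡ-≤ s i≤h₁))
          (subst (ℕ._≤ s) (ℕₚ.+-∸-comm (branch v) s≤h₁) (ℕₚ.m≤n+o⇒m∸n≤o _ s (inside v eq))))
        (within-trans G (within-forward s i a s≤i) climb)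

    -- The radius is half of h₁ + max(Q, p + h₂), rounded up. If p + h₂ is the larger, rounding
    -- costs 5 tenths and the two trees 4, which the excess 5 (g - p) ≥ 9 pays for.
    tall : p ℕ.* 5 ℕ.+ 9 ℕ.≤ g ℕ.* 5 → p ℕ.+ h₂ ℕ.≤ h₁ → Bounded
    tall 5p+9≤5g p+h₂≤h₁ = cases (ℕₚ.≤-total Q (p ℕ.+ h₂))
      where
      c : Fin n
      c = proj₁ longest
      Q : ℕ
      Q = branch c
      branch≤Q : ∀ v → root v ≡ root a → branch v ℕ.≤ Q
      branch≤Q = proj₂ (proj₂ longest)
      arith₁ : ∀ s p h₁ h₂ k₁ k₂ g → s ℕ.* 10 ℕ.+ (suc (h₁ ℕ.+ (p ℕ.+ h₂)) ℕ.* 5 ℕ.+ ((2 ℕ.+ k₁) ℕ.+ ((2 ℕ.+ k₂) ℕ.+ g ℕ.* 5))) ℕ.+ 0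
        ≡ g ℕ.* 5 ℕ.+ k₁ ℕ.+ k₂ ℕ.+ ((s ℕ.+ s) ℕ.* 5 ℕ.+ (h₁ ℕ.* 5 ℕ.+ (h₂ ℕ.* 5 ℕ.+ (p ℕ.* 5 ℕ.+ 9))))
      arith₁ = solve-∀
      arith₂ : ∀ s h₁ Q k₁ k g → s ℕ.* 10 ℕ.+ (suc (h₁ ℕ.+ Q) ℕ.* 5 ℕ.+ ((2 ℕ.+ k₁) ℕ.+ ((5 ℕ.+ k) ℕ.+ g ℕ.* 5))) ℕ.+ 3
        ≡ g ℕ.* 5 ℕ.+ k₁ ℕ.+ k ℕ.+ ((s ℕ.+ s) ℕ.* 5 ℕ.+ (h₁ ℕ.* 5 ℕ.+ (Q ℕ.* 5 ℕ.+ 15)))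
      arith₂ = solve-∀
      half≤ : ∀ {s D h} → s ℕ.+ s ℕ.≤ suc (h ℕ.+ D) → D ℕ.≤ h → s ℕ.≤ h
      half≤ {s} {D} {h} 2s≤ D≤h = ℕₚ.≮⇒≥ λ h<s → ℕₚ.<-irrefl refl
        (ℕₚ.≤-trans (subst (ℕ._≤ s ℕ.+ s) (cong suc (ℕₚ.+-suc h h)) (ℕₚ.+-mono-≤ h<s h<s))
          (ℕₚ.≤-trans 2s≤ (s≤s (ℕₚ.+-monoʳ-≤ h D≤h))))
      Q≤h₁ : Q ℕ.≤ h₁
      Q≤h₁ = ℕₚ.≤-trans (branch≤height c) (height≤a c)
      outside-longest : (∃ λ s → h₁ ℕ.+ (p ℕ.+ h₂) ℕ.≤ s ℕ.+ s × s ℕ.+ s ℕ.≤ suc (h₁ ℕ.+ (p ℕ.+ h₂))) → Q ℕ.≤ p ℕ.+ h₂ → Bounded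
      outside-longest (s , D≤2s , 2s≤D) Q≤ = s , iter s a ,
        tall-within (half≤ 2s≤D p+h₂≤h₁) D≤2s
          (λ v eq → ℕₚ.≤-trans (ℕₚ.+-monoʳ-≤ h₁ (ℕₚ.≤-trans (branch≤Q v eq) Q≤)) D≤2s) ,
        Low-≤ (linear (ℕₚ.*-monoˡ-≤ 5 2s≤D ⊹ gain-≥ h₁ ⊹ gain-≥ h₂ ⊹ 5p+9≤5g) _ _ 0 (arith₁ s p h₁ h₂ k₁ k₂ g))
          (Grown-full grown₂)
      extended : Chain S₁ c Q (g ℕ.* 5 ℕ.+ k₁ ℕ.+ (Q ℕ.* 5 ℕ.∸ 5))
      extended = chain-any (Grown.closed grown₁) Q c (proj₁ (proj₂ (S₁-entry c))) (proj₂ (proj₂ (S₁-entry c))) _ (Grown.low grown₁)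
      inside-longest : (∃ λ s → h₁ ℕ.+ Q ℕ.≤ s ℕ.+ s × s ℕ.+ s ℕ.≤ suc (h₁ ℕ.+ Q)) → p ℕ.+ h₂ ℕ.≤ Q → Bounded
      inside-longest (s , D≤2s , 2s≤D) ≤Q = s , iter s a ,
        tall-within (half≤ 2s≤D Q≤h₁) (ℕₚ.≤-trans (ℕₚ.+-monoʳ-≤ h₁ ≤Q) D≤2s)
          (λ v eq → ℕₚ.≤-trans (ℕₚ.+-monoʳ-≤ h₁ (branch≤Q v eq)) D≤2s) ,
        -- The costs are 5 tenths for rounding, 5 for the first vertex of the branch and 2 for the
        -- path from a, against 5 g ≥ 15.
        Low-≤ (linear (ℕₚ.*-monoˡ-≤ 5 2s≤D ⊹ gain-≥ h₁ ⊹ ℕₚ.m≤n+m∸n (Q ℕ.* 5) 5 ⊹ ℕₚ.*-monoˡ-≤ 5 3≤g) _ _ 3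
            (arith₂ s h₁ Q k₁ (Q ℕ.* 5 ℕ.∸ 5) g))
          (Low-full (Chain.closed extended)
            (λ v → height v , Chain.old extended _ (Grown.cycle grown₁ (root-onC v))) (Chain.low extended))
      cases : Q ℕ.≤ p ℕ.+ h₂ ⊎ p ℕ.+ h₂ ℕ.≤ Q → Bounded
      cases (inj₁ Q≤) = outside-longest (half (h₁ ℕ.+ (p ℕ.+ h₂))) Q≤
      cases (inj₂ ≤Q) = inside-longest (half (h₁ ℕ.+ Q)) ≤Q

  bounded : Bounded
  bounded with parity g
  ... | p , inj₂ g≡ with ℕₚ.≤-total h₁ (p ℕ.+ h₂)
  ...   | inj₁ h₁≤ = balanced-odd g≡ h₁≤
  ...   | inj₂ ≤h₁ = tall (ℕₚ.≤-reflexive g≡) (subst (λ g → p ℕ.* 5 ℕ.+ 9 ℕ.≤ g ℕ.* 5) (sym g≡) (room p (subst (3 ℕ.≤_) g≡ 3≤g))) ≤h₁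
    where
    arith : ∀ q → suc q ℕ.* 5 ℕ.+ 9 ℕ.+ (q ℕ.* 5 ℕ.+ 1) ≡ suc (suc q ℕ.+ suc q) ℕ.* 5
    arith = solve-∀
    room : ∀ p → 3 ℕ.≤ suc (p ℕ.+ p) → p ℕ.* 5 ℕ.+ 9 ℕ.≤ suc (p ℕ.+ p) ℕ.* 5
    room zero    (s≤s ())
    room (suc q) _ = m+n≡o⇒m≤o _ _ (arith q)
  bounded | p , inj₁ g≡ with ℕₚ.≤-total h₁ (p ℕ.+ h₂)
  ...   | inj₁ h₁≤ = balanced-even g≡ h₁≤
  ...   | inj₂ ≤h₁ = tall (ℕₚ.≤-trans (ℕₚ.≤-reflexive g≡) (ℕₚ.n≤1+n _))
    (subst (λ g → p ℕ.* 5 ℕ.+ 9 ℕ.≤ g ℕ.* 5) (sym g≡) (room p (subst (3 ℕ.≤_) g≡ 3≤g))) ≤h₁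
    where
    arith : ∀ q → suc (suc q) ℕ.* 5 ℕ.+ 9 ℕ.+ (q ℕ.* 5 ℕ.+ 1) ≡ (suc (suc q) ℕ.+ suc (suc q)) ℕ.* 5
    arith = solve-∀
    room : ∀ p → 3 ℕ.≤ p ℕ.+ p → p ℕ.* 5 ℕ.+ 9 ℕ.≤ (p ℕ.+ p) ℕ.* 5
    room zero          ()
    room (suc zero)    (s≤s (s≤s ()))
    room (suc (suc q)) _ = m+n≡o⇒m≤o _ _ (arith q)

-- Distances and the radius

module _ {n} (G : Graph n) where

  walk? : ∀ ℓ u v → Dec (Walk G u v ℓ)
  walk? zero u v with u Fin.≟ v
  ... | yes refl = yes walk-here
  ... | no u≢v   = no λ { walk-here → u≢v refl }
  walk? (suc ℓ) u v with Finₚ.any? (λ w → (adj G u w Bool.≟ true) ×-dec walk? ℓ w v)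
  ... | yes (w , e , p) = yes (walk-step e p)
  ... | no none = no λ { (walk-step {v = w} e p) → none (w , e , p) }

  dist : ∀ {u v ℓ} → Walk G u v ℓ → ∃ λ d → IsDist G u v d × d ℕ.≤ ℓ
  dist {u} {v} {ℓ} p with least (λ k → walk? k u v) ℓ p
  ... | d , q , d≤ℓ , min = d , (q , λ k w → ℕₚ.≮⇒≥ λ k<d → min k k<d w) , d≤ℓ

  -- `IsRadius` compares r with exact eccentricities, so the eccentricity of c is first realised as
  -- the largest distance from c, which is at most R.
  radius-≤ : ∀ {r R c} → IsRadius G r → (∀ v → Within G R c v) → r ℕ.≤ R
  radius-≤ {r} {R} {c} (_ , min) within = ℕₚ.≤-trans (min c (d far) ((far , isDist far) , ecc)) (d≤R far)
    where
    nearest : ∀ v → ∃ λ d → IsDist G c v d × d ℕ.≤ proj₁ (within v)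
    nearest v = dist (proj₂ (proj₂ (within v)))
    d : Fin n → ℕ
    d v = proj₁ (nearest v)
    isDist : ∀ v → IsDist G c v (d v)
    isDist v = proj₁ (proj₂ (nearest v))
    d≤R : ∀ v → d v ℕ.≤ R
    d≤R v = ℕₚ.≤-trans (proj₂ (proj₂ (nearest v))) (proj₁ (proj₂ (within v)))
    farthest : ∃ λ v → v ≡ v × (∀ w → w ≡ w → d w ℕ.≤ d v)
    farthest = argmax d (λ v → v Fin.≟ v) (c , refl)
    far : Fin n
    far = proj₁ farthest
    ecc : ∀ v k → IsDist G c v k → k ℕ.≤ d far
    ecc v k (_ , least-k) = ℕₚ.≤-trans (least-k (d v) (proj₁ (isDist v))) (proj₂ (proj₂ farthest) v refl)

-- A spanning unicyclic subgraph

-- The value of `parent` at the root z is prescribed: y = z gives a plain tree, and for y the other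
-- end of an extra edge at z, `parent` becomes the map f of a unicyclic graph.
record Tree {n} (G : Graph n) (z y : Fin n) : Set where
  field
    parent   : Fin n → Fin n
    depth    : Fin n → ℕ
    top      : parent z ≡ y
    adjacent : ∀ {v} → v ≢ z → adj G v (parent v) ≡ true
    shallow  : ∀ {v} → v ≢ z → depth (parent v) ℕ.< depth v

abstract
  -- The parent is the second vertex of a shortest walk to z, and the depth is the length of that
  -- walk.
  bfs : ∀ {n} (G : Graph n) z y → (∀ v → ∃ λ ℓ → Walk G v z ℓ) → Tree G z y
  bfs {n} G z y reach = record { parent = parent ; depth = depth ; top = top ; adjacent = adjacent ; shallow = shallow }
    where
    nearest : ∀ v → ∃ λ d → IsDist G v z d × d ℕ.≤ proj₁ (reach v)
    nearest v = dist G (proj₂ (reach v))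
    depth : Fin n → ℕ
    depth v = proj₁ (nearest v)
    step : ∀ {v} → v ≢ z → ∃ λ w → adj G v w ≡ true × depth w ℕ.< depth v
    step {v} v≢z = first (proj₁ (proj₁ (proj₂ (nearest v))))
      where
      first : ∀ {d} → Walk G v z d → ∃ λ w → adj G v w ≡ true × depth w ℕ.< d
      first walk-here = ⊥-elim (v≢z refl)
      first (walk-step {v = w} e p) = w , e , s≤s (proj₂ (proj₁ (proj₂ (nearest w))) _ p)
    parent : Fin n → Fin n
    parent v with v Fin.≟ z
    ... | yes _  = y
    ... | no v≢z = proj₁ (step v≢z)
    top : parent z ≡ y
    top with z Fin.≟ z
    ... | yes _  = refl
    ... | no z≢z = ⊥-elim (z≢z refl)
    adjacent : ∀ {v} → v ≢ z → adj G v (parent v) ≡ true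
    adjacent {v} v≢z with v Fin.≟ z
    ... | yes eq  = ⊥-elim (v≢z eq)
    ... | no v≢z′ = proj₁ (proj₂ (step v≢z′))
    shallow : ∀ {v} → v ≢ z → depth (parent v) ℕ.< depth v
    shallow {v} v≢z with v Fin.≟ z
    ... | yes eq  = ⊥-elim (v≢z eq)
    ... | no v≢z′ = proj₂ (proj₂ (step v≢z′))

indicator : ∀ {n} → Fin n → Fin n → ℕ
indicator i j = Sℕ.when (does (j Fin.≟ i)) 1

sum-indicator : ∀ {n} (i : Fin n) → Sℕ.sum (indicator i) ≡ 1
sum-indicator i = Sℕ.sum-pick i (λ _ → 1)

sum-const : ∀ n k → Sℕ.sum {n} (λ _ → k) ≡ n ℕ.* k
sum-const zero    k = refl
sum-const (suc n) k = cong (k ℕ.+_) (sum-const n k)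

sum-arcs : ∀ {n} (f : Fin n → Fin n) →
  Sℕ.sum (λ i → Sℕ.sum (λ j → indicator (f i) j ℕ.+ indicator (f j) i)) ≡ n ℕ.+ n
sum-arcs {n} f = begin
  Sℕ.sum (λ i → Sℕ.sum (λ j → indicator (f i) j ℕ.+ indicator (f j) i))
    ≡⟨ Sℕ.sum-cong-≗ (λ i → Sℕ.∑-distrib-+ (λ j → indicator (f i) j) (λ j → indicator (f j) i)) ⟩
  Sℕ.sum (λ i → Sℕ.sum (λ j → indicator (f i) j) ℕ.+ Sℕ.sum (λ j → indicator (f j) i))
    ≡⟨ Sℕ.∑-distrib-+ (λ i → Sℕ.sum (λ j → indicator (f i) j)) (λ i → Sℕ.sum (λ j → indicator (f j) i)) ⟩
  Sℕ.sum (λ i → Sℕ.sum (λ j → indicator (f i) j)) ℕ.+ Sℕ.sum (λ i → Sℕ.sum (λ j → indicator (f j) i))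
    ≡⟨ cong₂ ℕ._+_ ones (trans (Sℕ.∑-comm (λ i j → indicator (f j) i)) ones) ⟩
  n ℕ.+ n ∎
  where
  open ≡-Reasoning
  ones : Sℕ.sum (λ i → Sℕ.sum (λ j → indicator (f i) j)) ≡ n
  ones = trans (Sℕ.sum-cong-≗ λ i → sum-indicator (f i)) (trans (sum-const n 1) (ℕₚ.*-identityʳ n))

double-cancel-≤ℕ : ∀ {a b} → a ℕ.+ a ℕ.≤ b ℕ.+ b → a ℕ.≤ b
double-cancel-≤ℕ {a} {b} le = ℕₚ.≮⇒≥ λ b<a → ℕₚ.<⇒≱ (ℕₚ.+-mono-< b<a b<a) le

-- If all edges were tree edges, the ordered adjacent pairs, 2|E| in number, would be among the 2n pairs (i , parent i)
-- and (parent i , i); but parent z = z is a junk value, and (z , z) is counted twice.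
non-tree-edge : ∀ {n} (G : Graph n) {z} (T : Tree G z z) → n ℕ.≤ edgeCount G →
  ∃ λ x → ∃ λ y → adj G x y ≡ true × Tree.parent T x ≢ y × Tree.parent T y ≢ x
non-tree-edge {n} G {z} T n≤e
  with Finₚ.any? (λ x → Finₚ.any? (λ y → (adj G x y Bool.≟ true) ×-dec ¬? (Tree.parent T x Fin.≟ y) ×-dec ¬? (Tree.parent T y Fin.≟ x)))
... | yes found = found
... | no none = ⊥-elim (ℕₚ.<⇒≱ (ℕₚ.m<m+n (n ℕ.+ n) {2} (s≤s z≤n)) (begin
  n ℕ.+ n ℕ.+ 2
    ≤⟨ ℕₚ.+-monoˡ-≤ 2 (ℕₚ.+-mono-≤ n≤e n≤e) ⟩
  edgeCount G ℕ.+ edgeCount G ℕ.+ 2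
    ≡⟨ cong₂ ℕ._+_ (trans (edge-double G) (Sℕ.sum-cong-≗ (deg-sum G))) (sym corner) ⟩
  Sℕ.sum (λ i → Sℕ.sum (edgeᵢ i)) ℕ.+ Sℕ.sum (λ i → Sℕ.sum (corner-at i))
    ≡⟨ Sℕ.∑-distrib-+ (λ i → Sℕ.sum (edgeᵢ i)) (λ i → Sℕ.sum (corner-at i)) ⟨
  Sℕ.sum (λ i → Sℕ.sum (edgeᵢ i) ℕ.+ Sℕ.sum (corner-at i))
    ≡⟨ Sℕ.sum-cong-≗ (λ i → Sℕ.∑-distrib-+ (edgeᵢ i) (corner-at i)) ⟨
  Sℕ.sum (λ i → Sℕ.sum (λ j → edgeᵢ i j ℕ.+ corner-at i j))
    ≤⟨ sumℕ-mono (λ i → sumℕ-mono (le i)) ⟩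
  Sℕ.sum (λ i → Sℕ.sum (λ j → indicator (parent i) j ℕ.+ indicator (parent j) i))
    ≡⟨ sum-arcs parent ⟩
  n ℕ.+ n ∎))
  where
  open ℕₚ.≤-Reasoning
  open Tree T
  edgeᵢ corner-at : Fin n → Fin n → ℕ
  edgeᵢ i j = Sℕ.when (adj G i j) 1
  corner-at i j = Sℕ.when (does (i Fin.≟ z)) (Sℕ.when (does (j Fin.≟ z)) 2)
  corner : Sℕ.sum (λ i → Sℕ.sum (corner-at i)) ≡ 2
  corner = trans (Sℕ.∑-comm corner-at) (trans
    (Sℕ.sum-cong-≗ λ j → Sℕ.sum-pick z (λ _ → Sℕ.when (does (j Fin.≟ z)) 2)) (Sℕ.sum-pick z (λ _ → 2)))
  hit : ∀ {i j : Fin n} → i ≡ j → 1 ℕ.≤ indicator i j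
  hit {i} refl with i Fin.≟ i
  ... | yes _ = ℕₚ.≤-refl
  ... | no ne = ⊥-elim (ne refl)
  covered : ∀ i j → edgeᵢ i j ℕ.≤ indicator (parent i) j ℕ.+ indicator (parent j) i
  covered i j with adj G i j in ij
  ... | false = z≤n
  ... | true with parent i Fin.≟ j | parent j Fin.≟ i
  ...   | yes p | _     = ℕₚ.≤-trans (hit p) (ℕₚ.m≤m+n _ _)
  ...   | no _  | yes q = ℕₚ.≤-trans (hit q) (ℕₚ.m≤n+m _ _)
  ...   | no p  | no q  = ⊥-elim (none (i , j , ij , p , q))
  le : ∀ i j → edgeᵢ i j ℕ.+ corner-at i j ℕ.≤ indicator (parent i) j ℕ.+ indicator (parent j) i
  le i j = cases (i Fin.≟ z) (j Fin.≟ z)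
    where
    cases : (p : Dec (i ≡ z)) (q : Dec (j ≡ z)) →
      edgeᵢ i j ℕ.+ Sℕ.when (does p) (Sℕ.when (does q) 2) ℕ.≤ indicator (parent i) j ℕ.+ indicator (parent j) i
    cases (no _) _ = ℕₚ.≤-trans (ℕₚ.≤-reflexive (ℕₚ.+-identityʳ _)) (covered i j)
    cases (yes _) (no _) = ℕₚ.≤-trans (ℕₚ.≤-reflexive (ℕₚ.+-identityʳ _)) (covered i j)
    cases (yes refl) (yes refl) rewrite adj-irrefl G z = ℕₚ.+-mono-≤ (hit top) (hit top)

module _ {n} (G : Graph n) (u v : Fin n) where

  private
    endpoints : Fin n → Fin n → Bool
    endpoints i j = (does (i Fin.≟ u) ∧ does (j Fin.≟ v)) ∨ (does (i Fin.≟ v) ∧ does (j Fin.≟ u))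

    endpoints-elim : ∀ i j → endpoints i j ≡ true → (i ≡ u × j ≡ v) ⊎ (i ≡ v × j ≡ u)
    endpoints-elim i j p with ∨-elim {does (i Fin.≟ u) ∧ does (j Fin.≟ v)} p
    ... | inj₁ q = inj₁ (does⇒ (i Fin.≟ u) (Bool.∧-conicalˡ _ _ q) , does⇒ (j Fin.≟ v) (Bool.∧-conicalʳ (does (i Fin.≟ u)) _ q))
    ... | inj₂ q = inj₂ (does⇒ (i Fin.≟ v) (Bool.∧-conicalˡ _ _ q) , does⇒ (j Fin.≟ u) (Bool.∧-conicalʳ (does (i Fin.≟ v)) _ q))

    endpoints-sym : ∀ i j → endpoints i j ≡ endpoints j i
    endpoints-sym i j = trans (Bool.∨-comm (does (i Fin.≟ u) ∧ does (j Fin.≟ v)) _)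
      (cong₂ _∨_ (Bool.∧-comm (does (i Fin.≟ v)) _) (Bool.∧-comm (does (i Fin.≟ u)) _))

  removeEdge : Graph n
  removeEdge = record
    { adj    = λ i j → adj G i j ∧ not (endpoints i j)
    ; sym    = λ i j → cong₂ (λ b c → b ∧ not c) (adj-sym G i j) (endpoints-sym i j)
    ; irrefl = λ i → cong (_∧ not (endpoints i i)) (adj-irrefl G i)
    }

  removeEdge-other : ∀ i j → ¬ (i ≡ u × j ≡ v) → ¬ (i ≡ v × j ≡ u) → adj G i j ≡ adj removeEdge i j
  removeEdge-other i j ¬p ¬q = sym (trans (cong (λ b → adj G i j ∧ not b) (≢true⇒false λ r → none (endpoints-elim i j r)))
    (Bool.∧-identityʳ (adj G i j)))
    where
    none : (i ≡ u × j ≡ v) ⊎ (i ≡ v × j ≡ u) → ⊥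
    none (inj₁ p) = ¬p p
    none (inj₂ q) = ¬q q

  removeEdge-add : adj G u v ≡ true → AddEdge removeEdge G u v
  removeEdge-add uv = record
    { old  = trans (cong (λ b → adj G u v ∧ not b) (∨-introˡ _ (cong₂ _∧_ (dec-true (u Fin.≟ u) refl) (dec-true (v Fin.≟ v) refl))))
               (Bool.∧-zeroʳ (adj G u v))
    ; new  = uv
    ; same = removeEdge-other
    }

record Orientation {n} (G : Graph n) : Set where
  field
    f     : Fin n → Fin n
    ff    : ∀ v → f (f v) ≢ v
    x     : Fin n
    reach : ∀ v → ∃ λ k → Functional.iter f ff k v ≡ x
    edge  : ∀ v → adj G v (f v) ≡ true

-- A first spanning tree leaves out an edge xy and survives in G - xy, which is therefore connected.
-- A second tree, in G - xy with root x and parent of x set to y, is f.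
orientation : ∀ {n} (G : Graph n) → Connected G → Fin n → n ℕ.≤ edgeCount G → Orientation G
orientation {n} G connected z n≤e with bfs G z z (λ v → connected v z)
... | T with non-tree-edge G T n≤e
...   | x , y , xy , px≢y , py≢x = record { f = f ; ff = ff ; x = x ; reach = λ v → reach _ v ℕₚ.≤-refl ; edge = edge }
  where
  G′ : Graph n
  G′ = removeEdge G x y
  open AddEdge (removeEdge-add G x y xy)
  climb : ∀ d v → Tree.depth T v ℕ.≤ d → ∃ λ ℓ → Walk G′ v z ℓ
  climb d v le with v Fin.≟ z
  climb d v le | yes refl = 0 , walk-here
  climb zero v le | no v≢z = ⊥-elim (ℕₚ.<⇒≱ (Tree.shallow T v≢z) (ℕₚ.≤-trans le z≤n))
  climb (suc d) v le | no v≢z with climb d (Tree.parent T v) (ℕₚ.≤-pred (ℕₚ.<-≤-trans (Tree.shallow T v≢z) le))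
  ... | ℓ , w = suc ℓ , walk-step (trans (sym (same v (Tree.parent T v)
      (λ { (refl , eq) → px≢y eq }) (λ { (refl , eq) → py≢x eq }))) (Tree.adjacent T v≢z)) w
  to-x : ∀ v → ∃ λ ℓ → Walk G′ v x ℓ
  to-x v = _ , walk-++ G′ (proj₂ (climb _ v ℕₚ.≤-refl)) (walk-reverse G′ (proj₂ (climb _ x ℕₚ.≤-refl)))
  T′ : Tree G′ x y
  T′ = bfs G′ x y to-x
  open Tree T′ renaming (parent to f)
  y≢x : y ≢ x
  y≢x eq = distinct (sym eq)
  -- As xy has been deleted, the parent of y is not x; otherwise x and y would form a 2-cycle.
  not-back : ∀ {v} → v ≢ x → f v ≡ x → v ≢ y
  not-back v≢x fv≡x refl = true≢false (trans (cong (adj G′ y) (sym fv≡x)) (adjacent v≢x)) (trans (adj-sym G′ y x) old)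
  ff : ∀ v → f (f v) ≢ v
  ff v eq with v Fin.≟ x
  ... | yes refl = not-back y≢x (trans (cong f (sym top)) eq) refl
  ... | no v≢x with f v Fin.≟ x
  ...   | yes fv≡x = not-back v≢x fv≡x (sym (trans (sym top) (trans (cong f (sym fv≡x)) eq)))
  ...   | no fv≢x  = ℕₚ.<-irrefl (cong depth eq) (ℕₚ.<-trans (shallow fv≢x) (shallow v≢x))
  open Functional f ff
  reach : ∀ d v → depth v ℕ.≤ d → ∃ λ k → iter k v ≡ x
  reach d v le with v Fin.≟ x
  reach d v le | yes eq = 0 , eq
  reach zero v le | no v≢x = ⊥-elim (ℕₚ.<⇒≱ (shallow v≢x) (ℕₚ.≤-trans le z≤n))
  reach (suc d) v le | no v≢x with reach d (f v) (ℕₚ.≤-pred (ℕₚ.<-≤-trans (shallow v≢x) le))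
  ... | k , eq = suc k , trans (sym (iter-f k v)) eq
  edge : ∀ v → adj G v (f v) ≡ true
  edge v with v Fin.≟ x
  ... | yes refl = trans (cong (adj G x) top) xy
  ... | no v≢x   = Bool.∧-conicalˡ _ _ (adjacent v≢x)

edgeCount-add : ∀ {n} {G G⁺ : Graph n} {u v} → AddEdge G G⁺ u v → edgeCount G⁺ ≡ suc (edgeCount G)
edgeCount-add {n} {G} {G⁺} {u} {v} e = ℕₚ.≤-antisym (double-cancel-≤ℕ (ℕₚ.≤-reflexive doubled)) (double-cancel-≤ℕ (ℕₚ.≤-reflexive (sym doubled)))
  where
  open ≡-Reasoning
  open AddEdge e
  arith : ∀ a → a ℕ.+ a ℕ.+ 2 ≡ suc a ℕ.+ suc a
  arith = solve-∀
  at : ∀ i → deg G⁺ i ≡ deg G i ℕ.+ (indicator u i ℕ.+ indicator v i)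
  at i with i Fin.≟ u | i Fin.≟ v
  ... | yes refl | yes refl = ⊥-elim (distinct refl)
  ... | yes refl | no _     = trans deg-end (ℕₚ.+-comm 1 (deg G u))
  ... | no _     | yes refl = trans (AddEdge.deg-end (AddEdge-sym e)) (ℕₚ.+-comm 1 (deg G v))
  ... | no i≢u   | no i≢v   = trans (deg-other i≢u i≢v) (sym (ℕₚ.+-identityʳ _))
  doubled : edgeCount G⁺ ℕ.+ edgeCount G⁺ ≡ suc (edgeCount G) ℕ.+ suc (edgeCount G)
  doubled = begin
    edgeCount G⁺ ℕ.+ edgeCount G⁺
      ≡⟨ trans (edge-double G⁺) (Sℕ.sum-cong-≗ at) ⟩
    Sℕ.sum (λ i → deg G i ℕ.+ (indicator u i ℕ.+ indicator v i))
      ≡⟨ Sℕ.∑-distrib-+ (deg G) (λ i → indicator u i ℕ.+ indicator v i) ⟩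
    Sℕ.sum (deg G) ℕ.+ Sℕ.sum (λ i → indicator u i ℕ.+ indicator v i)
      ≡⟨ cong₂ ℕ._+_ (sym (edge-double G)) (trans (Sℕ.∑-distrib-+ (indicator u) (indicator v)) (cong₂ ℕ._+_ (sum-indicator u) (sum-indicator v))) ⟩
    edgeCount G ℕ.+ edgeCount G ℕ.+ 2
      ≡⟨ arith (edgeCount G) ⟩
    suc (edgeCount G) ℕ.+ suc (edgeCount G) ∎

-- Deleting the edges outside the unicyclic subgraph

module Deletion {n : ℕ} (f : Fin n → Fin n) (ff : ∀ v → f (f v) ≢ v) where
  open Functional f ff

  -- The n edges from v to f v are different because there are no 2-cycles.
  n≤edgeCount-U : n ℕ.≤ edgeCount (U full)
  n≤edgeCount-U = double-cancel-≤ℕ (subst₂ ℕ._≤_ (sum-arcs f) (sym (trans (edge-double (U full)) (Sℕ.sum-cong-≗ (deg-sum (U full)))))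
    (sumℕ-mono λ i → sumℕ-mono (le i)))
    where
    le : ∀ i j → indicator (f i) j ℕ.+ indicator (f j) i ℕ.≤ Sℕ.when (adj (U full) i j) 1
    le i j with j Fin.≟ f i | i Fin.≟ f j
    ... | yes refl | yes eq   = ⊥-elim (ff i (sym eq))
    ... | yes refl | no _     rewrite U-intro full {i} refl = ℕₚ.≤-refl
    ... | no _     | yes refl rewrite U-introʳ full {j} refl = ℕₚ.≤-refl
    ... | no _     | no _     = z≤n

  module _ (G : Graph n) (edge : ∀ v → adj G v (f v) ≡ true) where

    U⊆ : ∀ i j → adj (U full) i j ≡ true → adj G i j ≡ true
    U⊆ i j p with U-elim full {i} {j} p
    ... | inj₁ (_ , refl) = edge i
    ... | inj₂ (_ , refl) = trans (adj-sym G (f j) j) (edge j)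

    deg-f : ∀ v → 2 ℕ.≤ deg G (f v)
    deg-f v = deg-≥2 G (f v) (trans (adj-sym G (f v) v) (edge v)) (edge (f v)) (λ eq → ff v (sym eq))

    keep : ∀ i j → adj (U full) i j ≡ false → ∀ v → adj (removeEdge G i j) v (f v) ≡ true
    keep i j ¬U v = trans (sym (removeEdge-other G i j v (f v)
      (λ { (refl , refl) → true≢false (U-intro full refl) ¬U })
      (λ { (refl , refl) → true≢false (U-introʳ full refl) ¬U }))) (edge v)

  -- `e` is fuel bounding the number of edges. An edge outside U is deleted while those of U remain;
  -- once there is none, G has the adjacency of U.
  delete-all : ∀ e (G : Graph n) → edgeCount G ℕ.≤ e → (∀ v → adj G v (f v) ≡ true) →
    ∃ λ m → edgeCount G ≡ edgeCount (U full) ℕ.+ m × harmonic (U full) ℚ.≤ harmonic G ℚ.+ frac (m ℕ.* 31) 104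
  delete-all e G G≤e edge
    with Finₚ.any? (λ i → Finₚ.any? (λ j → (adj G i j Bool.≟ true) ×-dec (adj (U full) i j Bool.≟ false)))
  ... | no none = 0 , trans (edgeCount-cong {G = G} {U full} same) (sym (ℕₚ.+-identityʳ _)) ,
      subst₂ ℚ._≤_ (harmonic-cong {G = G} {U full} same) refl
        (subst (ℚ._≤ harmonic G ℚ.+ frac 0 104) (ℚₚ.+-identityʳ (harmonic G)) (ℚₚ.+-monoʳ-≤ (harmonic G) (0≤frac 0 104)))
    where
    same : ∀ i j → adj G i j ≡ adj (U full) i j
    same i j = Bool-ext covered (U⊆ G edge i j)
      where
      covered : adj G i j ≡ true → adj (U full) i j ≡ true
      covered p with adj (U full) i j in q
      ... | true  = refl
      ... | false = ⊥-elim (none (i , j , p , q))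
  delete-all zero G G≤0 edge | yes (i , j , ij , _) =
    ⊥-elim (ℕₚ.<⇒≱ (s≤s z≤n) (subst (ℕ._≤ 0) (edgeCount-add (removeEdge-add G i j ij)) G≤0))
  delete-all (suc e) G G≤e edge | yes (i , j , ij , ¬U)
    with delete-all e (removeEdge G i j) (ℕₚ.≤-pred (subst (ℕ._≤ suc e) (edgeCount-add (removeEdge-add G i j ij)) G≤e)) (keep G edge i j ¬U)
  ... | m , count , bound = suc m ,
      trans (edgeCount-add added) (trans (cong suc count) (sym (ℕₚ.+-suc _ m))) , (begin
        harmonic (U full)
          ≤⟨ bound ⟩
        harmonic (removeEdge G i j) ℚ.+ frac (m ℕ.* 31) 104
          -- f i and f j are still neighbours of the ends, and values of f have degree at least two
          -- in every graph containing U.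
          ≤⟨ ℚₚ.+-monoˡ-≤ (frac (m ℕ.* 31) 104) (harmonic-delete added (f i) (edge′ i) (deg-f G′ edge′ i) (f j) (edge′ j) (deg-f G′ edge′ j)) ⟩
        harmonic G ℚ.+ frac 31 104 ℚ.+ frac (m ℕ.* 31) 104
          ≡⟨ trans (ℚₚ.+-assoc (harmonic G) _ _) (cong (harmonic G ℚ.+_) (frac-+-same 31 (m ℕ.* 31) 104)) ⟩
        harmonic G ℚ.+ frac (suc m ℕ.* 31) 104 ∎)
    where
    open ℚₚ.≤-Reasoning
    added = removeEdge-add G i j ij
    G′ = removeEdge G i j
    edge′ = keep G edge i j ¬U

-- The bound for H in terms of radius and cyclomatic number

harmonic-radius : ∀ {n} (G : Graph n) → Connected G → ∀ k → edgeCount G ≡ n ℕ.+ k → ∀ r → IsRadius G r →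
  frac r 0 ℚ.≤ harmonic G ℚ.+ frac (31 ℕ.* k) 104
harmonic-radius {n} G connected k e≡ r radius@((z , _) , _) =
  conclude (Radius.bounded f ff x reach G edge) (Deletion.delete-all f ff _ G ℕₚ.≤-refl edge)
  where
  -- The vertex z attaining the radius serves as the root of the first spanning tree.
  open Orientation (orientation G connected z (subst (n ℕ.≤_) (sym e≡) (ℕₚ.m≤m+n n k)))
  open Functional f ff using (U; full)
  conclude : Radius.Bounded f ff x reach G edge →
    (∃ λ m → edgeCount G ≡ edgeCount (U full) ℕ.+ m × harmonic (U full) ℚ.≤ harmonic G ℚ.+ frac (m ℕ.* 31) 104) →
    frac r 0 ℚ.≤ harmonic G ℚ.+ frac (31 ℕ.* k) 104
  conclude (R , c , within , low) (m , count , deleted) = begin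
    frac r 0
      ≤⟨ frac-mono 0 (radius-≤ G radius within) ⟩
    frac R 0
      ≡⟨ frac-≡ R 0 (R ℕ.* 10) 9 (sym (ℕₚ.*-identityʳ _)) ⟩
    frac (R ℕ.* 10) 9
      ≤⟨ low ⟩
    harmonic (U full)
      ≤⟨ deleted ⟩
    harmonic G ℚ.+ frac (m ℕ.* 31) 104
      ≤⟨ ℚₚ.+-monoʳ-≤ (harmonic G) (frac-mono 104 (subst (ℕ._≤ 31 ℕ.* k) (ℕₚ.*-comm 31 m) (ℕₚ.*-monoʳ-≤ 31 m≤k))) ⟩
    harmonic G ℚ.+ frac (31 ℕ.* k) 104 ∎
    where
    open ℚₚ.≤-Reasoning
    m≤k : m ℕ.≤ k
    -- n + m ≤ |E(U)| + m = |E(G)| = n + k.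
    m≤k = ℕₚ.+-cancelˡ-≤ n m k (ℕₚ.≤-trans (ℕₚ.+-monoˡ-≤ m (Deletion.n≤edgeCount-U f ff))
      (ℕₚ.≤-reflexive (trans (sym count) e≡)))

-- Passes from integers to naturals: k is the cyclomatic number less one, the number of edges to be
-- deleted.
cyclomatic-suc : ∀ {n} (G : Graph n) → (+ 1) ℤ.≤ cyclomatic G →
  ∃ λ k → edgeCount G ≡ n ℕ.+ k × cyclomatic G ≡ + suc k
cyclomatic-suc {n} G 1≤c = k , sym n+k≡e , (begin
  + edgeCount G ℤ.- + n ℤ.+ + 1   ≡⟨ cong (λ e → + e ℤ.- + n ℤ.+ + 1) n+k≡e ⟨
  + (n ℕ.+ k) ℤ.- + n ℤ.+ + 1     ≡⟨ arith (+ n) (+ k) ⟩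
  + 1 ℤ.+ + k                     ∎)
  where
  open ≡-Reasoning
  cancel : ∀ i → i ℤ.+ + 1 ℤ.+ ℤ.-1ℤ ≡ i
  cancel = ℤ-Solver.solve-∀
  n≤e : n ℕ.≤ edgeCount G
  n≤e = ℤₚ.drop‿+≤+ (ℤₚ.0≤i-j⇒j≤i (subst (+ 0 ℤ.≤_) (cancel (+ edgeCount G ℤ.- + n)) (ℤₚ.+-monoˡ-≤ ℤ.-1ℤ 1≤c)))
  k : ℕ
  k = edgeCount G ℕ.∸ n
  n+k≡e : n ℕ.+ k ≡ edgeCount G
  n+k≡e = ℕₚ.m+[n∸m]≡n n≤e
  arith : ∀ n k → n ℤ.+ k ℤ.- n ℤ.+ + 1 ≡ + 1 ℤ.+ k
  arith = ℤ-Solver.solve-∀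

≤-+⇒-≤ : ∀ {p q} r → p ℚ.≤ q ℚ.+ r → p ℚ.- r ℚ.≤ q
≤-+⇒-≤ {p} {q} r le = subst (p ℚ.- r ℚ.≤_) (lemma q r) (ℚₚ.+-monoˡ-≤ (ℚ.- r) le)
  where
  lemma : ∀ q r → q ℚ.+ r ℚ.- r ≡ q
  lemma = solve 2 (λ q r → q :+ r :- r := q) refl

theorem3 : ∀ {n : ℕ} (G : Graph n) → Connected G → (+ 1) ℤ.≤ cyclomatic G →
    ∀ (r : ℕ) → IsRadius G r →
    (harmonic G ℚ.≥ ((+ r) ℚ./ 1) ℚ.- ((+ 31) ℚ./ 105) ℚ.* ((cyclomatic G ℤ.- (+ 1)) ℚ./ 1))
    × (cyclomatic G ℤ.≤ (+ 4) → harmonic G ℚ.> ((+ r) ℚ./ 1) ℚ.- ((+ 1) ℚ./ 1))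
theorem3 {n} G connected 1≤c r radius = from (cyclomatic-suc G 1≤c)
  where
  from : (∃ λ k → edgeCount G ≡ n ℕ.+ k × cyclomatic G ≡ + suc k) →
    (harmonic G ℚ.≥ ((+ r) ℚ./ 1) ℚ.- ((+ 31) ℚ./ 105) ℚ.* ((cyclomatic G ℤ.- (+ 1)) ℚ./ 1))
    × (cyclomatic G ℤ.≤ (+ 4) → harmonic G ℚ.> ((+ r) ℚ./ 1) ℚ.- ((+ 1) ℚ./ 1))
  from (k , e≡ , c≡) rewrite c≡ = subst (λ q → ((+ r) ℚ./ 1) ℚ.- q ℚ.≤ harmonic G) (sym product) bound , strict
    where
    product : ((+ 31) ℚ./ 105) ℚ.* ((+ k) ℚ./ 1) ≡ frac (31 ℕ.* k) 104
    product = trans (cong₂ ℚ._*_ (frac-/ 31 104) (frac-/ k 0)) (frac-* 31 104 k 0)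
    bound : ((+ r) ℚ./ 1) ℚ.- frac (31 ℕ.* k) 104 ℚ.≤ harmonic G
    bound = subst (λ q → q ℚ.- frac (31 ℕ.* k) 104 ℚ.≤ harmonic G) (sym (frac-/ r 0))
      (≤-+⇒-≤ (frac (31 ℕ.* k) 104) (harmonic-radius G connected k e≡ r radius))
    strict : + suc k ℤ.≤ + 4 → ((+ r) ℚ./ 1) ℚ.- ((+ 1) ℚ./ 1) ℚ.< harmonic G
    -- k is the cyclomatic number less one, hence at most 3, and 3 · 31/105 = 93/105 < 1.
    strict (ℤ.+≤+ (s≤s k≤3)) = ℚₚ.<-≤-trans (ℚₚ.+-monoʳ-< ((+ r) ℚ./ 1) (ℚₚ.neg-antimono-< (ℚₚ.≤-<-trans
      (frac-mono 104 (ℕₚ.*-monoʳ-≤ 31 k≤3)) (subst (ℚ._< (+ 1) ℚ./ 1) (frac-/ 93 104) (from-yes (((+ 93) ℚ./ 105) ℚ.<? ((+ 1) ℚ./ 1))))))) bound
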